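{- For any integer $t\ge 0$ and for any prime $p>2t+1$, $$S^q_{p-1}(\{2\}^t)\equiv (1-q)^{2t}\sum_{i=0}^t\left(t\binom{t-1}{i}+(t-1)\binom{t}{i}\right)(-1)^{i}K_{2t-i}(p)\pmod{[p]_q}.$$
   Context: Here $q$ is an indeterminate and $[n]_q=\frac{1-q^n}{1-q}=1+q+\cdots+q^{n-1}$. For positive integers $s_1,\dots,s_l$, $$S_n^q(s_1,\ldots,s_l)=\sum_{1\le k_1\le\cdots\le k_l\le n}\prod_{i=1}^l\frac{q^{(s_i-1)k_i}}{[k_i]_q^{s_i}},\qquad S_n^q(\emptyset)=1.$$ $\{s\}^t$ denotes $t\ge 0$ consecutive copies of $s$. The rational numbers $K_n(p)$ ($n\ge0$) are defined by the expansion about $z=1$ $$\frac{p(z-1)}{z^p-1}=\sum_{n=0}^{\infty}(-1)^{n-1}K_n(p)(z-1)^n$$ (so $K_0(p)=-1$, $K_1(p)=-\frac{p-1}{2}$, $K_2(p)=-\frac{p^2-1}{12}$). For a prime $p$ and rational functions $A,B$ in $q$, $A\equiv B\pmod{[p]_q}$ means $A-B=f/g$ with $f,g$ polynomials in $q$ with integer coefficients, $g$ coprime to $[p]_q$ in $\mathbb{Q}[q]$, and $[p]_q\mid f$ ($[p]_q$ is the $p$th cyclotomic polynomial, irreducible over $\mathbb{Q}$). -}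

module Defs where

open import Level using (0ℓ)
open import Algebra.Bundles using (RawRing)
import Algebra.Definitions.RawSemiring as RawSemiringDefs
open import Data.Empty using (⊥-elim)
open import Data.Fin.Base as Fin using (Fin; toℕ)
import Data.Fin.Properties as Fin
open import Data.Integer.Base as ℤ using (ℤ)
open import Data.List.Base as List using (List; []; _∷_)
open import Data.Nat.Base as ℕ using (ℕ; zero; suc; _∸_)
open import Data.Nat.Combinatorics using (_C_)
open import Data.Product.Base using (∃-syntax; _×_; _,_)
open import Data.Rational.Base as ℚ using (ℚ; 0ℚ; 1ℚ)
import Data.Rational.Properties as ℚ
open import Data.Sum.Base using (_⊎_; inj₁; inj₂)
open import Data.Vec.Base as Vec using (Vec; []; _∷_; lookup)
open import Data.Vec.Relation.Unary.Linked using (linked?)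
open import Relation.Binary.PropositionalEquality hiding ([_])
open import Relation.Nullary using (¬_; yes; no)

------------------------------------------------------------------------
-- Polynomials in one variable

-- a₀ ∷ a₁ ∷ … ∷ aₙ ∷ [] stands for a₀ + a₁ q + … + aₙ qⁿ.  Trailing zeros
-- are allowed, so polynomials are compared coefficientwise by _≈ᴾ_, not by _≡_.

module Polynomial (R : RawRing 0ℓ 0ℓ) where
  open RawRing R

  Poly : Set
  Poly = List Carrier

  coeff : Poly → ℕ → Carrier
  coeff []      n       = 0#
  coeff (a ∷ f) zero    = a
  coeff (a ∷ f) (suc n) = coeff f n

  infix  4 _≈ᴾ_
  infixl 6 _+ᴾ_
  infixl 7 _*ᴾ_

  _≈ᴾ_ : Poly → Poly → Set
  f ≈ᴾ g = ∀ n → coeff f n ≈ coeff g n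

  _+ᴾ_ : Poly → Poly → Poly
  []      +ᴾ g       = g
  (a ∷ f) +ᴾ []      = a ∷ f
  (a ∷ f) +ᴾ (b ∷ g) = (a + b) ∷ (f +ᴾ g)

  _*ᴾ_ : Poly → Poly → Poly
  []      *ᴾ g = []
  (a ∷ f) *ᴾ g = List.map (a *_) g +ᴾ (0# ∷ (f *ᴾ g))

  polyRawRing : RawRing 0ℓ 0ℓ
  polyRawRing = record
    { Carrier = Poly
    ; _≈_     = _≈ᴾ_
    ; _+_     = _+ᴾ_
    ; _*_     = _*ᴾ_
    ; -_      = List.map (-_)
    ; 0#      = []
    ; 1#      = 1# ∷ []
    }

  open RawSemiringDefs (RawRing.rawSemiring polyRawRing) public
    using () renaming (_^_ to _^ᴾ_; _∣_ to _∣ᴾ_; Coprime to Coprimeᴾ)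

  q : Poly
  q = 0# ∷ 1# ∷ []

  -- [n]_q = 1 + q + ⋯ + q^(n-1)
  [_] : ℕ → Poly
  [ n ] = List.replicate n 1#

module ℤ[q] = Polynomial ℤ.+-*-rawRing
module ℚ[q] = Polynomial ℚ.+-*-rawRing

toℚ[q] : ℤ[q].Poly → ℚ[q].Poly
toℚ[q] = List.map (ℚ._/ 1)

------------------------------------------------------------------------
-- ℚ[q] is an integral domain

module _ where
  open ℚ[q]
  open ≡-Reasoning

  coeff-+ : ∀ f g n → coeff (f +ᴾ g) n ≡ coeff f n ℚ.+ coeff g n
  coeff-+ []      g       n       = sym (ℚ.+-identityˡ _)
  coeff-+ (a ∷ f) []      zero    = sym (ℚ.+-identityʳ _)
  coeff-+ (a ∷ f) []      (suc n) = sym (ℚ.+-identityʳ _)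
  coeff-+ (a ∷ f) (b ∷ g) zero    = refl
  coeff-+ (a ∷ f) (b ∷ g) (suc n) = coeff-+ f g n

  coeff-scale : ∀ a g n → coeff (List.map (a ℚ.*_) g) n ≡ a ℚ.* coeff g n
  coeff-scale a []      n       = sym (ℚ.*-zeroʳ a)
  coeff-scale a (b ∷ g) zero    = refl
  coeff-scale a (b ∷ g) (suc n) = coeff-scale a g n

  coeff-∷* : ∀ a f g n →
    coeff ((a ∷ f) *ᴾ g) n ≡ a ℚ.* coeff g n ℚ.+ coeff (0ℚ ∷ (f *ᴾ g)) n
  coeff-∷* a f g n =
    trans (coeff-+ (List.map (a ℚ.*_) g) _ n) (cong (ℚ._+ _) (coeff-scale a g n))

  *-0∷ : ∀ f b g → b ≡ 0ℚ → f *ᴾ (b ∷ g) ≈ᴾ 0ℚ ∷ (f *ᴾ g)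
  *-0∷ []      b g b≡0 zero    = refl
  *-0∷ []      b g b≡0 (suc n) = refl
  *-0∷ (a ∷ f) b g b≡0 zero    = begin
    coeff ((a ∷ f) *ᴾ (b ∷ g)) 0 ≡⟨ coeff-∷* a f (b ∷ g) 0 ⟩
    a ℚ.* b ℚ.+ 0ℚ               ≡⟨ ℚ.+-identityʳ _ ⟩
    a ℚ.* b                      ≡⟨ cong (a ℚ.*_) b≡0 ⟩
    a ℚ.* 0ℚ                     ≡⟨ ℚ.*-zeroʳ a ⟩
    0ℚ                           ∎
  *-0∷ (a ∷ f) b g b≡0 (suc n) = begin
    coeff ((a ∷ f) *ᴾ (b ∷ g)) (suc n)
      ≡⟨ coeff-∷* a f (b ∷ g) (suc n) ⟩
    a ℚ.* coeff g n ℚ.+ coeff (f *ᴾ (b ∷ g)) n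
      ≡⟨ cong (a ℚ.* coeff g n ℚ.+_) (*-0∷ f b g b≡0 n) ⟩
    a ℚ.* coeff g n ℚ.+ coeff (0ℚ ∷ (f *ᴾ g)) n
      ≡⟨ coeff-∷* a f g n ⟨
    coeff ((a ∷ f) *ᴾ g) n ∎

  *≡0⇒≡0 : ∀ a b → b ≢ 0ℚ → a ℚ.* b ≡ 0ℚ → a ≡ 0ℚ
  *≡0⇒≡0 a b b≢0 ab≡0 = begin
    a                       ≡⟨ ℚ.*-identityʳ a ⟨
    a ℚ.* 1ℚ                ≡⟨ cong (a ℚ.*_) (ℚ.*-inverseʳ b) ⟨
    a ℚ.* (b ℚ.* (ℚ.1/ b))  ≡⟨ ℚ.*-assoc a b (ℚ.1/ b) ⟨
    a ℚ.* b ℚ.* (ℚ.1/ b)    ≡⟨ cong (ℚ._* (ℚ.1/ b)) ab≡0 ⟩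
    0ℚ ℚ.* (ℚ.1/ b)         ≡⟨ ℚ.*-zeroˡ (ℚ.1/ b) ⟩
    0ℚ                      ∎
    where instance
      b-nonZero : ℚ.NonZero b
      b-nonZero = ℚ.≢-nonZero b≢0

  *≈0-cancel : ∀ f b g → b ≢ 0ℚ → f *ᴾ (b ∷ g) ≈ᴾ [] → f ≈ᴾ []
  *≈0-cancel []      b g b≢0 fg≈0 n = refl
  *≈0-cancel (a ∷ f) b g b≢0 fg≈0   = λ { zero → a≡0 ; (suc n) → f≈0 n }
    where
    a≡0 : a ≡ 0ℚ
    a≡0 = *≡0⇒≡0 a b b≢0 (begin
      a ℚ.* b                      ≡⟨ ℚ.+-identityʳ _ ⟨
      a ℚ.* b ℚ.+ 0ℚ               ≡⟨ coeff-∷* a f (b ∷ g) 0 ⟨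
      coeff ((a ∷ f) *ᴾ (b ∷ g)) 0 ≡⟨ fg≈0 0 ⟩
      0ℚ                           ∎)

    f≈0 : f ≈ᴾ []
    f≈0 = *≈0-cancel f b g b≢0 λ n → begin
      coeff (f *ᴾ (b ∷ g)) n
        ≡⟨ ℚ.+-identityˡ _ ⟨
      0ℚ ℚ.+ coeff (f *ᴾ (b ∷ g)) n
        ≡⟨ cong (ℚ._+ coeff (f *ᴾ (b ∷ g)) n) (ℚ.*-zeroˡ (coeff g n)) ⟨
      0ℚ ℚ.* coeff g n ℚ.+ coeff (f *ᴾ (b ∷ g)) n
        ≡⟨ cong (λ x → x ℚ.* coeff g n ℚ.+ coeff (f *ᴾ (b ∷ g)) n) a≡0 ⟨
      a ℚ.* coeff g n ℚ.+ coeff (f *ᴾ (b ∷ g)) n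
        ≡⟨ coeff-∷* a f (b ∷ g) (suc n) ⟨
      coeff ((a ∷ f) *ᴾ (b ∷ g)) (suc n)
        ≡⟨ fg≈0 (suc n) ⟩
      0ℚ ∎

  *≈0⇒≈0 : ∀ f g → f *ᴾ g ≈ᴾ [] → f ≈ᴾ [] ⊎ g ≈ᴾ []
  *≈0⇒≈0 f []      fg≈0 = inj₂ λ n → refl
  *≈0⇒≈0 f (b ∷ g) fg≈0 with b ℚ.≟ 0ℚ
  ... | no  b≢0 = inj₁ (*≈0-cancel f b g b≢0 fg≈0)
  ... | yes b≡0 with *≈0⇒≈0 f g (λ n → trans (sym (*-0∷ f b g b≡0 (suc n))) (fg≈0 (suc n)))
  ...   | inj₁ f≈0 = inj₁ f≈0
  ...   | inj₂ g≈0 = inj₂ λ { zero → b≡0 ; (suc n) → g≈0 n }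

  *-≉0 : ∀ {f g} → ¬ f ≈ᴾ [] → ¬ g ≈ᴾ [] → ¬ f *ᴾ g ≈ᴾ []
  *-≉0 {f} {g} f≉0 g≉0 fg≈0 with *≈0⇒≈0 f g fg≈0
  ... | inj₁ f≈0 = f≉0 f≈0
  ... | inj₂ g≈0 = g≉0 g≈0

  1≉0 : ¬ (1ℚ ∷ []) ≈ᴾ []
  1≉0 1≈0 with 1≈0 0
  ... | ()

  ^-≉0 : ∀ {f} n → ¬ f ≈ᴾ [] → ¬ f ^ᴾ n ≈ᴾ []
  ^-≉0     zero    f≉0 = 1≉0
  ^-≉0 {f} (suc n) f≉0 = *-≉0 {f} {f ^ᴾ n} f≉0 (^-≉0 {f} n f≉0)

  [1+n]≉0 : ∀ n → ¬ [ suc n ] ≈ᴾ []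
  [1+n]≉0 n e with e 0
  ... | ()

------------------------------------------------------------------------
-- The field ℚ(q), up to the equality _≈ᶠ_ of fractions

record ℚ⟨q⟩ : Set where
  constructor frac
  field
    num   : ℚ[q].Poly
    den   : ℚ[q].Poly
    den≉0 : ¬ den ℚ[q].≈ᴾ []

open ℚ⟨q⟩ using (num; den; den≉0)

module _ where
  open ℚ[q]

  infix 4 _≈ᶠ_

  _≈ᶠ_ : ℚ⟨q⟩ → ℚ⟨q⟩ → Set
  A ≈ᶠ B = num A *ᴾ den B ≈ᴾ num B *ᴾ den A

  poly : ℚ[q].Poly → ℚ⟨q⟩
  poly f = frac f (1ℚ ∷ []) 1≉0

  const : ℚ → ℚ⟨q⟩
  const c = poly (c ∷ [])

  ℚ⟨q⟩-rawRing : RawRing 0ℓ 0ℓ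
  ℚ⟨q⟩-rawRing = record
    { Carrier = ℚ⟨q⟩
    ; _≈_     = _≈ᶠ_
    ; _+_     = λ A B → frac (num A *ᴾ den B +ᴾ num B *ᴾ den A) (den A *ᴾ den B)
                             (*-≉0 {den A} {den B} (den≉0 A) (den≉0 B))
    ; _*_     = λ A B → frac (num A *ᴾ num B) (den A *ᴾ den B)
                             (*-≉0 {den A} {den B} (den≉0 A) (den≉0 B))
    ; -_      = λ A → frac (List.map (ℚ.-_) (num A)) (den A) (den≉0 A)
    ; 0#      = poly []
    ; 1#      = poly (1ℚ ∷ [])
    }

module F where
  open RawRing ℚ⟨q⟩-rawRing public
  open RawSemiringDefs rawSemiring public using (_^_; product)

  infixl 6 _-_
  _-_ : ℚ⟨q⟩ → ℚ⟨q⟩ → ℚ⟨q⟩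
  A - B = A + (- B)

1-q : ℚ⟨q⟩
1-q = F.1# F.- poly ℚ[q].q

------------------------------------------------------------------------
-- Congruence of rational functions modulo [p]_q

infix 4 _≡_mod[_]

_≡_mod[_] : ℚ⟨q⟩ → ℚ⟨q⟩ → ℕ → Set
A ≡ B mod[ p ] =
  ∃[ f ] ∃[ g ] ∃[ g≉0 ]
    A F.- B ≈ᶠ frac (toℚ[q] f) (toℚ[q] g) g≉0
    × ℚ[q].Coprimeᴾ (toℚ[q] g) ℚ[q].[ p ]
    × ℤ[q].[ p ] ℤ[q].∣ᴾ f

------------------------------------------------------------------------
-- Multiple q-harmonic sums

-- A value j : Fin n stands for the summation index k = 1 + j, which thus
-- ranges over 1, …, n.

tuples : ∀ n l → List (Vec (Fin n) l)
tuples n zero    = [] ∷ []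
tuples n (suc l) = List.cartesianProductWith _∷_ (List.allFin n) (tuples n l)

-- All (k₁ , … , k_l) with 1 ≤ k₁ ≤ ⋯ ≤ k_l ≤ n.
increasing : ∀ n l → List (Vec (Fin n) l)
increasing n l = List.filter (linked? Fin._≤?_) (tuples n l)

-- q^((s-1)k) / [k]_q^s with k = 1 + j, meant for s ≥ 1.
term : ℕ → ℕ → ℚ⟨q⟩
term s j = frac (q ^ᴾ ((s ∸ 1) ℕ.* suc j)) ([ suc j ] ^ᴾ s) (^-≉0 s ([1+n]≉0 j))
  where open ℚ[q]

summand : ∀ {n l} → Vec ℕ l → Vec (Fin n) l → ℚ⟨q⟩
summand s k = F.product λ i → term (lookup s i) (toℕ (lookup k i))

-- S n (s₁ ∷ … ∷ s_l ∷ []) is S_n^q(s₁, …, s_l), for positive sᵢ.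
S : ∀ n {l} → Vec ℕ l → ℚ⟨q⟩
S n {l} s = List.foldr F._+_ F.0# (List.map (summand s) (increasing n l))

------------------------------------------------------------------------
-- The numbers K_n(p)

module Q where
  open RawRing ℚ.+-*-rawRing public using (rawSemiring)
  open RawSemiringDefs rawSemiring public using (_^_; sum)

-- Product of the power series with the given coefficients.
_⊛_ : (ℕ → ℚ) → (ℕ → ℚ) → ℕ → ℚ
(a ⊛ b) n = Q.sum {suc n} λ i → a (toℕ i) ℚ.* b (n ∸ toℕ i)

-- With x = z - 1 as the variable:  p x = (z^p - 1) · Σ (-1)^(n-1) K_n x^n  in
-- ℚ[[x]].  The polynomials in x are written in the list notation above, and
-- the sign (-1)^(n-1) as (-1)^(n+1) to keep the exponent natural at n = 0.
z : ℚ[q].Poly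
z = 1ℚ ∷ 1ℚ ∷ []

zᵖ-1 : ℕ → ℚ[q].Poly
zᵖ-1 p = z ^ᴾ p +ᴾ ((ℚ.- 1ℚ) ∷ [])
  where open ℚ[q]

p·x : ℕ → ℚ[q].Poly
p·x p = 0ℚ ∷ (ℤ.+ p ℚ./ 1) ∷ []

IsK : ℕ → (ℕ → ℚ) → Set
IsK p K = ∀ n →
  (coeff (zᵖ-1 p) ⊛ λ m → ((ℚ.- 1ℚ) Q.^ suc m) ℚ.* K m) n ≡ coeff (p·x p) n
  where open ℚ[q]

-- Division of power series: if a has order exactly 1 and b has zero constant
-- term, then b is a multiple of a.
module Quotient (a b : ℕ → ℚ) (a₀≡0 : a 0 ≡ 0ℚ) (a₁≢0 : a 1 ≢ 0ℚ) (b₀≡0 : b 0 ≡ 0ℚ) where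
  private instance
    a₁-nonZero : ℚ.NonZero (a 1)
    a₁-nonZero = ℚ.≢-nonZero a₁≢0

  next : ∀ {n} → Vec ℚ n → ℚ
  next {n} cs =
    (ℚ.1/ a 1) ℚ.* (b (suc n) ℚ.- Q.sum {n} λ i → a (suc (suc (toℕ i))) ℚ.* lookup cs i)

  -- The first n coefficients of the quotient, the latest one first.
  prefix : ∀ n → Vec ℚ n
  prefix zero    = []
  prefix (suc n) = next (prefix n) ∷ prefix n

  quotient : ℕ → ℚ
  quotient n = next (prefix n)

  lookup-prefix : ∀ n (i : Fin n) → lookup (prefix n) i ≡ quotient (n ∸ suc (toℕ i))
  lookup-prefix (suc n) Fin.zero    = refl
  lookup-prefix (suc n) (Fin.suc i) = lookup-prefix n i

  sum-cong : ∀ {n} {f g : Fin n → ℚ} → (∀ i → f i ≡ g i) → Q.sum f ≡ Q.sum g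
  sum-cong {zero}  f≡g = refl
  sum-cong {suc n} f≡g = cong₂ ℚ._+_ (f≡g Fin.zero) (sum-cong λ i → f≡g (Fin.suc i))

  open ≡-Reasoning

  ⊛-quotient : ∀ n → (a ⊛ quotient) n ≡ b n
  ⊛-quotient zero = begin
    a 0 ℚ.* quotient 0 ℚ.+ 0ℚ ≡⟨ ℚ.+-identityʳ _ ⟩
    a 0 ℚ.* quotient 0        ≡⟨ cong (ℚ._* quotient 0) a₀≡0 ⟩
    0ℚ ℚ.* quotient 0         ≡⟨ ℚ.*-zeroˡ (quotient 0) ⟩
    0ℚ                        ≡⟨ b₀≡0 ⟨
    b 0                       ∎
  ⊛-quotient (suc n) = begin
    a 0 ℚ.* quotient (suc n) ℚ.+ (a 1 ℚ.* quotient n ℚ.+ rest)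
      ≡⟨ cong (λ x → x ℚ.* quotient (suc n) ℚ.+ (a 1 ℚ.* quotient n ℚ.+ rest)) a₀≡0 ⟩
    0ℚ ℚ.* quotient (suc n) ℚ.+ (a 1 ℚ.* quotient n ℚ.+ rest)
      ≡⟨ cong (ℚ._+ (a 1 ℚ.* quotient n ℚ.+ rest)) (ℚ.*-zeroˡ (quotient (suc n))) ⟩
    0ℚ ℚ.+ (a 1 ℚ.* quotient n ℚ.+ rest)
      ≡⟨ ℚ.+-identityˡ _ ⟩
    a 1 ℚ.* quotient n ℚ.+ rest
      ≡⟨ cong₂ ℚ._+_ (sym (ℚ.*-assoc (a 1) (ℚ.1/ a 1) _)) rest≡known ⟩
    a 1 ℚ.* (ℚ.1/ a 1) ℚ.* (b (suc n) ℚ.- known) ℚ.+ known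
      ≡⟨ cong (λ x → x ℚ.* (b (suc n) ℚ.- known) ℚ.+ known) (ℚ.*-inverseʳ (a 1)) ⟩
    1ℚ ℚ.* (b (suc n) ℚ.- known) ℚ.+ known
      ≡⟨ cong (ℚ._+ known) (ℚ.*-identityˡ (b (suc n) ℚ.- known)) ⟩
    b (suc n) ℚ.- known ℚ.+ known
      ≡⟨ ℚ.+-assoc (b (suc n)) (ℚ.- known) known ⟩
    b (suc n) ℚ.+ (ℚ.- known ℚ.+ known)
      ≡⟨ cong (b (suc n) ℚ.+_) (ℚ.+-inverseˡ known) ⟩
    b (suc n) ℚ.+ 0ℚ
      ≡⟨ ℚ.+-identityʳ _ ⟩
    b (suc n) ∎
    where
    rest known : ℚ
    rest  = Q.sum {n} λ i → a (suc (suc (toℕ i))) ℚ.* quotient (n ∸ suc (toℕ i))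
    known = Q.sum {n} λ i → a (suc (suc (toℕ i))) ℚ.* lookup (prefix n) i

    rest≡known : rest ≡ known
    rest≡known = sum-cong λ i → cong (a (suc (suc (toℕ i))) ℚ.*_) (sym (lookup-prefix n i))

module _ where
  open ℚ[q]
  open ≡-Reasoning

  private
    const-* : ∀ c g n → coeff ((c ∷ []) *ᴾ g) n ≡ c ℚ.* coeff g n
    const-* c g n = trans (coeff-∷* c [] g n) (trans (cong (c ℚ.* coeff g n ℚ.+_) (0∷[] n)) (ℚ.+-identityʳ _))
      where
      0∷[] : ∀ n → coeff (0ℚ ∷ []) n ≡ 0ℚ
      0∷[] zero    = refl
      0∷[] (suc n) = refl

  coeff-z^0 : ∀ p → coeff (z ^ᴾ p) 0 ≡ 1ℚ
  coeff-z^0 zero    = refl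
  coeff-z^0 (suc p) = begin
    coeff (z *ᴾ (z ^ᴾ p)) 0          ≡⟨ coeff-∷* 1ℚ (1ℚ ∷ []) (z ^ᴾ p) 0 ⟩
    1ℚ ℚ.* coeff (z ^ᴾ p) 0 ℚ.+ 0ℚ   ≡⟨ ℚ.+-identityʳ _ ⟩
    1ℚ ℚ.* coeff (z ^ᴾ p) 0          ≡⟨ ℚ.*-identityˡ _ ⟩
    coeff (z ^ᴾ p) 0                 ≡⟨ coeff-z^0 p ⟩
    1ℚ                               ∎

  coeff-z^1 : ∀ p → coeff (z ^ᴾ suc p) 1 ≡ coeff (z ^ᴾ p) 1 ℚ.+ 1ℚ
  coeff-z^1 p = begin
    coeff (z *ᴾ (z ^ᴾ p)) 1
      ≡⟨ coeff-∷* 1ℚ (1ℚ ∷ []) (z ^ᴾ p) 1 ⟩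
    1ℚ ℚ.* coeff (z ^ᴾ p) 1 ℚ.+ coeff ((1ℚ ∷ []) *ᴾ (z ^ᴾ p)) 0
      ≡⟨ cong₂ ℚ._+_ (ℚ.*-identityˡ (coeff (z ^ᴾ p) 1)) (const-* 1ℚ (z ^ᴾ p) 0) ⟩
    coeff (z ^ᴾ p) 1 ℚ.+ 1ℚ ℚ.* coeff (z ^ᴾ p) 0
      ≡⟨ cong (coeff (z ^ᴾ p) 1 ℚ.+_) (trans (ℚ.*-identityˡ _) (coeff-z^0 p)) ⟩
    coeff (z ^ᴾ p) 1 ℚ.+ 1ℚ ∎

  coeff-z^1≥0 : ∀ p → 0ℚ ℚ.≤ coeff (z ^ᴾ p) 1
  coeff-z^1>0 : ∀ p → 0ℚ ℚ.< coeff (z ^ᴾ suc p) 1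
  coeff-z^1≥0 zero    = ℚ.≤-refl
  coeff-z^1≥0 (suc p) = ℚ.<⇒≤ (coeff-z^1>0 p)
  coeff-z^1>0 p = subst (0ℚ ℚ.<_) (sym (coeff-z^1 p))
    (ℚ.+-mono-≤-< (coeff-z^1≥0 p) (ℚ.positive⁻¹ 1ℚ))

  K-exists : ∀ p → ∃[ K ] IsK (suc p) K
  K-exists p = K , λ n → trans (sum-cong {suc n} (λ i → cong (a (toℕ i) ℚ.*_) (sign-K (n ∸ toℕ i))))
                                (⊛-quotient n)
    where
    a : ℕ → ℚ
    a = coeff (zᵖ-1 (suc p))

    a₀≡0 : a 0 ≡ 0ℚ
    a₀≡0 = trans (coeff-+ (z ^ᴾ suc p) _ 0) (cong (ℚ._+ (ℚ.- 1ℚ)) (coeff-z^0 (suc p)))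

    a₁≢0 : a 1 ≢ 0ℚ
    a₁≢0 a₁≡0 = ℚ.<⇒≢ (coeff-z^1>0 p) (begin
      0ℚ                             ≡⟨ a₁≡0 ⟨
      a 1                            ≡⟨ coeff-+ (z ^ᴾ suc p) _ 1 ⟩
      coeff (z ^ᴾ suc p) 1 ℚ.+ 0ℚ    ≡⟨ ℚ.+-identityʳ _ ⟩
      coeff (z ^ᴾ suc p) 1           ∎)

    open Quotient a (coeff (p·x (suc p))) a₀≡0 a₁≢0 refl

    sign : ℕ → ℚ
    sign n = (ℚ.- 1ℚ) Q.^ n

    sign-sq : ∀ n → sign n ℚ.* sign n ≡ 1ℚ
    sign-sq zero    = refl
    sign-sq (suc n) = begin
      (ℚ.- 1ℚ ℚ.* sign n) ℚ.* (ℚ.- 1ℚ ℚ.* sign n)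
        ≡⟨ cong₂ ℚ._*_ (neg (sign n)) (neg (sign n)) ⟩
      (ℚ.- sign n) ℚ.* (ℚ.- sign n)
        ≡⟨ ℚ.neg-distribˡ-* (sign n) (ℚ.- sign n) ⟨
      ℚ.- (sign n ℚ.* (ℚ.- sign n))
        ≡⟨ cong ℚ.-_ (ℚ.neg-distribʳ-* (sign n) (sign n)) ⟨
      ℚ.- (ℚ.- (sign n ℚ.* sign n))
        ≡⟨ cong (λ x → ℚ.- (ℚ.- x)) (sign-sq n) ⟩
      1ℚ ∎
      where
      neg : ∀ x → ℚ.- 1ℚ ℚ.* x ≡ ℚ.- x
      neg x = trans (sym (ℚ.neg-distribˡ-* 1ℚ x)) (cong ℚ.-_ (ℚ.*-identityˡ x))

    K : ℕ → ℚ
    K n = sign (suc n) ℚ.* quotient n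

    sign-K : ∀ n → sign (suc n) ℚ.* K n ≡ quotient n
    sign-K n = begin
      sign (suc n) ℚ.* (sign (suc n) ℚ.* quotient n) ≡⟨ ℚ.*-assoc (sign (suc n)) _ _ ⟨
      sign (suc n) ℚ.* sign (suc n) ℚ.* quotient n   ≡⟨ cong (ℚ._* quotient n) (sign-sq (suc n)) ⟩
      1ℚ ℚ.* quotient n                              ≡⟨ ℚ.*-identityˡ _ ⟩
      quotient n                                     ∎

-- t C(t-1, i) + (t-1) C(t, i).  At t = 0 the first product is 0 whatever
-- C(-1, i) means, while t - 1 = -1 is taken in ℤ.
weight : ℕ → ℕ → ℤ
weight t i = ℤ.+ (t ℕ.* ((t ∸ 1) C i)) ℤ.+ (ℤ.+ t ℤ.- ℤ.1ℤ) ℤ.* ℤ.+ (t C i)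

{-# OPTIONS --safe #-}

-- Work in R = ℚ[q] / [p], where ζ = q satisfies ζ^p = 1 and 1 - ζ^k is invertible
-- for p ∤ k, with inverse d_k.  Put y_k = d_k² - d_k = ζ^k / (1 - ζ^k)², so that
-- q^k / [k]² reduces to (1 - ζ)² y_k and S(p - 1; {2}^t) to (1 - ζ)^(2t) h_t, where
-- h_t is the complete homogeneous symmetric polynomial of y_1, …, y_(p-1).
--
-- The "cotangents" c_k = 1 - 2 d_k are odd in k, satisfy 4 y_k + 1 = c_k² and
-- c_(k+l) (c_k + c_l) = c_k c_l + 1.  With θ = w d/dw and P = Σ_k w y_k / (1 - w y_k)
-- the addition formula turns the double sum P² into single sums, which yields
--   (4 + w) P² = 2 (4 + w) θP + (4 + 2w) P - 12 w Σ_k y_k.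
-- Hence U = 2 - 2P + (4 + w) θP solves θU = P U.  So does 2 Σ_t h_t w^t, and the two
-- agree.  Comparing coefficients, h_t = Σ_k y_k^t (t + (t - 1) ζ^k).
--
-- On the other side, partial fractions of p (z - 1) / (z^p - 1) give
-- K_n = Σ_k ζ^k d_k^n in R, and the binomial theorem evaluates the weighted sum of
-- the K_(2t-i) to the same expression.

module Submission where

open import Defs
open ℚ⟨q⟩ using (num; den; den≉0)
open import Algebra.Bundles using (RawRing; CommutativeRing; Semiring)
open import Algebra.Definitions.RawMagma using (_,_)
import Algebra.Morphism.RingMonomorphism as RingMonomorphism
open import Algebra.Morphism.Structures using (IsRingHomomorphism; IsRingMonomorphism)
import Algebra.Solver.Ring as RingSolver
open import Algebra.Solver.Ring.AlmostCommutativeRing using (fromCommutativeRing; _-Raw-AlmostCommutative⟶_)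
open import Algebra.Structures using (IsCommutativeRing)
open import Data.Bool.Base using (true; false; if_then_else_)
open import Data.Empty using (⊥-elim)
open import Data.Fin.Base as Fin using (Fin; toℕ)
open import Data.Fin.Permutation using (reverse)
import Data.Fin.Properties as Fin
open import Data.Integer.Base as ℤ using (ℤ; +_)
import Data.Integer.Properties as ℤ
open import Data.List.Base as List using (List; []; _∷_; _++_)
open import Data.List.Properties using (filter-++; filter-≐)
open import Data.Maybe.Base using (Maybe; just; nothing)
open import Data.Nat.Base as ℕ using (ℕ; zero; suc; s≤s; z≤n; _∸_; _<_; _≤_; _≤ᵇ_; _>_)
open import Data.Nat.Combinatorics using (_C_; k>n⇒nCk≡0)
open import Data.Nat.Coprimality using (Coprime; coprime-Bézout)
open import Data.Nat.Divisibility using (divides; _∣0; _∣_; _∤_; _∣?_; ∣m+n∣m⇒∣n; ∣m∣n⇒∣m+n; ∣-refl; >⇒∤)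
open import Data.Nat.GCD using (module Bézout)
open import Data.Nat.Induction using (<-rec)
open import Data.Nat.Primality using (Prime; prime⇒irreducible; euclidsLemma; prime⇒nonTrivial)
import Data.Nat.Properties as ℕ
open import Data.Product.Base using (∃-syntax; _×_; _,_; proj₁; proj₂)
open import Data.Rational.Base as ℚ using (ℚ; 0ℚ; 1ℚ)
import Data.Rational.Properties as ℚ
import Data.Rational.Unnormalised.Base as ℚᵘ
import Data.Rational.Unnormalised.Properties as ℚᵘ
open import Data.Sum.Base using (inj₁; inj₂)
open import Data.Vec.Base using (Vec; []; _∷_; replicate)
open import Data.Vec.Relation.Unary.Linked as Linked using (Linked; linked?; []; [-]; _∷_)
open import Function.Base using (_∘_; id)
open import Level using (0ℓ)
open import Relation.Binary.PropositionalEquality as ≡ using (_≡_; cong; cong₂; _≢_)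
open import Relation.Nullary using (yes; no; Dec; does; ¬_)

-- Origin of U: 2 ζ^k y_k = 2 y_k + 1 + c_k, and the odd c_k drop out of sums against powers of y_k.
-- For t > 0 the formula for h_t therefore reads 2 h_t = (4t - 2) p_t + (t - 1) p_(t-1) with p_t =
-- Σ_k y_k^t, and U is the generating function of the right side, with constant term 2. Origin of 4
-- + w: partial fractions of a product of two summands of P involve y_l / (y_k - y_l) = -(c_(k+l) +
-- c_(k-l)) / (2 c_k). At the pole w = 1 / y_k the factor 4 + w equals c_k^2 / y_k, so it replaces
-- the denominator c_k by a numerator, and sums of c_(k+l) and c_(k-l) over l are known. The
-- addition formula breaks down at l = k and l = p - k; these exceptional terms supply θP and the
-- linear terms. Since θ(w p_1) = w p_1, the quadratic equation and its image under θ together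
-- eliminate p_1. Obstacle: the rings are not known to be domains. Divisions are by positive
-- integers, by the witnesses d_k, or by series with invertible leading coefficient, and inverses
-- enter through the equations that characterise them.

fromℤ : ℤ → ℚ
fromℤ i = i ℚ./ 1

toℚᵘ-fromℤ : ∀ i → ℚ.toℚᵘ (fromℤ i) ℚᵘ.≃ ℚᵘ.mkℚᵘ i 0
toℚᵘ-fromℤ i = ℚ.toℚᵘ-fromℚᵘ (ℚᵘ.mkℚᵘ i 0)

fromℤ-+ : ∀ i j → fromℤ (i ℤ.+ j) ≡ fromℤ i ℚ.+ fromℤ j
fromℤ-+ i j = ℚ.toℚᵘ-injective (begin
  ℚ.toℚᵘ (fromℤ (i ℤ.+ j))                  ≈⟨ toℚᵘ-fromℤ (i ℤ.+ j) ⟩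
  ℚᵘ.mkℚᵘ (i ℤ.+ j) 0
    ≈⟨ ℚᵘ.*≡* (cong (ℤ._* ℤ.1ℤ) (cong₂ ℤ._+_ (≡.sym (ℤ.*-identityʳ i)) (≡.sym (ℤ.*-identityʳ j)))) ⟩
  ℚᵘ.mkℚᵘ i 0 ℚᵘ.+ ℚᵘ.mkℚᵘ j 0              ≈⟨ ℚᵘ.+-cong (toℚᵘ-fromℤ i) (toℚᵘ-fromℤ j) ⟨
  ℚ.toℚᵘ (fromℤ i) ℚᵘ.+ ℚ.toℚᵘ (fromℤ j)    ≈⟨ ℚ.toℚᵘ-homo-+ (fromℤ i) (fromℤ j) ⟨
  ℚ.toℚᵘ (fromℤ i ℚ.+ fromℤ j)              ∎)
  where open ℚᵘ.≃-Reasoning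

fromℤ-* : ∀ i j → fromℤ (i ℤ.* j) ≡ fromℤ i ℚ.* fromℤ j
fromℤ-* i j = ℚ.toℚᵘ-injective (begin
  ℚ.toℚᵘ (fromℤ (i ℤ.* j))                  ≈⟨ toℚᵘ-fromℤ (i ℤ.* j) ⟩
  ℚᵘ.mkℚᵘ i 0 ℚᵘ.* ℚᵘ.mkℚᵘ j 0              ≈⟨ ℚᵘ.*-cong (toℚᵘ-fromℤ i) (toℚᵘ-fromℤ j) ⟨
  ℚ.toℚᵘ (fromℤ i) ℚᵘ.* ℚ.toℚᵘ (fromℤ j)    ≈⟨ ℚ.toℚᵘ-homo-* (fromℤ i) (fromℤ j) ⟨
  ℚ.toℚᵘ (fromℤ i ℚ.* fromℤ j)              ∎)
  where open ℚᵘ.≃-Reasoning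

fromℤ-neg : ∀ i → fromℤ (ℤ.- i) ≡ ℚ.- fromℤ i
fromℤ-neg i = ℚ.toℚᵘ-injective (begin
  ℚ.toℚᵘ (fromℤ (ℤ.- i))       ≈⟨ toℚᵘ-fromℤ (ℤ.- i) ⟩
  ℚᵘ.- ℚᵘ.mkℚᵘ i 0             ≈⟨ ℚᵘ.-‿cong (toℚᵘ-fromℤ i) ⟨
  ℚᵘ.- ℚ.toℚᵘ (fromℤ i)        ≈⟨ ℚ.toℚᵘ-homo‿- (fromℤ i) ⟨
  ℚ.toℚᵘ (ℚ.- fromℤ i)         ∎)
  where open ℚᵘ.≃-Reasoning

fromℤ-injective : ∀ {i j} → fromℤ i ≡ fromℤ j → i ≡ j
fromℤ-injective {i} {j} eq with ℚᵘ.≃-trans (ℚᵘ.≃-sym (toℚᵘ-fromℤ i)) (ℚᵘ.≃-trans (ℚᵘ.≃-reflexive (cong ℚ.toℚᵘ eq)) (toℚᵘ-fromℤ j))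
... | ℚᵘ.*≡* e = ≡.trans (≡.sym (ℤ.*-identityʳ i)) (≡.trans e (ℤ.*-identityʳ j))

-- Equality is a setoid relation, so that a quotient keeps its carrier and only coarsens `_≈_`. The
-- instances are ℚ, ℚ[q], residue rings, and power series over such rings; the scalars from ℚ make
-- positive integers invertible in all of them.
record ℚ-Algebra : Set₁ where
  field
    commutativeRing : CommutativeRing 0ℓ 0ℓ
  open CommutativeRing commutativeRing public
  field
    ι      : ℚ → Carrier
    ι-homo : IsRingHomomorphism ℚ.+-*-rawRing rawRing ι
  module ι = IsRingHomomorphism ι-homo
  open import Algebra.Properties.Semiring.Exp semiring public
    using (_^_; ^-congˡ; ^-homo-*; ^-assocʳ)

  -- ι (i / 1), but computing to 0# and 1#, so that the solver's numerals match these.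
  ιℤ : ℤ → Carrier
  ιℤ (ℤ.+ 0) = 0#
  ιℤ (ℤ.+ 1) = 1#
  ιℤ i       = ι (fromℤ i)

  ιℤ≈ : ∀ i → ιℤ i ≈ ι (fromℤ i)
  ιℤ≈ (ℤ.+ 0)           = sym ι.0#-homo
  ιℤ≈ (ℤ.+ 1)           = sym ι.1#-homo
  ιℤ≈ (ℤ.+ suc (suc n)) = refl
  ιℤ≈ ℤ.-[1+ n ]        = refl

  ιℤ-+ : ∀ i j → ιℤ (i ℤ.+ j) ≈ ιℤ i + ιℤ j
  ιℤ-+ i j = trans (ιℤ≈ (i ℤ.+ j)) (trans (ι.⟦⟧-cong (fromℤ-+ i j))
    (trans (ι.+-homo (fromℤ i) (fromℤ j)) (sym (+-cong (ιℤ≈ i) (ιℤ≈ j)))))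

  ιℤ-* : ∀ i j → ιℤ (i ℤ.* j) ≈ ιℤ i * ιℤ j
  ιℤ-* i j = trans (ιℤ≈ (i ℤ.* j)) (trans (ι.⟦⟧-cong (fromℤ-* i j))
    (trans (ι.*-homo (fromℤ i) (fromℤ j)) (sym (*-cong (ιℤ≈ i) (ιℤ≈ j)))))

  ιℤ-neg : ∀ i → ιℤ (ℤ.- i) ≈ - ιℤ i
  ιℤ-neg i = trans (ιℤ≈ (ℤ.- i)) (trans (ι.⟦⟧-cong (fromℤ-neg i))
    (trans (ι.-‿homo (fromℤ i)) (sym (-‿cong (ιℤ≈ i)))))

  private
    morphism : ℤ.+-*-rawRing -Raw-AlmostCommutative⟶ fromCommutativeRing commutativeRing
    morphism = record
      { ⟦_⟧    = ιℤ
      ; +-homo = ιℤ-+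
      ; *-homo = ιℤ-*
      ; -‿homo = ιℤ-neg
      ; 0-homo = refl
      ; 1-homo = refl
      }

    ≟⇒≈ : ∀ i j → Maybe (ιℤ i ≈ ιℤ j)
    ≟⇒≈ i j with i ℤ.≟ j
    ... | yes i≡j = just (reflexive (cong ιℤ i≡j))
    ... | no  _   = nothing

  module Solver =
    RingSolver ℤ.+-*-rawRing (fromCommutativeRing commutativeRing) morphism ≟⇒≈

  ι⁻¹ : ℕ → Carrier
  ι⁻¹ n = ι (ℤ.1ℤ ℚ./ suc n)

  ιℤ-inverse : ∀ n → ι⁻¹ n * ιℤ (ℤ.+ suc n) ≈ 1#
  ιℤ-inverse n = begin
    ι⁻¹ n * ιℤ (ℤ.+ suc n)                      ≈⟨ *-congˡ (ιℤ≈ (ℤ.+ suc n)) ⟩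
    ι⁻¹ n * ι (fromℤ (ℤ.+ suc n))               ≈⟨ ι.*-homo _ _ ⟨
    ι ((ℤ.1ℤ ℚ./ suc n) ℚ.* fromℤ (ℤ.+ suc n))  ≈⟨ ι.⟦⟧-cong (1/n*n≡1 n) ⟩
    ι 1ℚ                                        ≈⟨ ι.1#-homo ⟩
    1#                                          ∎
    where
    open import Relation.Binary.Reasoning.Setoid setoid
    1/n*n≡1 : ∀ n → (ℤ.1ℤ ℚ./ suc n) ℚ.* fromℤ (ℤ.+ suc n) ≡ 1ℚ
    1/n*n≡1 n = ℚ.toℚᵘ-injective (ℚᵘ.≃-trans (ℚ.toℚᵘ-homo-* (ℤ.1ℤ ℚ./ suc n) _)
      (ℚᵘ.≃-trans (ℚᵘ.*-cong (ℚ.toℚᵘ-fromℚᵘ (ℚᵘ.mkℚᵘ ℤ.1ℤ n)) (toℚᵘ-fromℤ (ℤ.+ suc n)))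
        (ℚᵘ.*≡* (≡.trans (ℤ.*-identityʳ _) (cong (ℤ.1ℤ ℤ.*_) (≡.sym (cong ℤ.+_ (ℕ.*-identityʳ (suc n)))))))))

  -- `ι⁻¹ n` inverts the integer, so no domain property enters. The case n = 1 serves the symmetry
  -- arguments below, where a sum is evaluated by doubling it.
  ιℤ-cancelˡ : ∀ n {x y} → ιℤ (ℤ.+ suc n) * x ≈ ιℤ (ℤ.+ suc n) * y → x ≈ y
  ιℤ-cancelˡ n {x} {y} eq = begin
    x                               ≈⟨ unfold x ⟩
    ι⁻¹ n * (ιℤ (ℤ.+ suc n) * x)    ≈⟨ *-congˡ eq ⟩
    ι⁻¹ n * (ιℤ (ℤ.+ suc n) * y)    ≈⟨ unfold y ⟨
    y                               ∎
    where
    open import Relation.Binary.Reasoning.Setoid setoid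
    unfold : ∀ z → z ≈ ι⁻¹ n * (ιℤ (ℤ.+ suc n) * z)
    unfold z = trans (sym (*-identityˡ z)) (trans (*-congʳ (sym (ιℤ-inverse n))) (*-assoc _ _ z))

-- Power series

module PowerSeries (R : ℚ-Algebra) where
  open ℚ-Algebra R
  open Solver using (solve; _:=_; _:+_; _:*_; con)
  open import Relation.Binary.Reasoning.Setoid setoid

  Series : Set
  Series = ℕ → Carrier

  infix  4 _≋_
  infixl 7 _⋆_
  infixl 6 _⊕_

  _≋_ : Series → Series → Set
  a ≋ b = ∀ n → a n ≈ b n

  _⊕_ : Series → Series → Series
  (a ⊕ b) n = a n + b n

  constant : Carrier → Series
  constant x zero    = x
  constant x (suc n) = 0#

  -- The Cauchy product, by recursion on the degree with the constant term of the left factor split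
  -- off; inductions pass from `a` to `a ∘ suc`.
  _⋆_ : Series → Series → Series
  (a ⋆ b) zero    = a 0 * b 0
  (a ⋆ b) (suc n) = a 0 * b (suc n) + ((a ∘ suc) ⋆ b) n

  ⋆-cong : ∀ {a a′ b b′} → a ≋ a′ → b ≋ b′ → a ⋆ b ≋ a′ ⋆ b′
  ⋆-cong p q zero    = *-cong (p 0) (q 0)
  ⋆-cong p q (suc n) = +-cong (*-cong (p 0) (q (suc n))) (⋆-cong (p ∘ suc) q n)

  ⋆-zeroˡ : ∀ a → (λ _ → 0#) ⋆ a ≋ λ _ → 0#
  ⋆-zeroˡ a zero    = zeroˡ _
  ⋆-zeroˡ a (suc n) = trans (+-cong (zeroˡ _) (⋆-zeroˡ a n)) (+-identityˡ 0#)

  constant-⋆ : ∀ x a n → (constant x ⋆ a) n ≈ x * a n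
  constant-⋆ x a zero    = refl
  constant-⋆ x a (suc n) = trans (+-congˡ (⋆-zeroˡ a n)) (+-identityʳ _)

  constant-cong : ∀ {x y} → x ≈ y → constant x ≋ constant y
  constant-cong x≈y zero    = x≈y
  constant-cong x≈y (suc n) = refl

  constant-* : ∀ x y → constant (x * y) ≋ constant x ⋆ constant y
  constant-* x y zero    = refl
  constant-* x y (suc n) = sym (trans (constant-⋆ x (constant y) (suc n)) (zeroʳ x))

  ⋆-distribʳ : ∀ c a b → (a ⊕ b) ⋆ c ≋ (a ⋆ c) ⊕ (b ⋆ c)
  ⋆-distribʳ c a b zero    = distribʳ _ _ _
  ⋆-distribʳ c a b (suc n) = trans (+-congˡ (⋆-distribʳ c (a ∘ suc) (b ∘ suc) n))
    (solve 5 (λ a₀ b₀ c s t → (a₀ :+ b₀) :* c :+ (s :+ t) := a₀ :* c :+ s :+ (b₀ :* c :+ t)) refl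
      (a 0) (b 0) (c (suc n)) _ _)

  ⋆-scaleˡ : ∀ x a b n → ((λ m → x * a m) ⋆ b) n ≈ x * (a ⋆ b) n
  ⋆-scaleˡ x a b zero    = *-assoc _ _ _
  ⋆-scaleˡ x a b (suc n) = trans (+-cong (*-assoc _ _ _) (⋆-scaleˡ x (a ∘ suc) b n)) (sym (distribˡ _ _ _))

  ⋆-sucʳ : ∀ a b n → (a ⋆ b) (suc n) ≈ (a ⋆ (b ∘ suc)) n + a (suc n) * b 0
  ⋆-sucʳ a b zero    = refl
  ⋆-sucʳ a b (suc n) = trans (+-congˡ (⋆-sucʳ (a ∘ suc) b n)) (sym (+-assoc _ _ _))

  ⋆-comm : ∀ a b → a ⋆ b ≋ b ⋆ a
  ⋆-comm a b zero    = *-comm _ _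
  ⋆-comm a b (suc n) = begin
    a 0 * b (suc n) + ((a ∘ suc) ⋆ b) n  ≈⟨ +-cong (*-comm _ _) (⋆-comm (a ∘ suc) b n) ⟩
    b (suc n) * a 0 + (b ⋆ (a ∘ suc)) n  ≈⟨ +-comm _ _ ⟩
    (b ⋆ (a ∘ suc)) n + b (suc n) * a 0  ≈⟨ ⋆-sucʳ b a n ⟨
    (b ⋆ a) (suc n)                      ∎

  ⋆-assoc : ∀ a b c → (a ⋆ b) ⋆ c ≋ a ⋆ (b ⋆ c)
  ⋆-assoc a b c zero    = *-assoc _ _ _
  ⋆-assoc a b c (suc n) = begin
    a 0 * b 0 * c (suc n) + (((λ m → a 0 * b (suc m)) ⊕ ((a ∘ suc) ⋆ b)) ⋆ c) n
      ≈⟨ +-congˡ (⋆-distribʳ c _ _ n) ⟩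
    a 0 * b 0 * c (suc n) + (((λ m → a 0 * b (suc m)) ⋆ c) n + (((a ∘ suc) ⋆ b) ⋆ c) n)
      ≈⟨ +-congˡ (+-cong (⋆-scaleˡ (a 0) (b ∘ suc) c n) (⋆-assoc (a ∘ suc) b c n)) ⟩
    a 0 * b 0 * c (suc n) + (a 0 * ((b ∘ suc) ⋆ c) n + ((a ∘ suc) ⋆ (b ⋆ c)) n)
      ≈⟨ solve 5 (λ a₀ b₀ c s t → a₀ :* b₀ :* c :+ (a₀ :* s :+ t) := a₀ :* (b₀ :* c :+ s) :+ t) refl
           (a 0) (b 0) (c (suc n)) _ _ ⟩
    a 0 * (b ⋆ c) (suc n) + ((a ∘ suc) ⋆ (b ⋆ c)) n ∎

  rawRing-ˢ : RawRing 0ℓ 0ℓ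
  rawRing-ˢ = record
    { Carrier = Series ; _≈_ = _≋_ ; _+_ = _⊕_ ; _*_ = _⋆_ ; -_ = λ a n → - a n
    ; 0# = λ _ → 0# ; 1# = constant 1# }

  isCommutativeRing-ˢ : IsCommutativeRing _≋_ _⊕_ _⋆_ (λ a n → - a n) (λ _ → 0#) (constant 1#)
  isCommutativeRing-ˢ = record
    { isRing = record
      { +-isAbelianGroup = record
        { isGroup = record
          { isMonoid = record
            { isSemigroup = record
              { isMagma = record
                { isEquivalence = record
                  { refl = λ _ → refl ; sym = λ p n → sym (p n) ; trans = λ p q n → trans (p n) (q n) }
                ; ∙-cong = λ p q n → +-cong (p n) (q n) }
              ; assoc = λ a b c n → +-assoc _ _ _ }
            ; identity = (λ a n → +-identityˡ _) , (λ a n → +-identityʳ _) }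
          ; inverse = (λ a n → -‿inverseˡ _) , (λ a n → -‿inverseʳ _)
          ; ⁻¹-cong = λ p n → -‿cong (p n) }
        ; comm = λ a b n → +-comm _ _ }
      ; *-cong = ⋆-cong
      ; *-assoc = ⋆-assoc
      ; *-identity = identityˡ-⋆ , λ a n → trans (⋆-comm a _ n) (identityˡ-⋆ a n)
      ; distrib = (λ c a b n → trans (⋆-comm c (a ⊕ b) n) (trans (⋆-distribʳ c a b n)
                    (+-cong (⋆-comm a c n) (⋆-comm b c n)))) , ⋆-distribʳ }
    ; *-comm = ⋆-comm }
    where
    identityˡ-⋆ : ∀ a → constant 1# ⋆ a ≋ a
    identityˡ-⋆ a n = trans (constant-⋆ 1# a n) (*-identityˡ (a n))

  powerSeriesAlgebra : ℚ-Algebra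
  powerSeriesAlgebra = record
    { commutativeRing = record { isCommutativeRing = isCommutativeRing-ˢ }
    ; ι = constant ∘ ι
    ; ι-homo = record
      { isSemiringHomomorphism = record
        { isNearSemiringHomomorphism = record
          { +-isMonoidHomomorphism = record
            { isMagmaHomomorphism = record
              { isRelHomomorphism = record { cong = λ x≡y → constant-cong (ι.⟦⟧-cong x≡y) }
              ; homo = λ { x y zero → ι.+-homo x y ; x y (suc n) → sym (+-identityˡ 0#) } }
            ; ε-homo = λ { zero → ι.0#-homo ; (suc n) → refl } }
          ; *-homo = λ x y n → trans (constant-cong (ι.*-homo x y) n) (constant-* (ι x) (ι y) n) }
        ; 1#-homo = constant-cong ι.1#-homo }
      ; -‿homo = λ { x zero → ι.-‿homo x ; x (suc n) → sym -0#≈0# } }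
    }
    where
    open import Algebra.Properties.Ring ring using (-0#≈0#)

  ιℤ-⋆ : ∀ i a n → (ℚ-Algebra.ιℤ powerSeriesAlgebra i ⋆ a) n ≈ ιℤ i * a n
  ιℤ-⋆ i a n = trans (⋆-cong (ℚ-Algebra.ιℤ≈ powerSeriesAlgebra i) (λ _ → refl) n)
    (trans (constant-⋆ (ι (fromℤ i)) a n) (*-congʳ (sym (ιℤ≈ i))))

  w : Series
  w zero          = 0#
  w (suc zero)    = 1#
  w (suc (suc n)) = 0#

  w⋆-zero : ∀ a → (w ⋆ a) 0 ≈ 0#
  w⋆-zero a = zeroˡ _

  w⋆-suc : ∀ a n → (w ⋆ a) (suc n) ≈ a n
  w⋆-suc a n = begin
    0# * a (suc n) + ((w ∘ suc) ⋆ a) n  ≈⟨ +-cong (zeroˡ _) (⋆-cong w-suc (λ _ → refl) n) ⟩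
    0# + (constant 1# ⋆ a) n               ≈⟨ +-identityˡ _ ⟩
    (constant 1# ⋆ a) n                    ≈⟨ constant-⋆ 1# a n ⟩
    1# * a n                            ≈⟨ *-identityˡ _ ⟩
    a n                                 ∎
    where
    w-suc : w ∘ suc ≋ constant 1#
    w-suc zero    = refl
    w-suc (suc n) = refl

  θ : Series → Series
  θ a n = ιℤ (+ n) * a n

  θ-cong : ∀ {a b} → a ≋ b → θ a ≋ θ b
  θ-cong p n = *-congˡ (p n)

  θ-⊕ : ∀ a b → θ (a ⊕ b) ≋ θ a ⊕ θ b
  θ-⊕ a b n = distribˡ _ _ _

  θ-constant : ∀ x → θ (constant x) ≋ λ _ → 0#
  θ-constant x zero    = zeroˡ x
  θ-constant x (suc n) = zeroʳ _

  θ-w : θ w ≋ w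
  θ-w zero          = zeroʳ _
  θ-w (suc zero)    = *-identityʳ _
  θ-w (suc (suc n)) = zeroʳ _

  θ-⋆ : ∀ a b → θ (a ⋆ b) ≋ (θ a ⋆ b) ⊕ (a ⋆ θ b)
  θ-⋆ a b zero    = solve 2 (λ x y → con (+ 0) :* (x :* y) := con (+ 0) :* x :* y :+ x :* (con (+ 0) :* y)) refl _ _
  θ-⋆ a b (suc n) = begin
    ιℤ (+ suc n) * (a 0 * b (suc n) + (a′ ⋆ b) n)
      ≈⟨ *-congʳ (ιℤ-suc n) ⟩
    (1# + ιℤ (+ n)) * (a 0 * b (suc n) + (a′ ⋆ b) n)
      ≈⟨ solve 4 (λ k x y s → (con (+ 1) :+ k) :* (x :* y :+ s) := x :* ((con (+ 1) :+ k) :* y) :+ s :+ k :* s) refl _ _ _ _ ⟩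
    a 0 * ((1# + ιℤ (+ n)) * b (suc n)) + (a′ ⋆ b) n + ιℤ (+ n) * (a′ ⋆ b) n
      ≈⟨ +-cong (+-congʳ (*-congˡ (*-congʳ (sym (ιℤ-suc n))))) (θ-⋆ a′ b n) ⟩
    a 0 * θ b (suc n) + (a′ ⋆ b) n + ((θ a′ ⋆ b) n + (a′ ⋆ θ b) n)
      -- The new summand `0# * a 0 * b (suc n)` is the leading term of `θ a ⋆ b`, because `θ a 0`
      -- carries the factor zero.
      ≈⟨ solve 6 (λ x y s t u z → y :+ s :+ (t :+ u) := con (+ 0) :* x :* z :+ (s :+ t) :+ (y :+ u)) refl (a 0) _ _ _ _ _ ⟩
    0# * a 0 * b (suc n) + ((a′ ⋆ b) n + (θ a′ ⋆ b) n) + (a 0 * θ b (suc n) + (a′ ⋆ θ b) n)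
      ≈⟨ +-congʳ (+-congˡ (⋆-distribʳ b a′ (θ a′) n)) ⟨
    0# * a 0 * b (suc n) + ((a′ ⊕ θ a′) ⋆ b) n + (a 0 * θ b (suc n) + (a′ ⋆ θ b) n)
      ≈⟨ +-congʳ (+-congˡ (⋆-cong θ-suc (λ _ → refl) n)) ⟨
    0# * a 0 * b (suc n) + ((θ a ∘ suc) ⋆ b) n + (a 0 * θ b (suc n) + (a′ ⋆ θ b) n) ∎
    where
    a′ = a ∘ suc
    ιℤ-suc : ∀ n → ιℤ (+ suc n) ≈ 1# + ιℤ (+ n)
    ιℤ-suc n = ιℤ-+ (+ 1) (+ n)
    θ-suc : θ a ∘ suc ≋ a′ ⊕ θ a′
    θ-suc m = trans (*-congʳ (ιℤ-suc m)) (trans (distribʳ _ _ _) (+-congʳ (*-identityˡ _)))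

  ⋆≈0 : ∀ a b n → a 0 ≈ 0# → (∀ m → m ℕ.< n → b m ≈ 0#) → (a ⋆ b) n ≈ 0#
  ⋆≈0 a b zero    a₀≈0 b≈0 = trans (*-congʳ a₀≈0) (zeroˡ _)
  ⋆≈0 a b (suc n) a₀≈0 b≈0 = begin
    a 0 * b (suc n) + ((a ∘ suc) ⋆ b) n  ≈⟨ +-congʳ (trans (*-congʳ a₀≈0) (zeroˡ _)) ⟩
    0# + ((a ∘ suc) ⋆ b) n               ≈⟨ +-identityˡ _ ⟩
    ((a ∘ suc) ⋆ b) n                    ≈⟨ low (a ∘ suc) n (λ m m≤n → b≈0 m (ℕ.s≤s m≤n)) ⟩
    0#                                   ∎
    where
    low : ∀ a n → (∀ m → m ℕ.≤ n → b m ≈ 0#) → (a ⋆ b) n ≈ 0#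
    low a zero    b≈0 = trans (*-congˡ (b≈0 0 ℕ.z≤n)) (zeroʳ _)
    low a (suc n) b≈0 = trans (+-cong (trans (*-congˡ (b≈0 (suc n) ℕ.≤-refl)) (zeroʳ _))
      (low (a ∘ suc) n (λ m m≤n → b≈0 m (ℕ.m≤n⇒m≤1+n m≤n)))) (+-identityˡ 0#)

  -- In degree n + 1 the equation equates (n + 1) u_(n+1) with a combination of u_0, ..., u_n, since
  -- `a 0` vanishes; the integer n + 1 can be cancelled.
  θ-ode-unique : ∀ a u → a 0 ≈ 0# → θ u ≋ a ⋆ u → u 0 ≈ 0# → ∀ n → u n ≈ 0#
  θ-ode-unique a u a₀≈0 ode u₀≈0 = <-rec _ λ where
    zero    rec → u₀≈0
    (suc n) rec → ιℤ-cancelˡ n (trans (ode (suc n))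
      (trans (⋆≈0 a u (suc n) a₀≈0 (λ m m<n → rec m<n)) (sym (zeroʳ _))))

  geometric : Carrier → Series
  geometric x n = x ^ n

  geometric-unfold : ∀ x → geometric x ≋ constant 1# ⊕ (constant x ⋆ (w ⋆ geometric x))
  geometric-unfold x zero    = sym (trans (+-congˡ (trans (*-congˡ (w⋆-zero (geometric x))) (zeroʳ x))) (+-identityʳ 1#))
  geometric-unfold x (suc n) = sym (trans (+-identityˡ _) (trans (constant-⋆ x _ (suc n)) (*-congˡ (w⋆-suc (geometric x) n))))

  ⋆-low : ∀ a b n → (∀ m → m ℕ.< n → b m ≈ 0#) → (a ⋆ b) n ≈ a 0 * b n
  ⋆-low a b zero    b≈0 = refl
  ⋆-low a b (suc n) b≈0 = trans (⋆-sucʳ a b n) (trans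
    (+-cong (⋆-low a (b ∘ suc) n (λ m m<n → b≈0 (suc m) (ℕ.s≤s m<n))) (trans (*-congˡ (b≈0 0 (ℕ.s≤s ℕ.z≤n))) (zeroʳ _)))
    (+-identityʳ _))

  -- The series `a` has order one with an invertible integer as leading coefficient, so b m can be
  -- read off from degree m + 1 of the product. Applied to z^p - 1 in the variable z - 1, whose
  -- leading coefficient is p.
  ⋆-cancel : ∀ a b n → a 0 ≈ 0# → a 1 ≈ ιℤ (+ suc n) → (∀ m → (a ⋆ b) m ≈ 0#) → ∀ m → b m ≈ 0#
  ⋆-cancel a b n a₀≈0 a₁≈ ab≈0 = <-rec _ λ m rec → ιℤ-cancelˡ n (begin
    ιℤ (+ suc n) * b m                      ≈⟨ *-congʳ a₁≈ ⟨
    a 1 * b m                               ≈⟨ ⋆-low (a ∘ suc) b m (λ i i<m → rec i<m) ⟨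
    ((a ∘ suc) ⋆ b) m                       ≈⟨ +-identityˡ _ ⟨
    0# + ((a ∘ suc) ⋆ b) m                  ≈⟨ +-congʳ (trans (*-congʳ a₀≈0) (zeroˡ _)) ⟨
    (a ⋆ b) (suc m)                         ≈⟨ ab≈0 (suc m) ⟩
    0#                                      ≈⟨ zeroʳ _ ⟨
    ιℤ (+ suc n) * 0#                       ∎)

-- Finite sums

module RangeSum (R : Semiring 0ℓ 0ℓ) where
  open Semiring R
  open import Algebra.Properties.Semiring.Sum R public
    using (sum; sum-cong-≋; sum-cong-≗; ∑-distrib-+; ∑-comm; sum-permute; *-distribˡ-sum; *-distribʳ-sum; sum-init-last)
  open import Relation.Binary.Reasoning.Setoid setoid

  -- Summands live on ℕ rather than on `Fin n`, so that indices such as k + l and p - k can be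
  -- formed freely.
  Σ< : ℕ → (ℕ → Carrier) → Carrier
  Σ< n f = sum {n} (λ i → f (toℕ i))

  Σ<-cong : ∀ n {f g} → (∀ i → i < n → f i ≈ g i) → Σ< n f ≈ Σ< n g
  Σ<-cong n f≈g = sum-cong-≋ {n} (λ i → f≈g (toℕ i) (Fin.toℕ<n i))

  Σ<-+ : ∀ n f g → Σ< n (λ i → f i + g i) ≈ Σ< n f + Σ< n g
  Σ<-+ n f g = ∑-distrib-+ {n} (λ i → f (toℕ i)) (λ i → g (toℕ i))

  *-Σ< : ∀ n x f → x * Σ< n f ≈ Σ< n (λ i → x * f i)
  *-Σ< n x f = *-distribˡ-sum {n} x (λ i → f (toℕ i))

  Σ<-comm : ∀ m n (f : ℕ → ℕ → Carrier) → Σ< m (λ i → Σ< n (f i)) ≈ Σ< n (λ j → Σ< m (λ i → f i j))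
  Σ<-comm m n f = ∑-comm {m} {n} (λ i j → f (toℕ i) (toℕ j))

  Σ<-snoc : ∀ n f → Σ< (suc n) f ≈ Σ< n f + f n
  Σ<-snoc zero    f = trans (+-identityʳ _) (sym (+-identityˡ _))
  Σ<-snoc (suc n) f = trans (+-congˡ (Σ<-snoc n (f ∘ suc))) (sym (+-assoc _ _ _))

  Σ<-reverse : ∀ n f → Σ< n f ≈ Σ< n (λ i → f (n ∸ suc i))
  Σ<-reverse n f = trans (sum-permute {n} {n} (λ i → f (toℕ i)) reverse)
    (sum-cong-≋ {n} λ i → reflexive (cong f (Fin.opposite-prop i)))

  Σ<-shift : ∀ n f → f n ≈ f 0 → Σ< n (f ∘ suc) ≈ Σ< n f
  Σ<-shift zero    f fn≈f0 = refl
  Σ<-shift (suc n) f fn≈f0 = begin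
    Σ< (suc n) (f ∘ suc)       ≈⟨ Σ<-snoc n (f ∘ suc) ⟩
    Σ< n (f ∘ suc) + f (suc n) ≈⟨ +-congˡ fn≈f0 ⟩
    Σ< n (f ∘ suc) + f 0       ≈⟨ +-comm _ _ ⟩
    Σ< (suc n) f               ∎

  -- Moving the window by one place trades f m for f (m + n), which periodicity identifies.
  Σ<-translate : ∀ n f → (∀ i → f (i ℕ.+ n) ≈ f i) → ∀ m → Σ< n (λ i → f (m ℕ.+ i)) ≈ Σ< n f
  Σ<-translate n f periodic zero    = refl
  Σ<-translate n f periodic (suc m) = begin
    Σ< n (λ i → f (suc m ℕ.+ i))  ≈⟨ Σ<-cong n (λ i _ → reflexive (cong f (≡.sym (ℕ.+-suc m i)))) ⟩
    Σ< n (λ i → f (m ℕ.+ suc i))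
      ≈⟨ Σ<-shift n (λ i → f (m ℕ.+ i)) (trans (periodic m) (reflexive (cong f (≡.sym (ℕ.+-identityʳ m))))) ⟩
    Σ< n (λ i → f (m ℕ.+ i))      ≈⟨ Σ<-translate n f periodic m ⟩
    Σ< n f                        ∎

  Σ<-zero : ∀ n f → (∀ i → i < n → f i ≈ 0#) → Σ< n f ≈ 0#
  Σ<-zero zero    f f≈0 = refl
  Σ<-zero (suc n) f f≈0 = trans (+-cong (f≈0 0 (s≤s z≤n)) (Σ<-zero n (f ∘ suc) (λ i i<n → f≈0 (suc i) (s≤s i<n)))) (+-identityˡ 0#)

  Σ<-single : ∀ n k f → k < n → (∀ i → i < n → i ≢ k → f i ≈ 0#) → Σ< n f ≈ f k
  Σ<-single (suc n) zero    f k<n f≈0 =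
    trans (+-congˡ (Σ<-zero n (f ∘ suc) (λ i i<n → f≈0 (suc i) (s≤s i<n) λ ()))) (+-identityʳ _)
  Σ<-single (suc n) (suc k) f (s≤s k<n) f≈0 =
    trans (+-cong (f≈0 0 (s≤s z≤n) λ ())
      (Σ<-single n k (f ∘ suc) k<n (λ i i<n i≢k → f≈0 (suc i) (s≤s i<n) (i≢k ∘ ℕ.suc-injective))))
    (+-identityˡ _)

  -- Meant for rows in which only the indices k and p - k survive, and for the two surviving powers
  -- of z in the partial fraction expansion.
  Σ<-pair : ∀ n k l f → k < n → l < n → k ≢ l → (∀ i → i < n → i ≢ k → i ≢ l → f i ≈ 0#) → Σ< n f ≈ f k + f l
  Σ<-pair (suc n) zero    zero    f k<n l<n k≢l f≈0 = ⊥-elim (k≢l ≡.refl)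
  Σ<-pair (suc n) zero    (suc l) f k<n (s≤s l<n) k≢l f≈0 =
    +-congˡ (Σ<-single n l (f ∘ suc) l<n (λ i i<n i≢l → f≈0 (suc i) (s≤s i<n) (λ ()) (i≢l ∘ ℕ.suc-injective)))
  Σ<-pair (suc n) (suc k) zero    f (s≤s k<n) l<n k≢l f≈0 = trans
    (+-congˡ (Σ<-single n k (f ∘ suc) k<n (λ i i<n i≢k → f≈0 (suc i) (s≤s i<n) (i≢k ∘ ℕ.suc-injective) (λ ()))))
    (+-comm _ _)
  Σ<-pair (suc n) (suc k) (suc l) f (s≤s k<n) (s≤s l<n) k≢l f≈0 =
    trans (+-cong (f≈0 0 (s≤s z≤n) (λ ()) (λ ()))
      (Σ<-pair n k l (f ∘ suc) k<n l<n (k≢l ∘ cong suc)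
        (λ i i<n i≢k i≢l → f≈0 (suc i) (s≤s i<n) (i≢k ∘ ℕ.suc-injective) (i≢l ∘ ℕ.suc-injective))))
    (+-identityˡ _)

-- Roots of unity and cotangent identities

-- ζ plays the role of a primitive p-th root of unity, p = suc r, and d k is
-- 1 / (1 - ζ ^ k); the value 1 / 2 at p ∣ k makes c below an odd function.
record RootOfUnity (R : ℚ-Algebra) (r : ℕ) : Set where
  open ℚ-Algebra R
  field
    ζ         : Carrier
    ζ^p≈1     : ζ ^ suc r ≈ 1#
    d         : ℕ → Carrier
    2d≈1      : ∀ {k} → suc r ∣ k → ιℤ (+ 2) * d k ≈ 1#
    d-inverse : ∀ {k} → suc r ∤ k → (1# - ζ ^ k) * d k ≈ 1#

module Cotangent (R : ℚ-Algebra) (r : ℕ) (ρ : RootOfUnity R r) where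
  open ℚ-Algebra R
  open RootOfUnity ρ
  open Solver using (solve; _:=_; _:+_; _:*_; _:-_; :-_; con)
  open RangeSum semiring
  open import Relation.Binary.Reasoning.Setoid setoid

  p : ℕ
  p = suc r

  ζ^≈1 : ∀ {k} → p ∣ k → ζ ^ k ≈ 1#
  ζ^≈1 (divides m ≡.refl) = begin
    ζ ^ (m ℕ.* p)  ≡⟨ cong (ζ ^_) (ℕ.*-comm m p) ⟩
    ζ ^ (p ℕ.* m)  ≈⟨ ^-assocʳ ζ p m ⟨
    (ζ ^ p) ^ m    ≈⟨ ^-congˡ m ζ^p≈1 ⟩
    1# ^ m         ≈⟨ 1^ m ⟩
    1#             ∎
    where
    1^ : ∀ m → 1# ^ m ≈ 1#
    1^ zero    = refl
    1^ (suc m) = trans (*-identityˡ _) (1^ m)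

  y c : ℕ → Carrier
  y k = d k * d k - d k
  c k = 1# - ιℤ (+ 2) * d k

  d-unique : ∀ {k x} → p ∤ k → (1# - ζ ^ k) * x ≈ 1# → x ≈ d k
  d-unique {k} {x} p∤k eq = begin
    x                              ≈⟨ *-identityˡ x ⟨
    1# * x                         ≈⟨ *-congʳ (d-inverse p∤k) ⟨
    (1# - ζ ^ k) * d k * x         ≈⟨ solve 3 (λ a b e → a :* b :* e := a :* e :* b) refl _ _ _ ⟩
    (1# - ζ ^ k) * x * d k         ≈⟨ *-congʳ eq ⟩
    1# * d k                       ≈⟨ *-identityˡ _ ⟩
    d k                            ∎

  -- If a b = 1 then 1 / (1 - a) + 1 / (1 - b) = 1. When p divides k it divides l as well, and both
  -- values are the default 1 / 2.
  d-opposite : ∀ {k l} → p ∣ k ℕ.+ l → d k + d l ≈ 1#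
  d-opposite {k} {l} p∣k+l with p ∣? k
  ... | yes p∣k = ιℤ-cancelˡ 1 (begin
    ιℤ (+ 2) * (d k + d l)             ≈⟨ distribˡ _ _ _ ⟩
    ιℤ (+ 2) * d k + ιℤ (+ 2) * d l    ≈⟨ +-cong (2d≈1 p∣k) (2d≈1 (∣m+n∣m⇒∣n p∣k+l p∣k)) ⟩
    1# + 1#                            ≈⟨ solve 0 (con (+ 1) :+ con (+ 1) := con (+ 2) :* con (+ 1)) refl ⟩
    ιℤ (+ 2) * 1#                      ∎)
  ... | no p∤k = begin
    α + β
      -- Padding each summand with a factor (1 - ζ^k) d_k = 1 replaces clearing denominators by a
      -- polynomial identity.
      ≈⟨ +-cong (trans (*-congˡ (d-inverse p∤l)) (*-identityʳ α)) (trans (*-congˡ (d-inverse p∤k)) (*-identityʳ β)) ⟨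
    α * ((1# - b) * β) + β * ((1# - a) * α)
      ≈⟨ solve 4 (λ α β a b → α :* ((con (+ 1) :- b) :* β) :+ β :* ((con (+ 1) :- a) :* α)
           := ((con (+ 1) :- a) :* α) :* ((con (+ 1) :- b) :* β) :+ (con (+ 1) :- a :* b) :* (α :* β)) refl α β a b ⟩
    ((1# - a) * α) * ((1# - b) * β) + (1# - a * b) * (α * β)
      ≈⟨ +-cong (*-cong (d-inverse p∤k) (d-inverse p∤l)) (*-congʳ (+-congˡ (-‿cong ab≈1))) ⟩
    1# * 1# + (1# - 1#) * (α * β)
      ≈⟨ solve 1 (λ x → con (+ 1) :* con (+ 1) :+ (con (+ 1) :- con (+ 1)) :* x := con (+ 1)) refl (α * β) ⟩
    1# ∎
    where
    α = d k
    β = d l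
    a = ζ ^ k
    b = ζ ^ l
    p∤l : p ∤ l
    p∤l p∣l = p∤k (∣m+n∣m⇒∣n (≡.subst (p ∣_) (ℕ.+-comm k l) p∣k+l) p∣l)
    ab≈1 : a * b ≈ 1#
    ab≈1 = trans (sym (^-homo-* ζ k l)) (ζ^≈1 p∣k+l)

  c-odd : ∀ {k l} → p ∣ k ℕ.+ l → c l ≈ - c k
  c-odd {k} {l} p∣k+l = begin
    1# - ιℤ (+ 2) * d l
      ≈⟨ solve 2 (λ a b → con (+ 1) :- con (+ 2) :* b := :- (con (+ 1) :- con (+ 2) :* a) :+ con (+ 2) :* (con (+ 1) :- (a :+ b))) refl (d k) (d l) ⟩
    - c k + ιℤ (+ 2) * (1# - (d k + d l))   ≈⟨ +-congˡ (*-congˡ (+-congˡ (-‿cong (d-opposite {k} p∣k+l)))) ⟩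
    - c k + ιℤ (+ 2) * (1# - 1#)
      ≈⟨ solve 1 (λ a → a :+ con (+ 2) :* (con (+ 1) :- con (+ 1)) := a) refl _ ⟩
    - c k ∎

  y-even : ∀ {k l} → p ∣ k ℕ.+ l → y l ≈ y k
  y-even {k} {l} p∣k+l = begin
    d l * d l - d l
      ≈⟨ solve 2 (λ a b → b :* b :- b := a :* a :- a :+ (b :- a) :* (a :+ b :- con (+ 1))) refl (d k) (d l) ⟩
    y k + (d l - d k) * (d k + d l - 1#)  ≈⟨ +-congˡ (*-congˡ (+-congʳ (d-opposite {k} p∣k+l))) ⟩
    y k + (d l - d k) * (1# - 1#)
      ≈⟨ solve 2 (λ a b → a :+ b :* (con (+ 1) :- con (+ 1)) := a) refl _ _ ⟩
    y k ∎

  -- The function `d` is arbitrary apart from its defining equations; these depend on k modulo p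
  -- only and determine 2 d_k.
  c-periodic : ∀ k → c (k ℕ.+ p) ≈ c k
  c-periodic k = +-congˡ (-‿cong (lemma (p ∣? k)))
    where
    lemma : _ → ιℤ (+ 2) * d (k ℕ.+ p) ≈ ιℤ (+ 2) * d k
    lemma (yes p∣k) = trans (2d≈1 (∣m∣n⇒∣m+n p∣k ∣-refl)) (sym (2d≈1 p∣k))
    lemma (no  p∤k) = *-congˡ (d-unique p∤k (trans (*-congʳ (+-congˡ (-‿cong (sym ζ^k+p)))) (d-inverse p∤k+p)))
      where
      ζ^k+p : ζ ^ (k ℕ.+ p) ≈ ζ ^ k
      ζ^k+p = trans (^-homo-* ζ k p) (trans (*-congˡ ζ^p≈1) (*-identityʳ _))
      p∤k+p : p ∤ k ℕ.+ p
      p∤k+p p∣k+p = p∤k (∣m+n∣m⇒∣n (≡.subst (p ∣_) (ℕ.+-comm k p) p∣k+p) ∣-refl)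

  -- For ζ = exp(2πi/p) one has c_k = -i cot(πk/p), and this is the addition formula of the
  -- cotangent. Expanded in d it is four times the identity `key`, d_(k+l) (d_k + d_l - 1) = d_k
  -- d_l.
  c-addition : ∀ {k l} → p ∤ k → p ∤ l → p ∤ k ℕ.+ l → c (k ℕ.+ l) * (c k + c l) ≈ c k * c l + 1#
  c-addition {k} {l} p∤k p∤l p∤k+l = begin
    (1# - ιℤ (+ 2) * γ) * (1# - ιℤ (+ 2) * α + (1# - ιℤ (+ 2) * β))
      ≈⟨ solve 3 (λ α β γ → (con (+ 1) :- con (+ 2) :* γ) :* (con (+ 1) :- con (+ 2) :* α :+ (con (+ 1) :- con (+ 2) :* β))
           := (con (+ 1) :- con (+ 2) :* α) :* (con (+ 1) :- con (+ 2) :* β) :+ con (+ 1)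
              :+ con (+ 4) :* (γ :* (α :+ β :- con (+ 1)) :- α :* β)) refl α β γ ⟩
    c k * c l + 1# + ιℤ (+ 4) * (γ * (α + β - 1#) - α * β)
      ≈⟨ +-congˡ (*-congˡ (+-congʳ key)) ⟩
    c k * c l + 1# + ιℤ (+ 4) * (α * β - α * β)
      ≈⟨ solve 2 (λ a b → a :+ con (+ 4) :* (b :- b) := a) refl _ _ ⟩
    c k * c l + 1# ∎
    where
    α = d k
    β = d l
    γ = d (k ℕ.+ l)
    a = ζ ^ k
    b = ζ ^ l
    key : γ * (α + β - 1#) ≈ α * β
    key = begin
      γ * (α + β - 1#)
        ≈⟨ *-congˡ (+-cong (+-cong
             (trans (*-congˡ (d-inverse p∤l)) (*-identityʳ α)) (trans (*-congˡ (d-inverse p∤k)) (*-identityʳ β)))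
             (-‿cong (trans (*-cong (d-inverse p∤k) (d-inverse p∤l)) (*-identityˡ 1#)))) ⟨
      γ * (α * ((1# - b) * β) + β * ((1# - a) * α) - (1# - a) * α * ((1# - b) * β))
        ≈⟨ solve 5 (λ α β γ a b → γ :* (α :* ((con (+ 1) :- b) :* β) :+ β :* ((con (+ 1) :- a) :* α)
              :- (con (+ 1) :- a) :* α :* ((con (+ 1) :- b) :* β))
             := (con (+ 1) :- a :* b) :* γ :* (α :* β)) refl α β γ a b ⟩
      (1# - a * b) * γ * (α * β)
        ≈⟨ *-congʳ (*-congʳ (+-congˡ (-‿cong (^-homo-* ζ k l)))) ⟨
      (1# - ζ ^ (k ℕ.+ l)) * γ * (α * β)  ≈⟨ *-congʳ (d-inverse p∤k+l) ⟩
      1# * (α * β)                        ≈⟨ *-identityˡ _ ⟩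
      α * β                               ∎

  c-0 : ∀ {k} → p ∣ k → c k ≈ 0#
  c-0 p∣k = trans (+-congˡ (-‿cong (2d≈1 p∣k))) (-‿inverseʳ 1#)

  Σ≢0 : (ℕ → Carrier) → Carrier
  Σ≢0 f = Σ< r (f ∘ suc)

  Σ≢0-cong : ∀ {f g} → (∀ k → p ∤ k → f k ≈ g k) → Σ≢0 f ≈ Σ≢0 g
  Σ≢0-cong f≈g = Σ<-cong r λ i i<r → f≈g (suc i) (>⇒∤ (s≤s i<r))

  Σ≢0-reflect : ∀ f → Σ≢0 f ≈ Σ≢0 (λ k → f (p ∸ k))
  Σ≢0-reflect f = trans (Σ<-reverse r (f ∘ suc)) (Σ<-cong r λ i i<r →
    reflexive (cong f (≡.sym (ℕ.+-∸-assoc 1 i<r))))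

  Σ-c≈0 : Σ< p c ≈ 0#
  Σ-c≈0 = ιℤ-cancelˡ 1 (begin
    ιℤ (+ 2) * Σ< p c                    ≈⟨ solve 1 (λ x → con (+ 2) :* x := x :+ x) refl _ ⟩
    Σ< p c + Σ< p c
      ≈⟨ +-congˡ (+-cong refl (Σ≢0-reflect c)) ⟩
    (c 0 + Σ≢0 c) + (c 0 + Σ≢0 (λ k → c (p ∸ k)))
      ≈⟨ solve 3 (λ a x y → (a :+ x) :+ (a :+ y) := con (+ 2) :* a :+ (x :+ y)) refl _ _ _ ⟩
    ιℤ (+ 2) * c 0 + (Σ≢0 c + Σ≢0 (λ k → c (p ∸ k)))
      ≈⟨ +-cong (trans (*-congˡ (c-0 (p ∣0))) (zeroʳ _)) (sym (∑-distrib-+ {r} _ _)) ⟩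
    0# + Σ≢0 (λ k → c k + c (p ∸ k))
      ≈⟨ +-congˡ (Σ<-zero r _ λ i i<r → trans (+-congˡ (c-odd {suc i} (≡.subst (p ∣_) (≡.sym (ℕ.m+[n∸m]≡n (ℕ.m≤n⇒m≤1+n i<r))) ∣-refl))) (-‿inverseʳ _)) ⟩
    0# + 0#
      ≈⟨ solve 0 (con (+ 0) :+ con (+ 0) := con (+ 2) :* con (+ 0)) refl ⟩
    ιℤ (+ 2) * 0# ∎)

  -- A full period of the odd function c sums to zero, and the index l = 0 that is left out
  -- contributes c k.
  Σ≢0-c+ : ∀ k → Σ≢0 (λ l → c (k ℕ.+ l)) ≈ - c k
  Σ≢0-c+ k = begin
    s                       ≈⟨ solve 2 (λ a s → s := :- a :+ (a :+ s)) refl (c k) s ⟩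
    - c k + (c k + s)       ≡⟨ cong (λ x → - c k + (c x + s)) (≡.sym (ℕ.+-identityʳ k)) ⟩
    - c k + Σ< p (λ l → c (k ℕ.+ l)) ≈⟨ +-congˡ (trans (Σ<-translate p c c-periodic k) Σ-c≈0) ⟩
    - c k + 0#              ≈⟨ +-identityʳ _ ⟩
    - c k                   ∎
    where s = Σ≢0 (λ l → c (k ℕ.+ l))

  Σ≢0-c- : ∀ k → Σ≢0 (λ l → c (k ℕ.+ (p ∸ l))) ≈ - c k
  Σ≢0-c- k = trans (sym (Σ≢0-reflect (λ l → c (k ℕ.+ l)))) (Σ≢0-c+ k)

-- Derivations and the Riccati equation

-- Abstracts w d/dw on power series. The Riccati computation uses only these rules, so it is plain
-- algebra in one ring, with w, P and θP as atoms.
record Derivation (R : ℚ-Algebra) : Set where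
  open ℚ-Algebra R
  field
    θ      : Carrier → Carrier
    θ-cong : ∀ {a b} → a ≈ b → θ a ≈ θ b
    θ-+    : ∀ a b → θ (a + b) ≈ θ a + θ b
    θ-*    : ∀ a b → θ (a * b) ≈ θ a * b + a * θ b
    θ-ι    : ∀ q → θ (ι q) ≈ 0#
    w      : Carrier
    θ-w    : θ w ≈ w

  θ-ιℤ : ∀ i → θ (ιℤ i) ≈ 0#
  θ-ιℤ i = trans (θ-cong (ιℤ≈ i)) (θ-ι _)

module _ {R : ℚ-Algebra} (D : Derivation R) where
  open ℚ-Algebra R
  open Derivation D
  open Solver using (solve; _:=_; _:+_; _:*_; _:-_; :-_; con)
  open RangeSum semiring
  open import Relation.Binary.Reasoning.Setoid setoid

  θ-Σ< : ∀ n f → θ (Σ< n f) ≈ Σ< n (θ ∘ f)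
  θ-Σ< zero    f = θ-ιℤ (+ 0)
  θ-Σ< (suc n) f = trans (θ-+ _ _) (+-congˡ (θ-Σ< n (f ∘ suc)))

  θ-neg : ∀ x → θ (- x) ≈ - θ x
  θ-neg x = begin
    θ (- x)                    ≈⟨ solve 2 (λ a b → a := b :+ a :- b) refl (θ (- x)) (θ x) ⟩
    θ x + θ (- x) - θ x        ≈⟨ +-congʳ (θ-+ x (- x)) ⟨
    θ (x - x) - θ x            ≈⟨ +-congʳ (trans (θ-cong (-‿inverseʳ x)) (θ-ιℤ (+ 0))) ⟩
    0# - θ x                   ≈⟨ +-identityˡ _ ⟩
    - θ x                      ∎

  θ-scale : ∀ {x} → θ x ≈ 0# → ∀ a → θ (x * a) ≈ x * θ a
  θ-scale {x} θx a = trans (θ-* x a) (trans (+-congʳ (trans (*-congʳ θx) (zeroˡ a))) (+-identityˡ _))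

  IsGeometric : Carrier → Carrier → Set
  IsGeometric x e = e ≈ 1# + x * (w * e)

  -- e is the inverse of 1 - x w.
  *-geometric : ∀ {x e} → IsGeometric x e → ∀ a → e * (a - x * (w * a)) ≈ a
  *-geometric {x} {e} eq a = begin
    e * (a - x * (w * a))     ≈⟨ solve 4 (λ e a x w → e :* (a :- x :* (w :* a)) := a :* (e :- x :* (w :* e))) refl e a x w ⟩
    a * (e - x * (w * e))     ≈⟨ *-congˡ (+-congʳ eq) ⟩
    a * (1# + x * (w * e) - x * (w * e)) ≈⟨ solve 2 (λ a b → a :* (con (+ 1) :+ b :- b) := a) refl a _ ⟩
    a                         ∎

  geometric-unique : ∀ {x x′ e e′} → x ≈ x′ → IsGeometric x e → IsGeometric x′ e′ → e′ ≈ e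
  geometric-unique {x} {x′} {e} {e′} x≈x′ g g′ = begin
    e′                                          ≈⟨ *-geometric g e′ ⟨
    e * (e′ - x * (w * e′))                     ≈⟨ *-congˡ (+-cong g′ (-‿cong (*-congʳ x≈x′))) ⟩
    e * (1# + x′ * (w * e′) - x′ * (w * e′))
      ≈⟨ solve 2 (λ a b → a :* (con (+ 1) :+ b :- b) := a) refl e _ ⟩
    e                                           ∎

  -- This is θ applied to (1 - x w) b = a, with the part of the product rule that differentiates w
  -- moved to the right.
  θ-linear-step : ∀ {x} → θ x ≈ 0# → ∀ a b → b ≈ a + x * (w * b) → θ b - x * (w * θ b) ≈ θ a + x * (w * b)
  θ-linear-step {x} θx a b eq = begin
    θ b - x * (w * θ b)
      ≈⟨ +-congʳ (trans (θ-cong eq) (trans (θ-+ a _) (+-congˡ (trans (θ-* x _) (+-cong (*-congʳ θx) (*-congˡ (trans (θ-* w b) (+-congʳ (*-congʳ θ-w))))))))) ⟩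
    θ a + (0# * (w * b) + x * (w * b + w * θ b)) - x * (w * θ b)
      ≈⟨ solve 5 (λ s t x w b → s :+ (con (+ 0) :* (w :* b) :+ x :* (w :* b :+ w :* t)) :- x :* (w :* t) := s :+ x :* (w :* b)) refl (θ a) (θ b) x w b ⟩
    θ a + x * (w * b) ∎

  θ-geometric : ∀ {x e} → θ x ≈ 0# → IsGeometric x e → θ e ≈ e * (e - 1#)
  θ-geometric {x} {e} θx g = begin
    θ e                        ≈⟨ *-geometric g (θ e) ⟨
    e * (θ e - x * (w * θ e))  ≈⟨ *-congˡ (θ-linear-step θx 1# e g) ⟩
    e * (θ 1# + x * (w * e))   ≈⟨ *-congˡ (+-congʳ (θ-ιℤ (+ 1))) ⟩
    e * (0# + x * (w * e))     ≈⟨ *-congˡ (solve 1 (λ a → con (+ 0) :+ a := con (+ 1) :+ a :- con (+ 1)) refl _) ⟩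
    e * (1# + x * (w * e) - 1#) ≈⟨ *-congˡ (+-congʳ g) ⟨
    e * (e - 1#)               ∎

  -- h n is the product of 1 / (1 - x i w) over i < n.
  θ-product : (x e h : ℕ → Carrier) →
    (∀ i → θ (x i) ≈ 0#) → (∀ i → IsGeometric (x i) (e i)) →
    h 0 ≈ 1# → (∀ n → h (suc n) ≈ h n + x n * (w * h (suc n))) →
    ∀ n → θ (h n) ≈ Σ< n (λ i → e i - 1#) * h n
  θ-product x e h θx g h₀ h₊ zero    = trans (θ-cong h₀) (trans (θ-ιℤ (+ 1)) (sym (zeroˡ _)))
  θ-product x e h θx g h₀ h₊ (suc n) = begin
    θ h′                                          ≈⟨ *-geometric (g n) (θ h′) ⟨
    e n * (θ h′ - x n * (w * θ h′))               ≈⟨ *-congˡ (θ-linear-step (θx n) (h n) h′ (h₊ n)) ⟩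
    e n * (θ (h n) + x n * (w * h′))              ≈⟨ *-congˡ (+-congʳ (θ-product x e h θx g h₀ h₊ n)) ⟩
    e n * (s * h n + x n * (w * h′))
      -- The recursion is read backwards as h n = (1 - x_n w) h (n + 1), so that `e n` can cancel
      -- the factor.
      ≈⟨ *-congˡ (+-congʳ (*-congˡ (trans (solve 2 (λ a b → a := a :+ b :- b) refl (h n) _) (+-congʳ (sym (h₊ n)))))) ⟩
    e n * (s * (h′ - x n * (w * h′)) + x n * (w * h′))
      ≈⟨ solve 5 (λ e s h x w → e :* (s :* (h :- x :* (w :* h)) :+ x :* (w :* h))
           := s :* (e :* (h :- x :* (w :* h))) :+ x :* (w :* e) :* h) refl (e n) s h′ (x n) w ⟩
    s * (e n * (h′ - x n * (w * h′))) + x n * (w * e n) * h′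
      ≈⟨ +-cong (*-congˡ (*-geometric (g n) h′)) (*-congʳ (trans (solve 1 (λ a → a := con (+ 1) :+ a :- con (+ 1)) refl _) (+-congʳ (sym (g n))))) ⟩
    s * h′ + (e n - 1#) * h′                      ≈⟨ distribʳ _ _ _ ⟨
    (s + (e n - 1#)) * h′                         ≈⟨ *-congʳ (Σ<-snoc n (λ i → e i - 1#)) ⟨
    Σ< (suc n) (λ i → e i - 1#) * h′              ∎
    where
    h′ = h (suc n)
    s = Σ< n (λ i → e i - 1#)

  -- Partial fractions in w of e f = 1 / ((1 - x w) (1 - y w)); for x = y k and
  -- y = y l the numbers u and v are the cotangents of k + l and k - l.
  pair-identity : ∀ {x y e f a b u v} →
    IsGeometric x e → IsGeometric y f →
    ιℤ (+ 4) * x ≈ a * a - 1# → ιℤ (+ 4) * y ≈ b * b - 1# →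
    u * (a + b) ≈ a * b + 1# → v * (a - b) ≈ 1# - a * b →
    ιℤ (+ 2) * (ιℤ (+ 4) + w) * ((e - 1#) * (f - 1#))
      + (w * ((e - 1#) * (a * (u + v))) + w * ((f - 1#) * (b * (u - v)))) ≈ 0#
  pair-identity {x} {y} {e} {f} {a} {b} {u} {v} ge gf 4x 4y uab vab = begin
    ιℤ (+ 2) * (ιℤ (+ 4) + w) * ((e - 1#) * (f - 1#))
      + (w * ((e - 1#) * (a * (u + v))) + w * ((f - 1#) * (b * (u - v))))
      -- The single terms are brought over the common denominator of e f: f (1 - y w) = 1 is
      -- inserted next to e, and e (1 - x w) = 1 next to f. What remains to vanish is a linear
      -- polynomial in w, with coefficients `z₀` and `z₁`.
      ≈⟨ +-cong (*-congˡ (*-cong (e-1 ge) (e-1 gf)))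
           (+-cong (*-congˡ (*-congʳ (trans (e-1 ge) (*-congˡ (*-congˡ (sym (*-geometric gf e)))))))
                   (*-congˡ (*-congʳ (trans (e-1 gf) (*-congˡ (*-congˡ (sym (*-geometric ge f)))))))) ⟩
    ιℤ (+ 2) * (ιℤ (+ 4) + w) * (x * (w * e) * (y * (w * f)))
      + (w * (x * (w * (f * (e - y * (w * e)))) * (a * (u + v)))
        + w * (y * (w * (e * (f - x * (w * f)))) * (b * (u - v))))
      ≈⟨ solve 9 (λ w x y e f a b u v →
           con (+ 2) :* (con (+ 4) :+ w) :* (x :* (w :* e) :* (y :* (w :* f)))
           :+ (w :* (x :* (w :* (f :* (e :- y :* (w :* e)))) :* (a :* (u :+ v)))
             :+ w :* (y :* (w :* (e :* (f :- x :* (w :* f)))) :* (b :* (u :- v))))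
           := w :* w :* e :* f :* ((con (+ 8) :* (x :* y) :+ x :* a :* (u :+ v) :+ y :* b :* (u :- v))
                :+ w :* (x :* y) :* (con (+ 2) :- (u :* (a :+ b) :+ v :* (a :- b))))) refl w x y e f a b u v ⟩
    w * w * e * f * ((ιℤ (+ 8) * (x * y) + x * a * (u + v) + y * b * (u - v))
      + w * (x * y) * (ιℤ (+ 2) - (u * (a + b) + v * (a - b))))
      ≈⟨ *-congˡ (+-cong z₀ (*-congˡ z₁)) ⟩
    w * w * e * f * (0# + w * (x * y) * 0#)
      ≈⟨ solve 2 (λ a b → a :* (con (+ 0) :+ b :* con (+ 0)) := con (+ 0)) refl _ _ ⟩
    0# ∎
    where
    e-1 : ∀ {x e} → IsGeometric x e → e - 1# ≈ x * (w * e)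
    e-1 g = trans (+-congʳ g) (solve 1 (λ a → con (+ 1) :+ a :- con (+ 1) := a) refl _)
    z₁ : ιℤ (+ 2) - (u * (a + b) + v * (a - b)) ≈ 0#
    z₁ = trans (+-congˡ (-‿cong (+-cong uab vab)))
      (solve 1 (λ a → con (+ 2) :- (a :+ con (+ 1) :+ (con (+ 1) :- a)) := con (+ 0)) refl (a * b))
    -- Multiplying by four brings in 4x = a^2 - 1 and 4y = b^2 - 1. Then u is multiplied by a^3 - a
    -- + b^3 - b and v by a^3 - a - b^3 + b, which are divisible by a + b and a - b, and the
    -- hypotheses on u and v apply.
    z₀ : ιℤ (+ 8) * (x * y) + x * a * (u + v) + y * b * (u - v) ≈ 0#
    z₀ = ιℤ-cancelˡ 1 (begin
      ιℤ (+ 2) * (ιℤ (+ 8) * (x * y) + x * a * (u + v) + y * b * (u - v))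
        ≈⟨ ιℤ-cancelˡ 1 (begin
            ιℤ (+ 2) * (ιℤ (+ 2) * (ιℤ (+ 8) * (x * y) + x * a * (u + v) + y * b * (u - v)))
              ≈⟨ solve 6 (λ x y a b u v → con (+ 2) :* (con (+ 2) :* (con (+ 8) :* (x :* y) :+ x :* a :* (u :+ v) :+ y :* b :* (u :- v)))
                   := con (+ 2) :* ((con (+ 4) :* x) :* (con (+ 4) :* y)) :+ (con (+ 4) :* x) :* a :* (u :+ v) :+ (con (+ 4) :* y) :* b :* (u :- v)) refl x y a b u v ⟩
            ιℤ (+ 2) * ((ιℤ (+ 4) * x) * (ιℤ (+ 4) * y)) + (ιℤ (+ 4) * x) * a * (u + v) + (ιℤ (+ 4) * y) * b * (u - v)
              ≈⟨ +-cong (+-cong (*-congˡ (*-cong 4x 4y)) (*-congʳ (*-congʳ 4x))) (*-congʳ (*-congʳ 4y)) ⟩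
            ιℤ (+ 2) * ((a * a - 1#) * (b * b - 1#)) + (a * a - 1#) * a * (u + v) + (b * b - 1#) * b * (u - v)
              ≈⟨ solve 4 (λ a b u v → con (+ 2) :* ((a :* a :- con (+ 1)) :* (b :* b :- con (+ 1))) :+ (a :* a :- con (+ 1)) :* a :* (u :+ v) :+ (b :* b :- con (+ 1)) :* b :* (u :- v)
                   := con (+ 2) :* ((a :* a :- con (+ 1)) :* (b :* b :- con (+ 1))) :+ u :* (a :+ b) :* (a :* a :- a :* b :+ b :* b :- con (+ 1)) :+ v :* (a :- b) :* (a :* a :+ a :* b :+ b :* b :- con (+ 1))) refl a b u v ⟩
            ιℤ (+ 2) * ((a * a - 1#) * (b * b - 1#)) + u * (a + b) * (a * a - a * b + b * b - 1#) + v * (a - b) * (a * a + a * b + b * b - 1#)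
              ≈⟨ +-cong (+-congˡ (*-congʳ uab)) (*-congʳ vab) ⟩
            ιℤ (+ 2) * ((a * a - 1#) * (b * b - 1#)) + (a * b + 1#) * (a * a - a * b + b * b - 1#) + (1# - a * b) * (a * a + a * b + b * b - 1#)
              ≈⟨ solve 2 (λ a b → con (+ 2) :* ((a :* a :- con (+ 1)) :* (b :* b :- con (+ 1))) :+ (a :* b :+ con (+ 1)) :* (a :* a :- a :* b :+ b :* b :- con (+ 1)) :+ (con (+ 1) :- a :* b) :* (a :* a :+ a :* b :+ b :* b :- con (+ 1)) := con (+ 2) :* con (+ 0)) refl a b ⟩
            ιℤ (+ 2) * 0# ∎) ⟩
      0#  ≈⟨ zeroʳ _ ⟨
      ιℤ (+ 2) * 0# ∎)

module Riccati (R : ℚ-Algebra) (r : ℕ) (ρ : RootOfUnity R r) (D : Derivation R) where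
  open ℚ-Algebra R
  open RootOfUnity ρ
  open Derivation D
  open Cotangent R r ρ
  open Solver using (solve; _:=_; _:+_; _:*_; _:-_; :-_; con)
  open RangeSum semiring
  open import Relation.Binary.Reasoning.Setoid setoid

  module Solution
    (p-odd : ∀ {k} → p ∤ k → p ∤ k ℕ.+ k)
    (θ-y : ∀ k → θ (y k) ≈ 0#)
    (e : ℕ → Carrier) (e-geometric : ∀ k → IsGeometric D (y k) (e k))
    where

    a : ℕ → Carrier
    a k = e k - 1#

    P p₁ : Carrier
    P  = Σ≢0 a
    p₁ = Σ≢0 y

    4y : ∀ k → ιℤ (+ 4) * y k ≈ c k * c k - 1#
    4y k = solve 1 (λ d → con (+ 4) :* (d :* d :- d)
      := (con (+ 1) :- con (+ 2) :* d) :* (con (+ 1) :- con (+ 2) :* d) :- con (+ 1)) refl (d k)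

    -- The difference k - l is represented by k + (p - l), which stays in ℕ and has the same
    -- cotangent.
    cross : ℕ → ℕ → Carrier
    cross k l = w * (a k * (c k * (c (k ℕ.+ l) + c (k ℕ.+ (p ∸ l)))))

    -- The left side of `pair-identity` for the indices k and l, symmetrised: c_(l-k) = -c_(k-l)
    -- accounts for the sign of v in its last term.
    excess : ℕ → ℕ → Carrier
    excess k l = ιℤ (+ 2) * (ιℤ (+ 4) + w) * (a k * a l) + (cross k l + cross l k)

    private
      k+[p∸k] : ∀ {k} → k ≤ p → k ℕ.+ (p ∸ k) ≡ p
      k+[p∸k] = ℕ.m+[n∸m]≡n

      p∣k+[p∸k] : ∀ {k} → k ≤ p → p ∣ k ℕ.+ (p ∸ k)
      p∣k+[p∸k] k≤p = ≡.subst (p ∣_) (≡.sym (k+[p∸k] k≤p)) ∣-refl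

      swap-∣ : ∀ {k l} → k ≤ p → l ≤ p → p ∣ (k ℕ.+ (p ∸ l)) ℕ.+ (l ℕ.+ (p ∸ k))
      swap-∣ {k} {l} k≤p l≤p = ≡.subst (p ∣_) eq (∣m∣n⇒∣m+n ∣-refl ∣-refl)
        where
        eq : p ℕ.+ p ≡ (k ℕ.+ (p ∸ l)) ℕ.+ (l ℕ.+ (p ∸ k))
        eq = ≡.trans (≡.sym (cong₂ ℕ._+_ (k+[p∸k] k≤p) (k+[p∸k] l≤p)))
          (solve′ 4 (λ a b c d → (a :+′ b) :+′ (c :+′ d) :=′ (a :+′ d) :+′ (c :+′ b)) ≡.refl k (p ∸ k) l (p ∸ l))
          where open import Data.Nat.Solver
                open +-*-Solver using () renaming (solve to solve′; _:+_ to _:+′_; _:=_ to _:=′_)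

      ∣⇒≡p : ∀ {m} → p ∣ m → 0 < m → m < p ℕ.+ p → m ≡ p
      ∣⇒≡p (divides 0 ≡.refl) () m<2p
      ∣⇒≡p (divides 1 ≡.refl) 0<m m<2p = ℕ.*-identityˡ p
      ∣⇒≡p (divides (suc (suc q)) ≡.refl) 0<m m<2p =
        ⊥-elim (ℕ.<⇒≱ m<2p (ℕ.+-monoʳ-≤ p (ℕ.m≤m+n p _)))

    a-even : ∀ {k} → k ≤ p → a (p ∸ k) ≈ a k
    a-even {k} k≤p = +-congʳ (geometric-unique D (sym (y-even {k} (p∣k+[p∸k] k≤p))) (e-geometric k) (e-geometric (p ∸ k)))

    -- Away from l = k and l = p - k neither k + l nor k - l is divisible by p, so the addition
    -- formula provides both u and v.
    excess≈0 : ∀ {k l} → 0 < k → k < p → 0 < l → l < p → l ≢ k → l ≢ p ∸ k → excess k l ≈ 0#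
    excess≈0 {k} {l} 0<k k<p 0<l l<p l≢k l≢p∸k = trans
      (+-congˡ (+-congˡ (*-congˡ (*-congˡ (*-congˡ (+-cong
        (reflexive (cong c (ℕ.+-comm l k))) (c-odd {k ℕ.+ (p ∸ l)} (swap-∣ (ℕ.<⇒≤ k<p) (ℕ.<⇒≤ l<p)))))))))
      (pair-identity D (e-geometric k) (e-geometric l) (4y k) (4y l)
        (c-addition p∤k p∤l p∤k+l) c-subtraction)
      where
      instance
        k≢0 = ℕ.>-nonZero 0<k
        l≢0 = ℕ.>-nonZero 0<l
      p∤k : p ∤ k
      p∤k = >⇒∤ k<p
      p∤l : p ∤ l
      p∤l = >⇒∤ l<p
      p∸l≡ : l ℕ.+ (p ∸ l) ≡ p
      p∸l≡ = k+[p∸k] (ℕ.<⇒≤ l<p)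
      p∤k+l : p ∤ k ℕ.+ l
      p∤k+l p∣k+l = l≢p∸k (≡.trans (≡.sym (ℕ.m+n∸m≡n k l))
        (cong (_∸ k) (∣⇒≡p p∣k+l (ℕ.<-≤-trans 0<k (ℕ.m≤m+n k l)) (ℕ.+-mono-< k<p l<p))))
      p∤k-l : p ∤ k ℕ.+ (p ∸ l)
      p∤k-l p∣k-l = l≢k (ℕ.+-cancelʳ-≡ (p ∸ l) l k (≡.trans p∸l≡ (≡.sym
        (∣⇒≡p p∣k-l (ℕ.<-≤-trans 0<k (ℕ.m≤m+n k (p ∸ l))) (ℕ.+-mono-<-≤ k<p (ℕ.m∸n≤m p l))))))
      p∤p∸l : p ∤ p ∸ l
      p∤p∸l p∣p∸l = p∤l (∣m+n∣m⇒∣n (≡.subst (p ∣_) (≡.trans (≡.sym p∸l≡) (ℕ.+-comm l _)) ∣-refl) p∣p∸l)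
      c-subtraction : c (k ℕ.+ (p ∸ l)) * (c k - c l) ≈ 1# - c k * c l
      c-subtraction = begin
        c (k ℕ.+ (p ∸ l)) * (c k - c l)         ≈⟨ *-congˡ (+-congˡ (sym c-)) ⟩
        c (k ℕ.+ (p ∸ l)) * (c k + c (p ∸ l))   ≈⟨ c-addition p∤k p∤p∸l p∤k-l ⟩
        c k * c (p ∸ l) + 1#                    ≈⟨ +-congʳ (*-congˡ c-) ⟩
        c k * - c l + 1#
          ≈⟨ solve 2 (λ a b → a :* :- b :+ con (+ 1) := con (+ 1) :- a :* b) refl (c k) (c l) ⟩
        1# - c k * c l ∎
        where
        c- : c (p ∸ l) ≈ - c l
        c- = c-odd {l} (p∣k+[p∸k] (ℕ.<⇒≤ l<p))

    -- The common value of `excess` at the two exceptional indices l = k and l = p - k. One of the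
    -- cotangents of k + l and k - l is then that of a multiple of p, hence zero, and the other is
    -- c_(2k).
    diagonal : ℕ → Carrier
    diagonal k = ιℤ (+ 2) * (ιℤ (+ 4) + w) * (a k * a k) + w * (a k * (ιℤ (+ 2) * (c k * c (k ℕ.+ k))))

    excess-diagonal : ∀ {k} → k ≤ p → excess k k ≈ diagonal k
    excess-diagonal {k} k≤p = +-congˡ (trans
      (+-cong c≈ c≈)
      (solve 4 (λ w a c c₂ → w :* (a :* (c :* (c₂ :+ con (+ 0)))) :+ w :* (a :* (c :* (c₂ :+ con (+ 0))))
        := w :* (a :* (con (+ 2) :* (c :* c₂)))) refl w (a k) (c k) _))
      where
      c≈ : cross k k ≈ w * (a k * (c k * (c (k ℕ.+ k) + 0#)))
      c≈ = *-congˡ (*-congˡ (*-congˡ (+-congˡ (c-0 (p∣k+[p∸k] k≤p)))))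

    excess-antidiagonal : ∀ {k} → k ≤ p → excess k (p ∸ k) ≈ diagonal k
    excess-antidiagonal {k} k≤p = +-cong (*-congˡ (*-congˡ (a-even k≤p)))
      (trans (+-cong
        (*-congˡ (*-congˡ (*-congˡ (+-cong (c-0 (p∣k+[p∸k] k≤p)) (reflexive (cong (λ m → c (k ℕ.+ m)) (ℕ.m∸[m∸n]≡n k≤p)))))))
        (*-congˡ (*-cong (a-even k≤p) (*-cong (c-odd {k} (p∣k+[p∸k] k≤p)) (+-cong
          (c-0 (≡.subst (p ∣_) (ℕ.+-comm k _) (p∣k+[p∸k] k≤p))) c-2k)))))
        (solve 4 (λ w a c c₂ → w :* (a :* (c :* (con (+ 0) :+ c₂))) :+ w :* (a :* (:- c :* (con (+ 0) :+ :- c₂)))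
          := w :* (a :* (con (+ 2) :* (c :* c₂)))) refl w (a k) (c k) _))
      where
      c-2k : c ((p ∸ k) ℕ.+ (p ∸ k)) ≈ - c (k ℕ.+ k)
      c-2k = c-odd {k ℕ.+ k} (≡.subst (p ∣_) eq (∣m∣n⇒∣m+n (p∣k+[p∸k] k≤p) (p∣k+[p∸k] k≤p)))
        where
        eq : k ℕ.+ (p ∸ k) ℕ.+ (k ℕ.+ (p ∸ k)) ≡ k ℕ.+ k ℕ.+ ((p ∸ k) ℕ.+ (p ∸ k))
        eq = solve′ 2 (λ a b → (a :+′ b) :+′ (a :+′ b) :=′ (a :+′ a) :+′ (b :+′ b)) ≡.refl k (p ∸ k)
          where open import Data.Nat.Solver
                open +-*-Solver using () renaming (solve to solve′; _:+_ to _:+′_; _:=_ to _:=′_)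

    wya : ∀ k → y k * (w * a k) ≈ a k - w * y k
    wya k = begin
      y k * (w * (e k - 1#))     ≈⟨ solve 3 (λ y w e → y :* (w :* (e :- con (+ 1))) := con (+ 1) :+ y :* (w :* e) :- con (+ 1) :- w :* y) refl (y k) w (e k) ⟩
      1# + y k * (w * e k) - 1# - w * y k  ≈⟨ +-congʳ (+-congʳ (e-geometric k)) ⟨
      a k - w * y k              ∎

    -- Two relations make the diagonal linear in a_k: a_k^2 = θ a_k - a_k, and the doubling formula
    -- 2 c_k c_(2k) = c_k^2 + 1, which requires p not to divide 2k.
    diagonal-value : ∀ {k} → p ∤ k → diagonal k ≈
      ιℤ (+ 2) * (ιℤ (+ 4) + w) * θ (a k) - ιℤ (+ 4) * a k - ιℤ (+ 4) * (w * y k)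
    diagonal-value {k} p∤k = begin
      diagonal k
        ≈⟨ +-cong (*-congˡ aa) (*-congˡ (*-congˡ 2cc)) ⟩
      ιℤ (+ 2) * (ιℤ (+ 4) + w) * (θ (a k) - a k) + w * (a k * (ιℤ (+ 4) * y k + ιℤ (+ 2)))
        ≈⟨ solve 4 (λ w a y t → con (+ 2) :* (con (+ 4) :+ w) :* (t :- a) :+ w :* (a :* (con (+ 4) :* y :+ con (+ 2)))
            := con (+ 2) :* (con (+ 4) :+ w) :* t :- con (+ 8) :* a :+ con (+ 4) :* (y :* (w :* a))) refl w (a k) (y k) (θ (a k)) ⟩
      ιℤ (+ 2) * (ιℤ (+ 4) + w) * θ (a k) - ιℤ (+ 8) * a k + ιℤ (+ 4) * (y k * (w * a k))
        ≈⟨ +-congˡ (*-congˡ (wya k)) ⟩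
      ιℤ (+ 2) * (ιℤ (+ 4) + w) * θ (a k) - ιℤ (+ 8) * a k + ιℤ (+ 4) * (a k - w * y k)
        ≈⟨ solve 3 (λ s a b → s :- con (+ 8) :* a :+ con (+ 4) :* (a :- b) := s :- con (+ 4) :* a :- con (+ 4) :* b) refl _ (a k) (w * y k) ⟩
      ιℤ (+ 2) * (ιℤ (+ 4) + w) * θ (a k) - ιℤ (+ 4) * a k - ιℤ (+ 4) * (w * y k) ∎
      where
      aa : a k * a k ≈ θ (a k) - a k
      aa = begin
        (e k - 1#) * (e k - 1#)   ≈⟨ solve 1 (λ e → (e :- con (+ 1)) :* (e :- con (+ 1)) := e :* (e :- con (+ 1)) :+ con (+ 0) :- (e :- con (+ 1))) refl (e k) ⟩
        e k * (e k - 1#) + 0# - a k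
          ≈⟨ +-congʳ (+-cong (θ-geometric D (θ-y k) (e-geometric k)) (θ-ιℤ (+ 1))) ⟨
        θ (e k) + θ 1# - a k      ≈⟨ +-congʳ θ-a ⟨
        θ (a k) - a k ∎
        where
        θ-a : θ (a k) ≈ θ (e k) + θ 1#
        θ-a = trans (θ-+ (e k) (- 1#)) (+-congˡ (trans (θ-neg D 1#)
          (trans (-‿cong (θ-ιℤ (+ 1))) (trans (solve 0 (:- con (+ 0) := con (+ 0)) refl) (sym (θ-ιℤ (+ 1)))))))
      2cc : ιℤ (+ 2) * (c k * c (k ℕ.+ k)) ≈ ιℤ (+ 4) * y k + ιℤ (+ 2)
      2cc = begin
        ιℤ (+ 2) * (c k * c (k ℕ.+ k))     ≈⟨ solve 2 (λ a b → con (+ 2) :* (a :* b) := b :* (a :+ a)) refl (c k) _ ⟩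
        c (k ℕ.+ k) * (c k + c k)          ≈⟨ c-addition p∤k p∤k (p-odd p∤k) ⟩
        c k * c k + 1#                     ≈⟨ solve 1 (λ a → a :* a :+ con (+ 1) := (a :* a :- con (+ 1)) :+ con (+ 2)) refl (c k) ⟩
        c k * c k - 1# + ιℤ (+ 2)          ≈⟨ +-congʳ (4y k) ⟨
        ιℤ (+ 4) * y k + ιℤ (+ 2)          ∎

    -- First evaluation of a row: only l = k and l = p - k survive. They are distinct because p does
    -- not divide 2k.
    Σ-excess : ∀ i → i < r → Σ≢0 (excess (suc i)) ≈ ιℤ (+ 2) * diagonal (suc i)
    Σ-excess i i<r = begin
      Σ≢0 (excess k)
        -- Positions are shifted by one against indices: position i holds k = i + 1, and position r
        -- - (i + 1) holds p - k.
        ≈⟨ Σ<-pair r i (r ∸ suc i) (excess k ∘ suc) i<r (ℕ.∸-monoʳ-< (s≤s z≤n) i<r) i≢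
            (λ j j<r j≢i j≢ → excess≈0 {k} {suc j} (s≤s z≤n) (s≤s i<r) (s≤s z≤n) (s≤s j<r) (j≢i ∘ ℕ.suc-injective)
              (λ eq → j≢ (ℕ.suc-injective (≡.trans eq p∸k≡)))) ⟩
      excess k k + excess k (suc (r ∸ suc i))
        ≈⟨ +-cong (excess-diagonal k≤p) (trans (reflexive (cong (excess k) (≡.sym p∸k≡))) (excess-antidiagonal k≤p)) ⟩
      diagonal k + diagonal k
        ≈⟨ solve 1 (λ x → x :+ x := con (+ 2) :* x) refl _ ⟩
      ιℤ (+ 2) * diagonal k ∎
      where
      k = suc i
      k≤p : k ≤ p
      k≤p = ℕ.m≤n⇒m≤1+n i<r
      p∸k≡ : p ∸ k ≡ suc (r ∸ suc i)
      p∸k≡ = ℕ.+-∸-assoc 1 i<r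
      i≢ : i ≢ r ∸ suc i
      i≢ eq = p-odd {k} (>⇒∤ (s≤s i<r)) (≡.subst (p ∣_)
        (cong (k ℕ.+_) (≡.trans p∸k≡ (≡.sym (cong suc eq)))) (p∣k+[p∸k] k≤p))

    -- Both c_(k+l) and c_(k-l), summed over l, give -c_k.
    Σ-cross : ∀ k → Σ≢0 (cross k) ≈ - (ιℤ (+ 2) * (w * (a k * (c k * c k))))
    Σ-cross k = begin
      Σ≢0 (cross k)
        ≈⟨ *-distribˡ-sum {r} w _ ⟨
      w * Σ≢0 (λ l → a k * (c k * (c (k ℕ.+ l) + c (k ℕ.+ (p ∸ l)))))
        ≈⟨ *-congˡ (*-distribˡ-sum {r} (a k) _) ⟨
      w * (a k * Σ≢0 (λ l → c k * (c (k ℕ.+ l) + c (k ℕ.+ (p ∸ l)))))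
        ≈⟨ *-congˡ (*-congˡ (*-distribˡ-sum {r} (c k) _)) ⟨
      w * (a k * (c k * Σ≢0 (λ l → c (k ℕ.+ l) + c (k ℕ.+ (p ∸ l)))))
        ≈⟨ *-congˡ (*-congˡ (*-congˡ (trans (∑-distrib-+ {r} _ _) (+-cong (Σ≢0-c+ k) (Σ≢0-c- k))))) ⟩
      w * (a k * (c k * (- c k + - c k)))
        ≈⟨ solve 3 (λ w a c → w :* (a :* (c :* (:- c :+ :- c))) := :- (con (+ 2) :* (w :* (a :* (c :* c))))) refl w (a k) (c k) ⟩
      - (ιℤ (+ 2) * (w * (a k * (c k * c k)))) ∎

    -- Second evaluation, by expansion: the products of a_k and a_l give P^2, and the two families
    -- of cross terms agree after exchanging k and l.
    ΣΣ-excess : Σ≢0 (λ k → Σ≢0 (excess k)) ≈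
      ιℤ (+ 2) * (ιℤ (+ 4) + w) * (P * P) + ιℤ (+ 2) * Σ≢0 (λ k → - (ιℤ (+ 2) * (w * (a k * (c k * c k)))))
    ΣΣ-excess = begin
      Σ≢0 (λ k → Σ≢0 (excess k))
        ≈⟨ Σ≢0-cong (λ k _ → row k) ⟩
      Σ≢0 (λ k → α * (a k * P) + (Σ≢0 (cross k) + Σ≢0 (λ l → cross l k)))
        ≈⟨ trans (∑-distrib-+ {r} _ _) (+-cong
             (trans (sym (*-distribˡ-sum {r} α _)) (*-congˡ (sym (*-distribʳ-sum {r} P _))))
             (trans (∑-distrib-+ {r} _ _) (+-congˡ (∑-comm {r} {r} _)))) ⟩
      α * (P * P) + (Σ≢0 (λ k → Σ≢0 (cross k)) + Σ≢0 (λ l → Σ≢0 (cross l)))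
        ≈⟨ +-congˡ (solve 1 (λ x → x :+ x := con (+ 2) :* x) refl _) ⟩
      α * (P * P) + ιℤ (+ 2) * Σ≢0 (λ k → Σ≢0 (cross k))
        ≈⟨ +-congˡ (*-congˡ (Σ≢0-cong (λ k _ → Σ-cross k))) ⟩
      α * (P * P) + ιℤ (+ 2) * Σ≢0 (λ k → - (ιℤ (+ 2) * (w * (a k * (c k * c k))))) ∎
      where
      α = ιℤ (+ 2) * (ιℤ (+ 4) + w)
      row : ∀ k → Σ≢0 (excess k) ≈ α * (a k * P) + (Σ≢0 (cross k) + Σ≢0 (λ l → cross l k))
      row k = begin
        Σ≢0 (excess k)
          ≈⟨ ∑-distrib-+ {r} (λ i → α * (a k * a (suc (toℕ i)))) _ ⟩
        Σ≢0 (λ l → α * (a k * a l)) + Σ≢0 (λ l → cross k l + cross l k)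
          ≈⟨ +-cong (sym (*-distribˡ-sum {r} α _)) (∑-distrib-+ {r} (λ i → cross k (suc (toℕ i))) _) ⟩
        α * Σ≢0 (λ l → a k * a l) + (Σ≢0 (cross k) + Σ≢0 (λ l → cross l k))
          ≈⟨ +-congʳ (*-congˡ (*-distribˡ-sum {r} (a k) _)) ⟨
        α * (a k * P) + (Σ≢0 (cross k) + Σ≢0 (λ l → cross l k)) ∎

    -- Compares the two evaluations of the double sum of `excess`; c_k^2 = 4 y_k + 1 and w y_k a_k =
    -- a_k - w y_k reduce everything else to single sums.
    riccati : (ιℤ (+ 4) + w) * (P * P) ≈
      ιℤ (+ 2) * ((ιℤ (+ 4) + w) * θ P) + (ιℤ (+ 4) + ιℤ (+ 2) * w) * P - ιℤ (+ 12) * (w * p₁)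
    riccati = ιℤ-cancelˡ 1 (begin
      ιℤ (+ 2) * ((ιℤ (+ 4) + w) * (P * P))
        ≈⟨ solve 3 (λ w P s → con (+ 2) :* ((con (+ 4) :+ w) :* (P :* P))
             := con (+ 2) :* (con (+ 4) :+ w) :* (P :* P) :+ con (+ 2) :* s :+ :- con (+ 2) :* s) refl w P s ⟩
      ιℤ (+ 2) * (ιℤ (+ 4) + w) * (P * P) + ιℤ (+ 2) * s + - ιℤ (+ 2) * s
        ≈⟨ +-congʳ (trans (sym ΣΣ-excess) (Σ<-cong r Σ-excess)) ⟩
      Σ≢0 (λ k → ιℤ (+ 2) * diagonal k) + - ιℤ (+ 2) * s
        ≈⟨ +-congˡ (*-distribˡ-sum {r} (- ιℤ (+ 2)) _) ⟩
      Σ≢0 (λ k → ιℤ (+ 2) * diagonal k) + Σ≢0 (λ k → - ιℤ (+ 2) * - (ιℤ (+ 2) * (w * (a k * (c k * c k)))))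
        ≈⟨ ∑-distrib-+ {r} _ _ ⟨
      Σ≢0 (λ k → ιℤ (+ 2) * diagonal k + - ιℤ (+ 2) * - (ιℤ (+ 2) * (w * (a k * (c k * c k)))))
        ≈⟨ Σ≢0-cong termwise ⟩
      Σ≢0 (λ k → ιℤ (+ 4) * (ιℤ (+ 4) + w) * θ (a k) + (ιℤ (+ 8) + ιℤ (+ 4) * w) * a k + - ιℤ (+ 24) * w * y k)
        ≈⟨ trans (∑-distrib-+ {r} _ _) (+-cong (trans (∑-distrib-+ {r} _ _) (+-cong
             (sym (*-distribˡ-sum {r} _ _)) (sym (*-distribˡ-sum {r} _ _)))) (sym (*-distribˡ-sum {r} _ _))) ⟩
      ιℤ (+ 4) * (ιℤ (+ 4) + w) * Σ≢0 (θ ∘ a) + (ιℤ (+ 8) + ιℤ (+ 4) * w) * P + - ιℤ (+ 24) * w * p₁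
        ≈⟨ +-congʳ (+-congʳ (*-congˡ (θ-Σ< D r (a ∘ suc)))) ⟨
      ιℤ (+ 4) * (ιℤ (+ 4) + w) * θ P + (ιℤ (+ 8) + ιℤ (+ 4) * w) * P + - ιℤ (+ 24) * w * p₁
        ≈⟨ solve 4 (λ w T P p₁ → con (+ 4) :* (con (+ 4) :+ w) :* T :+ (con (+ 8) :+ con (+ 4) :* w) :* P :+ :- con (+ 24) :* w :* p₁
             := con (+ 2) :* (con (+ 2) :* ((con (+ 4) :+ w) :* T) :+ (con (+ 4) :+ con (+ 2) :* w) :* P :- con (+ 12) :* (w :* p₁)))
             refl w (θ P) P p₁ ⟩
      ιℤ (+ 2) * (ιℤ (+ 2) * ((ιℤ (+ 4) + w) * θ P) + (ιℤ (+ 4) + ιℤ (+ 2) * w) * P - ιℤ (+ 12) * (w * p₁)) ∎)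
      where
      s = Σ≢0 (λ k → - (ιℤ (+ 2) * (w * (a k * (c k * c k)))))
      termwise : ∀ k → p ∤ k → ιℤ (+ 2) * diagonal k + - ιℤ (+ 2) * - (ιℤ (+ 2) * (w * (a k * (c k * c k)))) ≈
        ιℤ (+ 4) * (ιℤ (+ 4) + w) * θ (a k) + (ιℤ (+ 8) + ιℤ (+ 4) * w) * a k + - ιℤ (+ 24) * w * y k
      termwise k p∤k = begin
        ιℤ (+ 2) * diagonal k + - ιℤ (+ 2) * - (ιℤ (+ 2) * (w * (a k * (c k * c k))))
          ≈⟨ +-cong (*-congˡ (diagonal-value p∤k)) (*-congˡ (-‿cong (*-congˡ (*-congˡ (*-congˡ
               (trans (solve 1 (λ x → x := x :- con (+ 1) :+ con (+ 1)) refl _) (+-congʳ (sym (4y k))))))))) ⟩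
        ιℤ (+ 2) * (ιℤ (+ 2) * (ιℤ (+ 4) + w) * θ (a k) - ιℤ (+ 4) * a k - ιℤ (+ 4) * (w * y k))
          + - ιℤ (+ 2) * - (ιℤ (+ 2) * (w * (a k * (ιℤ (+ 4) * y k + 1#))))
          ≈⟨ solve 4 (λ w t a y → con (+ 2) :* (con (+ 2) :* (con (+ 4) :+ w) :* t :- con (+ 4) :* a :- con (+ 4) :* (w :* y))
               :+ :- con (+ 2) :* :- (con (+ 2) :* (w :* (a :* (con (+ 4) :* y :+ con (+ 1)))))
               := con (+ 4) :* (con (+ 4) :+ w) :* t :- con (+ 8) :* a :- con (+ 8) :* (w :* y) :+ con (+ 4) :* (w :* a) :+ con (+ 16) :* (y :* (w :* a)))
               refl w (θ (a k)) (a k) (y k) ⟩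
        ιℤ (+ 4) * (ιℤ (+ 4) + w) * θ (a k) - ιℤ (+ 8) * a k - ιℤ (+ 8) * (w * y k) + ιℤ (+ 4) * (w * a k) + ιℤ (+ 16) * (y k * (w * a k))
          ≈⟨ +-congˡ (*-congˡ (wya k)) ⟩
        ιℤ (+ 4) * (ιℤ (+ 4) + w) * θ (a k) - ιℤ (+ 8) * a k - ιℤ (+ 8) * (w * y k) + ιℤ (+ 4) * (w * a k) + ιℤ (+ 16) * (a k - w * y k)
          ≈⟨ solve 4 (λ w t a y → con (+ 4) :* (con (+ 4) :+ w) :* t :- con (+ 8) :* a :- con (+ 8) :* (w :* y) :+ con (+ 4) :* (w :* a) :+ con (+ 16) :* (a :- w :* y)
               := con (+ 4) :* (con (+ 4) :+ w) :* t :+ (con (+ 8) :+ con (+ 4) :* w) :* a :+ :- con (+ 24) :* w :* y) refl w (θ (a k)) (a k) (y k) ⟩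
        ιℤ (+ 4) * (ιℤ (+ 4) + w) * θ (a k) + (ιℤ (+ 8) + ιℤ (+ 4) * w) * a k + - ιℤ (+ 24) * w * y k ∎

    -- Twice the generating function of the h_t.
    U : Carrier
    U = ιℤ (+ 2) - ιℤ (+ 2) * P + (ιℤ (+ 4) + w) * θ P

    θ-[4+w]* : ∀ x → θ ((ιℤ (+ 4) + w) * x) ≈ w * x + (ιℤ (+ 4) + w) * θ x
    θ-[4+w]* x = trans (θ-* _ x) (+-congʳ (*-congʳ (trans (θ-+ _ w) (trans (+-cong (θ-ιℤ (+ 4)) θ-w) (+-identityˡ w)))))

    -- `riccati` enters twice, once as it stands with a minus sign and once under θ. The terms 12 w
    -- p₁ cancel, and θ(P^2) = 2 P θP produces the product P θP occurring in P U.
    θ-U : θ U ≈ P * U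
    θ-U = ιℤ-cancelˡ 1 (begin
      ιℤ (+ 2) * θ U
        ≈⟨ *-congˡ (trans (θ-+ _ _) (+-cong
             (trans (θ-+ _ _) (+-cong (θ-ιℤ (+ 2)) (trans (θ-neg D _) (-‿cong (θ-scale D (θ-ιℤ (+ 2)) P)))))
             (θ-[4+w]* (θ P)))) ⟩
      ιℤ (+ 2) * (0# - ιℤ (+ 2) * T + (w * T + (ιℤ (+ 4) + w) * θ T))
        ≈⟨ solve 5 (λ w P T T′ p₁ → con (+ 2) :* (con (+ 0) :- con (+ 2) :* T :+ (w :* T :+ (con (+ 4) :+ w) :* T′))
             := (con (+ 4) :+ con (+ 2) :* w) :* P :- (con (+ 2) :* ((con (+ 4) :+ w) :* T) :+ (con (+ 4) :+ con (+ 2) :* w) :* P :- con (+ 12) :* (w :* p₁))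
                :- con (+ 12) :* (w :* p₁) :+ (con (+ 4) :+ con (+ 4) :* w) :* T :+ con (+ 2) :* ((con (+ 4) :+ w) :* T′)) refl w P T (θ T) p₁ ⟩
      (ιℤ (+ 4) + ιℤ (+ 2) * w) * P - (ιℤ (+ 2) * ((ιℤ (+ 4) + w) * T) + (ιℤ (+ 4) + ιℤ (+ 2) * w) * P - ιℤ (+ 12) * (w * p₁))
        - ιℤ (+ 12) * (w * p₁) + (ιℤ (+ 4) + ιℤ (+ 4) * w) * T + ιℤ (+ 2) * ((ιℤ (+ 4) + w) * θ T)
        ≈⟨ +-congʳ (+-congʳ (+-congʳ (+-congˡ (-‿cong (sym riccati))))) ⟩
      (ιℤ (+ 4) + ιℤ (+ 2) * w) * P - (ιℤ (+ 4) + w) * (P * P)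
        - ιℤ (+ 12) * (w * p₁) + (ιℤ (+ 4) + ιℤ (+ 4) * w) * T + ιℤ (+ 2) * ((ιℤ (+ 4) + w) * θ T)
        ≈⟨ solve 5 (λ w P T T′ p₁ → (con (+ 4) :+ con (+ 2) :* w) :* P :- (con (+ 4) :+ w) :* (P :* P)
             :- con (+ 12) :* (w :* p₁) :+ (con (+ 4) :+ con (+ 4) :* w) :* T :+ con (+ 2) :* ((con (+ 4) :+ w) :* T′)
             := con (+ 4) :* P :- con (+ 4) :* (P :* P) :- w :* (P :* P)
               :+ (con (+ 2) :* (w :* T :+ (con (+ 4) :+ w) :* T′) :+ (con (+ 2) :* w :* P :+ (con (+ 4) :+ con (+ 2) :* w) :* T) :- con (+ 12) :* (w :* p₁)))
             refl w P T (θ T) p₁ ⟩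
      ιℤ (+ 4) * P - ιℤ (+ 4) * (P * P) - w * (P * P)
        + (ιℤ (+ 2) * (w * T + (ιℤ (+ 4) + w) * θ T) + (ιℤ (+ 2) * w * P + (ιℤ (+ 4) + ιℤ (+ 2) * w) * T) - ιℤ (+ 12) * (w * p₁))
        ≈⟨ +-congˡ (trans (sym θ-rhs) (trans (θ-cong (sym riccati)) (trans (θ-[4+w]* (P * P)) (+-congˡ (*-congˡ (θ-* P P)))))) ⟩
      ιℤ (+ 4) * P - ιℤ (+ 4) * (P * P) - w * (P * P) + (w * (P * P) + (ιℤ (+ 4) + w) * (T * P + P * T))
        ≈⟨ solve 3 (λ w P T → con (+ 4) :* P :- con (+ 4) :* (P :* P) :- w :* (P :* P) :+ (w :* (P :* P) :+ (con (+ 4) :+ w) :* (T :* P :+ P :* T))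
             := con (+ 2) :* (P :* (con (+ 2) :- con (+ 2) :* P :+ (con (+ 4) :+ w) :* T))) refl w P T ⟩
      ιℤ (+ 2) * (P * U) ∎)
      where
      T = θ P
      θ-p₁ : θ p₁ ≈ 0#
      θ-p₁ = trans (θ-Σ< D r (y ∘ suc)) (Σ<-zero r _ (λ i _ → θ-y (suc i)))
      θ-rhs : θ (ιℤ (+ 2) * ((ιℤ (+ 4) + w) * T) + (ιℤ (+ 4) + ιℤ (+ 2) * w) * P - ιℤ (+ 12) * (w * p₁)) ≈
        ιℤ (+ 2) * (w * T + (ιℤ (+ 4) + w) * θ T) + (ιℤ (+ 2) * w * P + (ιℤ (+ 4) + ιℤ (+ 2) * w) * T) - ιℤ (+ 12) * (w * p₁)
      θ-rhs = trans (θ-+ _ _) (+-cong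
        (trans (θ-+ _ _) (+-cong
          (trans (θ-scale D (θ-ιℤ (+ 2)) _) (*-congˡ (θ-[4+w]* T)))
          (trans (θ-* _ P) (+-congʳ (*-congʳ (trans (θ-+ _ _) (trans
            (+-cong (θ-ιℤ (+ 4)) (trans (θ-scale D (θ-ιℤ (+ 2)) w) (*-congˡ θ-w))) (+-identityˡ _))))))))
        (trans (θ-neg D _) (-‿cong (trans (θ-scale D (θ-ιℤ (+ 12)) _) (*-congˡ
          (trans (θ-* w p₁) (trans (+-cong (*-congʳ θ-w) (trans (*-congˡ θ-p₁) (zeroʳ w))) (+-identityʳ _))))))))

-- Complete homogeneous symmetric polynomials

module Homogeneous (R : ℚ-Algebra) where
  open ℚ-Algebra R

  -- The complete homogeneous symmetric polynomial of degree t in x 0, …, x (n - 1).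
  h : (ℕ → Carrier) → ℕ → ℕ → Carrier
  h x n       zero    = 1#
  h x zero    (suc t) = 0#
  h x (suc n) (suc t) = h x n (suc t) + x n * h x (suc n) t

  h-cong : ∀ {x x′} n → (∀ i → i < n → x i ≈ x′ i) → ∀ t → h x n t ≈ h x′ n t
  h-cong n       x≈ zero    = refl
  h-cong zero    x≈ (suc t) = refl
  h-cong (suc n) x≈ (suc t) = +-cong (h-cong n (λ i i<n → x≈ i (ℕ.m<n⇒m<1+n i<n)) (suc t))
    (*-cong (x≈ n (ℕ.n<1+n n)) (h-cong (suc n) x≈ t))

  h-scale : ∀ a x n t → h (λ i → a * x i) n t ≈ a ^ t * h x n t
  h-scale a x n       zero    = sym (*-identityˡ _)
  h-scale a x zero    (suc t) = sym (zeroʳ _)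
  h-scale a x (suc n) (suc t) = begin
    h (λ i → a * x i) n (suc t) + a * x n * h (λ i → a * x i) (suc n) t
      ≈⟨ +-cong (h-scale a x n (suc t)) (*-congˡ (h-scale a x (suc n) t)) ⟩
    a * a ^ t * h x n (suc t) + a * x n * (a ^ t * h x (suc n) t)
      ≈⟨ solve 5 (λ a b x h h′ → a :* b :* h :+ a :* x :* (b :* h′) := a :* b :* (h :+ x :* h′)) refl _ _ _ _ _ ⟩
    a * a ^ t * (h x n (suc t) + x n * h x (suc n) t) ∎
    where
    open import Relation.Binary.Reasoning.Setoid setoid
    open Solver using (solve; _:=_; _:+_; _:*_)

-- Passage to power series

module SeriesDerivation (R : ℚ-Algebra) where
  open ℚ-Algebra R
  open PowerSeries R public

  θ-derivation : Derivation powerSeriesAlgebra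
  θ-derivation = record
    { θ = θ ; θ-cong = θ-cong ; θ-+ = θ-⊕ ; θ-* = θ-⋆ ; θ-ι = λ q → θ-constant (ι q) ; w = w ; θ-w = θ-w }

module SeriesLift (R : ℚ-Algebra) (r : ℕ) (ρ : RootOfUnity R r) where
  open ℚ-Algebra R
  open RootOfUnity ρ
  open SeriesDerivation R public
  open Cotangent R r ρ using (p; y)
  open RangeSum semiring

  module Ser where
    open ℚ-Algebra powerSeriesAlgebra public
    open RangeSum (ℚ-Algebra.semiring powerSeriesAlgebra) public

  constant-^ : ∀ x k → constant x Ser.^ k ≋ constant (x ^ k)
  constant-^ x zero    n = refl
  constant-^ x (suc k) n = trans (⋆-cong {constant x} (λ _ → refl) (constant-^ x k) n) (sym (constant-* x (x ^ k) n))

  2dˢ≈1 : ∀ {k} → p ∣ k → Ser.ιℤ (+ 2) ⋆ constant (d k) ≋ constant 1#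
  2dˢ≈1 {k} p∣k zero    = 2d≈1 p∣k
  2dˢ≈1 {k} p∣k (suc n) = trans (ιℤ-⋆ (+ 2) (constant (d k)) (suc n)) (zeroʳ _)

  1-constant : ∀ x → constant 1# Ser.- constant x ≋ constant (1# - x)
  1-constant x zero    = refl
  1-constant x (suc n) = -‿inverseʳ 0#

  dˢ-inverse : ∀ {k} → p ∤ k → (constant 1# Ser.- constant ζ Ser.^ k) ⋆ constant (d k) ≋ constant 1#
  dˢ-inverse {k} p∤k = Ser.trans (Ser.*-congʳ {constant (d k)} (Ser.trans (Ser.+-congˡ (Ser.-‿cong (constant-^ ζ k))) (1-constant (ζ ^ k))))
    (Ser.trans (Ser.sym (constant-* (1# - ζ ^ k) (d k))) (constant-cong (d-inverse p∤k)))

  -- The Riccati argument, run over power series, forms d^2 - d there; this identifies its y with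
  -- the constant series of y.
  yˢ : ∀ k → constant (d k) ⋆ constant (d k) Ser.- constant (d k) ≋ constant (y k)
  yˢ k zero    = refl
  yˢ k (suc n) = trans (+-congʳ (sym (constant-* (d k) (d k) (suc n)))) (-‿inverseʳ 0#)

  ρˢ : RootOfUnity powerSeriesAlgebra r
  ρˢ = record
    { ζ         = constant ζ
    ; ζ^p≈1     = Ser.trans (constant-^ ζ p) (constant-cong ζ^p≈1)
    ; d         = constant ∘ d
    ; 2d≈1      = 2dˢ≈1
    ; d-inverse = λ {k} → dˢ-inverse {k}
    }

  Σˢ : ∀ n f t → Ser.Σ< n f t ≈ Σ< n (λ i → f i t)
  Σˢ zero    f t = refl
  Σˢ (suc n) f t = +-congˡ (Σˢ n (f ∘ suc) t)

-- Evaluation of h_t by power sums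

module RootSums (R : ℚ-Algebra) (r : ℕ) (ρ : RootOfUnity R r) where
  open ℚ-Algebra R
  open RootOfUnity ρ
  open Solver using (solve; _:=_; _:+_; _:*_; _:-_; :-_; con)
  open RangeSum semiring
  open import Relation.Binary.Reasoning.Setoid setoid
  open Cotangent R r ρ
  open Homogeneous R

  powerSum : ℕ → Carrier
  powerSum t = Σ≢0 (λ k → y k ^ t)

  module _ (p-odd : ∀ {k} → p ∤ k → p ∤ k ℕ.+ k) where
    open SeriesLift R r ρ

    e : ℕ → Series
    e k = geometric (y k)

    e-geometric : ∀ k → IsGeometric θ-derivation (constant (d k) ⋆ constant (d k) Ser.- constant (d k)) (e k)
    e-geometric k = Ser.trans (geometric-unfold (y k)) (Ser.+-congˡ {constant 1#} (Ser.*-congʳ {w ⋆ e k} (Ser.sym (yˢ k))))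

    θ-yˢ : ∀ k → θ (constant (d k) ⋆ constant (d k) Ser.- constant (d k)) ≋ λ _ → 0#
    θ-yˢ k = Ser.trans (θ-cong (yˢ k)) (θ-constant (y k))

    open Riccati powerSeriesAlgebra r ρˢ θ-derivation using (module Solution)
    open Solution p-odd θ-yˢ e e-geometric using (P; U; θ-U)

    -- With the degree as last argument, `h (y ∘ suc) n` is already a series, namely the generating
    -- function of the complete homogeneous polynomials in y_1, ..., y_n.
    H : ℕ → Series
    H = h (y ∘ suc)

    θ-H : θ (H r) ≋ P ⋆ H r
    θ-H = θ-product θ-derivation _ (e ∘ suc) H (θ-yˢ ∘ suc) (e-geometric ∘ suc) H₀ H₊ r
      where
      H₀ : H 0 ≋ constant 1#
      H₀ zero    = refl
      H₀ (suc n) = refl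
      H₊ : ∀ n → H (suc n) ≋ H n ⊕ ((constant (d (suc n)) ⋆ constant (d (suc n)) Ser.- constant (d (suc n))) ⋆ (w ⋆ H (suc n)))
      H₊ n = Ser.trans lemma (Ser.+-congˡ {H n} (Ser.*-congʳ {w ⋆ H (suc n)} (Ser.sym (yˢ (suc n)))))
        where
        lemma : H (suc n) ≋ H n ⊕ (constant (y (suc n)) ⋆ (w ⋆ H (suc n)))
        lemma zero    = sym (trans (+-cong (refl {1#}) (trans (*-congˡ (w⋆-zero (H (suc n)))) (zeroʳ _))) (+-identityʳ 1#))
        lemma (suc t) = +-congˡ (sym (trans (constant-⋆ _ (w ⋆ H (suc n)) (suc t)) (*-congˡ (w⋆-suc (H (suc n)) t))))

    P-zero : P 0 ≈ 0#
    P-zero = trans (Σˢ r (λ i → e (suc i) Ser.- constant 1#) 0) (Σ<-zero r (λ i → (e (suc i) Ser.- constant 1#) 0) (λ i _ → -‿inverseʳ 1#))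

    P-suc : ∀ t → P (suc t) ≈ powerSum (suc t)
    P-suc t = trans (Σˢ r (λ i → e (suc i) Ser.- constant 1#) (suc t)) (Σ<-cong r {λ i → (e (suc i) Ser.- constant 1#) (suc t)} {λ i → y (suc i) ^ suc t} (λ i _ → trans (+-congˡ -0#≈0#) (+-identityʳ _)))
      where open import Algebra.Properties.Ring ring using (-0#≈0#)

    V : Series
    V = U Ser.- Ser.ιℤ (+ 2) ⋆ H r

    -- U and 2H satisfy the same first-order equation and both have constant term 2, so their
    -- difference is zero by uniqueness.
    V≈0 : ∀ t → V t ≈ 0#
    V≈0 = θ-ode-unique P V P-zero θ-V V-zero
      where
      θ-V : θ V ≋ P ⋆ V
      θ-V = Ser.trans (θ-⊕ U _) (Ser.trans
        (Ser.+-cong θ-U (Ser.trans (θ-neg θ-derivation _) (Ser.-‿cong (Ser.trans (θ-scale θ-derivation (Derivation.θ-ιℤ θ-derivation (+ 2)) (H r)) (Ser.*-congˡ {Ser.ιℤ (+ 2)} θ-H)))))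
        (Ser.Solver.solve 3 (λ P U H → P Ser.Solver.:* U Ser.Solver.:+ Ser.Solver.:- (Ser.Solver.con (+ 2) Ser.Solver.:* (P Ser.Solver.:* H))
           Ser.Solver.:= P Ser.Solver.:* (U Ser.Solver.:- Ser.Solver.con (+ 2) Ser.Solver.:* H)) Ser.refl P U (H r)))
      V-zero : V 0 ≈ 0#
      V-zero = trans (+-congʳ (+-cong (+-congˡ (-‿cong (*-congˡ P-zero))) (*-congˡ (zeroˡ _))))
        (solve 1 (λ a → con (+ 2) :- con (+ 2) :* con (+ 0) :+ a :* con (+ 0) :- con (+ 2) :* con (+ 1) := con (+ 0)) refl _)

    -- The coefficient of w^(s+1) in U; the last summand stems from the w in 4 + w.
    2h : ∀ s → ιℤ (+ 2) * h (y ∘ suc) r (suc s) ≈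
      (ιℤ (+ 4) * ιℤ (+ suc s) - ιℤ (+ 2)) * powerSum (suc s) + ιℤ (+ s) * powerSum s
    2h s = begin
      ιℤ (+ 2) * H r t
        ≈⟨ ιℤ-⋆ (+ 2) (H r) t ⟨
      (Ser.ιℤ (+ 2) ⋆ H r) t
        ≈⟨ solve 2 (λ a b → b := a :- (a :- b)) refl (U t) _ ⟩
      U t - V t
        ≈⟨ trans (+-congˡ (-‿cong (V≈0 t))) (solve 1 (λ a → a :- con (+ 0) := a) refl (U t)) ⟩
      (0# - (Ser.ιℤ (+ 2) ⋆ P) t) + ((Ser.ιℤ (+ 4) ⊕ w) ⋆ θ P) t
        ≈⟨ +-cong (+-congˡ (-‿cong (ιℤ-⋆ (+ 2) P t))) (trans (⋆-distribʳ (θ P) (Ser.ιℤ (+ 4)) w t)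
             (+-cong (ιℤ-⋆ (+ 4) (θ P) t) (w⋆-suc (θ P) s))) ⟩
      (0# - ιℤ (+ 2) * P t) + (ιℤ (+ 4) * (ιℤ (+ t) * P t) + ιℤ (+ s) * P s)
        ≈⟨ +-cong (+-congˡ (-‿cong (*-congˡ (P-suc s)))) (+-cong (*-congˡ (*-congˡ (P-suc s))) (lemma s)) ⟩
      (0# - ιℤ (+ 2) * powerSum t) + (ιℤ (+ 4) * (ιℤ (+ t) * powerSum t) + ιℤ (+ s) * powerSum s)
        ≈⟨ solve 4 (λ t p s q → (con (+ 0) :- con (+ 2) :* p) :+ (con (+ 4) :* (t :* p) :+ s :* q) := (con (+ 4) :* t :- con (+ 2)) :* p :+ s :* q) refl _ _ _ _ ⟩
      (ιℤ (+ 4) * ιℤ (+ suc s) - ιℤ (+ 2)) * powerSum (suc s) + ιℤ (+ s) * powerSum s ∎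
      where
      t = suc s
      -- At s = 0 the two sums differ, P 0 being zero and `powerSum 0` being p - 1, but the factor s
      -- removes both.
      lemma : ∀ s → ιℤ (+ s) * P s ≈ ιℤ (+ s) * powerSum s
      lemma zero    = trans (zeroˡ _) (sym (zeroˡ _))
      lemma (suc s) = *-congˡ (P-suc s)

  twisted : ℕ → Carrier
  twisted t = Σ≢0 (λ k → ζ ^ k * y k ^ t)

  closedForm : ℕ → Carrier
  closedForm t = ιℤ (+ t) * powerSum t + (ιℤ (+ t) - 1#) * twisted t

  ζd : ∀ {k} → p ∤ k → ζ ^ k * d k ≈ d k - 1#
  ζd {k} p∤k = begin
    ζ ^ k * d k                     ≈⟨ solve 2 (λ x d → x :* d := d :- (con (+ 1) :- x) :* d) refl _ _ ⟩
    d k - (1# - ζ ^ k) * d k        ≈⟨ +-congˡ (-‿cong (d-inverse p∤k)) ⟩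
    d k - 1#                        ∎

  -- y is even and c is odd under k ↦ p - k, so opposite terms cancel.
  Σ-yc≈0 : ∀ s → Σ≢0 (λ k → y k ^ s * c k) ≈ 0#
  Σ-yc≈0 s = ιℤ-cancelˡ 1 (begin
    ιℤ (+ 2) * Σ≢0 f                    ≈⟨ solve 1 (λ x → con (+ 2) :* x := x :+ x) refl _ ⟩
    Σ≢0 f + Σ≢0 f                       ≈⟨ +-congˡ (Σ≢0-reflect f) ⟩
    Σ≢0 f + Σ≢0 (λ k → f (p ∸ k))       ≈⟨ ∑-distrib-+ {r} (f ∘ suc ∘ toℕ) _ ⟨
    Σ≢0 (λ k → f k + f (p ∸ k))         ≈⟨ Σ<-zero r _ (λ i i<r → cancel (suc i) (ℕ.m≤n⇒m≤1+n i<r)) ⟩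
    0#                                  ≈⟨ zeroʳ _ ⟨
    ιℤ (+ 2) * 0#                       ∎)
    where
    f : ℕ → Carrier
    f k = y k ^ s * c k
    cancel : ∀ k → k ≤ p → f k + f (p ∸ k) ≈ 0#
    cancel k k≤p = trans (+-congˡ (*-cong (^-congˡ s (y-even {k} ∣k)) (c-odd {k} ∣k)))
      (solve 2 (λ a b → a :* b :+ a :* :- b := con (+ 0)) refl _ _)
      where
      ∣k : p ∣ k ℕ.+ (p ∸ k)
      ∣k = ≡.subst (p ∣_) (≡.sym (ℕ.m+[n∸m]≡n k≤p)) ∣-refl

  -- From ζ^k d_k = d_k - 1 follows ζ^k y_k = (d_k - 1)^2 = y_k + (1 + c_k) / 2, and the part with
  -- c_k sums to zero.
  2twisted : ∀ s → ιℤ (+ 2) * twisted (suc s) ≈ ιℤ (+ 2) * powerSum (suc s) + powerSum s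
  2twisted s = begin
    ιℤ (+ 2) * twisted (suc s)
      ≈⟨ *-distribˡ-sum {r} _ _ ⟩
    Σ≢0 (λ k → ιℤ (+ 2) * (ζ ^ k * y k ^ suc s))
      ≈⟨ Σ≢0-cong (λ k p∤k → termwise k p∤k) ⟩
    Σ≢0 (λ k → ιℤ (+ 2) * y k ^ suc s + y k ^ s + y k ^ s * c k)
      ≈⟨ trans (∑-distrib-+ {r} _ (λ i → y (suc (toℕ i)) ^ s * c (suc (toℕ i)))) (trans (+-congˡ (Σ-yc≈0 s)) (+-identityʳ _)) ⟩
    Σ≢0 (λ k → ιℤ (+ 2) * y k ^ suc s + y k ^ s)
      ≈⟨ trans (∑-distrib-+ {r} _ (λ i → y (suc (toℕ i)) ^ s)) (+-congʳ (sym (*-distribˡ-sum {r} _ _))) ⟩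
    ιℤ (+ 2) * powerSum (suc s) + powerSum s ∎
    where
    termwise : ∀ k → p ∤ k → ιℤ (+ 2) * (ζ ^ k * y k ^ suc s) ≈ ιℤ (+ 2) * y k ^ suc s + y k ^ s + y k ^ s * c k
    termwise k p∤k = begin
      ιℤ (+ 2) * (ζ ^ k * ((d k * d k - d k) * y k ^ s))
        ≈⟨ solve 3 (λ z d q → con (+ 2) :* (z :* ((d :* d :- d) :* q)) := con (+ 2) :* (z :* d) :* (d :- con (+ 1)) :* q) refl _ (d k) _ ⟩
      ιℤ (+ 2) * (ζ ^ k * d k) * (d k - 1#) * y k ^ s
        ≈⟨ *-congʳ (*-congʳ (*-congˡ (ζd p∤k))) ⟩
      ιℤ (+ 2) * (d k - 1#) * (d k - 1#) * y k ^ s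
        ≈⟨ solve 2 (λ d q → con (+ 2) :* (d :- con (+ 1)) :* (d :- con (+ 1)) :* q
             := con (+ 2) :* ((d :* d :- d) :* q) :+ q :+ q :* (con (+ 1) :- con (+ 2) :* d)) refl (d k) _ ⟩
      ιℤ (+ 2) * y k ^ suc s + y k ^ s + y k ^ s * c k ∎

  -- Exchanges the lower power sum in `2h` for `twisted`, by means of `2twisted`.
  h≈closedForm-suc : (∀ {k} → p ∤ k → p ∤ k ℕ.+ k) → ∀ s → h (y ∘ suc) r (suc s) ≈ closedForm (suc s)
  h≈closedForm-suc p-odd s = ιℤ-cancelˡ 1 (begin
    ιℤ (+ 2) * h (y ∘ suc) r (suc s)
      ≈⟨ 2h p-odd s ⟩
    (ιℤ (+ 4) * ιℤ (+ suc s) - ιℤ (+ 2)) * q + ιℤ (+ s) * q′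
      ≈⟨ +-congʳ (*-congʳ (+-congʳ (*-congˡ ιℤ-suc))) ⟩
    (ιℤ (+ 4) * (1# + ιℤ (+ s)) - ιℤ (+ 2)) * q + ιℤ (+ s) * q′
      ≈⟨ solve 3 (λ s q q′ → (con (+ 4) :* (con (+ 1) :+ s) :- con (+ 2)) :* q :+ s :* q′
           := con (+ 2) :* ((con (+ 1) :+ s) :* q) :+ (con (+ 1) :+ s :- con (+ 1)) :* (con (+ 2) :* q :+ q′)) refl (ιℤ (+ s)) q q′ ⟩
    ιℤ (+ 2) * ((1# + ιℤ (+ s)) * q) + (1# + ιℤ (+ s) - 1#) * (ιℤ (+ 2) * q + q′)
      ≈⟨ +-cong (*-congˡ (*-congʳ (sym ιℤ-suc))) (*-cong (+-congʳ (sym ιℤ-suc)) (sym (2twisted s))) ⟩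
    ιℤ (+ 2) * (ιℤ (+ suc s) * q) + (ιℤ (+ suc s) - 1#) * (ιℤ (+ 2) * twisted (suc s))
      ≈⟨ solve 3 (λ a b t → con (+ 2) :* a :+ b :* (con (+ 2) :* t) := con (+ 2) :* (a :+ b :* t)) refl _ _ _ ⟩
    ιℤ (+ 2) * closedForm (suc s) ∎)
    where
    q  = powerSum (suc s)
    q′ = powerSum s
    ιℤ-suc : ιℤ (+ suc s) ≈ 1# + ιℤ (+ s)
    ιℤ-suc = ιℤ-+ (+ 1) (+ s)

  geometricSum : ∀ n x → (1# - x) * Σ< n (λ i → x ^ i) ≈ 1# - x ^ n
  geometricSum zero    x = trans (zeroʳ _) (sym (-‿inverseʳ 1#))
  geometricSum (suc n) x = begin
    (1# - x) * Σ< (suc n) (λ i → x ^ i)          ≈⟨ *-congˡ (Σ<-snoc n (λ i → x ^ i)) ⟩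
    (1# - x) * (Σ< n (λ i → x ^ i) + x ^ n)      ≈⟨ distribˡ _ _ _ ⟩
    (1# - x) * Σ< n (λ i → x ^ i) + (1# - x) * x ^ n  ≈⟨ +-congʳ (geometricSum n x) ⟩
    1# - x ^ n + (1# - x) * x ^ n                ≈⟨ solve 2 (λ x q → con (+ 1) :- q :+ (con (+ 1) :- x) :* q := con (+ 1) :- x :* q) refl x _ ⟩
    1# - x ^ suc n                               ∎

  -- The geometric sum is annihilated by 1 - ζ^m, which is invertible for such m.
  Σζ^≈0 : ∀ {m} → p ∤ m → Σ< p (λ i → (ζ ^ m) ^ i) ≈ 0#
  Σζ^≈0 {m} p∤m = begin
    s                                    ≈⟨ *-identityˡ s ⟨
    1# * s                               ≈⟨ *-congʳ (d-inverse p∤m) ⟨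
    (1# - ζ ^ m) * d m * s               ≈⟨ solve 3 (λ a b s → a :* b :* s := b :* (a :* s)) refl _ _ _ ⟩
    d m * ((1# - ζ ^ m) * s)             ≈⟨ *-congˡ (geometricSum p (ζ ^ m)) ⟩
    d m * (1# - (ζ ^ m) ^ p)             ≈⟨ *-congˡ (+-congˡ (-‿cong (trans (^-assocʳ ζ m p) (ζ^≈1 (divides m ≡.refl))))) ⟩
    d m * (1# - 1#)                      ≈⟨ solve 1 (λ a → a :* (con (+ 1) :- con (+ 1)) := con (+ 0)) refl _ ⟩
    0#                                   ∎
    where s = Σ< p (λ i → (ζ ^ m) ^ i)

-- Binomial evaluation of the weighted sum

module Bernoulli (R : ℚ-Algebra) (r : ℕ) (ρ : RootOfUnity R r) (1<p : 1 < suc r) where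
  open ℚ-Algebra R
  open RootOfUnity ρ
  open Solver using (solve; _:=_; _:+_; _:*_; _:-_; :-_; con)
  open RangeSum semiring
  open import Relation.Binary.Reasoning.Setoid setoid
  open Cotangent R r ρ
  open RootSums R r ρ
  open import Algebra.Properties.CommutativeSemiring.Exp commutativeSemiring using (^-distrib-*)

  open import Algebra.Properties.Semiring.Mult semiring using () renaming (_×_ to _·_)

  p∤1 : p ∤ 1
  p∤1 = >⇒∤ 1<p

  -- At t = 0 the closed form is minus the sum of ζ^k over k ≠ 0, and all powers ζ^0, ..., ζ^(p-1)
  -- sum to zero.
  closedForm-zero : closedForm 0 ≈ 1#
  closedForm-zero = begin
    0# * powerSum 0 + (0# - 1#) * twisted 0
      ≈⟨ solve 2 (λ a b → con (+ 0) :* a :+ (con (+ 0) :- con (+ 1)) :* b := con (+ 1) :- (con (+ 1) :+ b)) refl _ _ ⟩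
    1# - (1# + twisted 0)
      ≈⟨ +-congˡ (-‿cong (+-congˡ (Σ≢0-cong (λ k _ → trans (*-identityʳ _) (^-congˡ k (sym (*-identityʳ ζ))))))) ⟩
    1# - Σ< p (λ i → (ζ ^ 1) ^ i)
      ≈⟨ +-congˡ (-‿cong (Σζ^≈0 p∤1)) ⟩
    1# - 0#
      ≈⟨ solve 0 (con (+ 1) :- con (+ 0) := con (+ 1)) refl ⟩
    1# ∎

  -- The residue class of K n.
  bernoulli : ℕ → Carrier
  bernoulli n = Σ≢0 (λ k → ζ ^ k * d k ^ n)

  ·≈ιℤ : ∀ n x → n · x ≈ ιℤ (+ n) * x
  ·≈ιℤ zero    x = sym (zeroˡ x)
  ·≈ιℤ (suc n) x = begin
    x + n · x                    ≈⟨ +-cong (sym (*-identityˡ x)) (·≈ιℤ n x) ⟩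
    1# * x + ιℤ (+ n) * x        ≈⟨ distribʳ _ _ _ ⟨
    (1# + ιℤ (+ n)) * x          ≈⟨ *-congʳ (ιℤ-+ (+ 1) (+ n)) ⟨
    ιℤ (+ suc n) * x             ∎

  binomial : ∀ n x → Σ< (suc n) (λ i → ιℤ (+ (n C i)) * ((- 1#) ^ i * x ^ (n ∸ i))) ≈ (x - 1#) ^ n
  binomial n x = begin
    Σ< (suc n) (λ i → ιℤ (+ (n C i)) * ((- 1#) ^ i * x ^ (n ∸ i)))
      ≈⟨ Σ<-cong (suc n) (λ i _ → sym (·≈ιℤ (n C i) ((- 1#) ^ i * x ^ (n ∸ i)))) ⟩
    Σ< (suc n) (λ i → (n C i) · ((- 1#) ^ i * x ^ (n ∸ i)))
      ≈⟨ theorem n (- 1#) x ⟨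
    (- 1# + x) ^ n
      ≈⟨ ^-congˡ n (+-comm _ _) ⟩
    (x - 1#) ^ n ∎
    where open import Algebra.Properties.CommutativeSemiring.Binomial commutativeSemiring using (theorem)

  y^ : ∀ k n → d k ^ n * (d k - 1#) ^ n ≈ y k ^ n
  y^ k n = trans (sym (^-distrib-* (d k) (d k - 1#) n))
    (^-congˡ n (solve 1 (λ d → d :* (d :- con (+ 1)) := d :* d :- d) refl (d k)))

  -- Taking out d_k^t leaves the binomial expansion of (d_k - 1)^t, and y_k = d_k (d_k - 1).
  expand-ζy^ : ∀ k t → Σ< (suc t) (λ i → ιℤ (+ (t C i)) * ((- 1#) ^ i * (ζ ^ k * d k ^ (2 ℕ.* t ∸ i)))) ≈ ζ ^ k * y k ^ t
  expand-ζy^ k t = begin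
    Σ< (suc t) (λ i → ιℤ (+ (t C i)) * ((- 1#) ^ i * (ζ ^ k * d k ^ (2 ℕ.* t ∸ i))))
      ≈⟨ Σ<-cong (suc t) (λ i i<1+t → termwise i (ℕ.≤-pred i<1+t)) ⟩
    Σ< (suc t) (λ i → ζ ^ k * d k ^ t * (ιℤ (+ (t C i)) * ((- 1#) ^ i * d k ^ (t ∸ i))))
      ≈⟨ *-Σ< (suc t) (ζ ^ k * d k ^ t) (λ i → ιℤ (+ (t C i)) * ((- 1#) ^ i * d k ^ (t ∸ i))) ⟨
    ζ ^ k * d k ^ t * Σ< (suc t) (λ i → ιℤ (+ (t C i)) * ((- 1#) ^ i * d k ^ (t ∸ i)))
      ≈⟨ *-congˡ (binomial t (d k)) ⟩
    ζ ^ k * d k ^ t * (d k - 1#) ^ t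
      ≈⟨ trans (*-assoc _ _ _) (*-congˡ (y^ k t)) ⟩
    ζ ^ k * y k ^ t ∎
    where
    termwise : ∀ i → i ≤ t → ιℤ (+ (t C i)) * ((- 1#) ^ i * (ζ ^ k * d k ^ (2 ℕ.* t ∸ i))) ≈
      ζ ^ k * d k ^ t * (ιℤ (+ (t C i)) * ((- 1#) ^ i * d k ^ (t ∸ i)))
    termwise i i≤t = trans
      (*-congˡ (*-congˡ (*-congˡ (trans
        (reflexive (cong (d k ^_) (≡.trans (cong (λ m → t ℕ.+ m ∸ i) (ℕ.+-identityʳ t)) (ℕ.+-∸-assoc t i≤t))))
        (^-homo-* (d k) t (t ∸ i))))))
      (solve 5 (λ b s z e f → b :* (s :* (z :* (e :* f))) := z :* e :* (b :* (s :* f))) refl _ _ _ _ _)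

  -- Row s of the binomials with exponents 2(s + 1) - i gives d_k^2 times the previous expansion,
  -- and ζ^k d_k^2 = (d_k - 1) d_k = y_k absorbs ζ^k. This is how untwisted powers come out of the
  -- same K_n.
  expand-y^ : ∀ k s → p ∤ k →
    Σ< (suc (suc s)) (λ i → ιℤ (+ (s C i)) * ((- 1#) ^ i * (ζ ^ k * d k ^ (2 ℕ.* suc s ∸ i)))) ≈ y k ^ suc s
  expand-y^ k s p∤k = begin
    Σ< (suc (suc s)) f
      -- The range matches that of row s + 1; the extra last term carries C(s, s + 1) = 0.
      ≈⟨ Σ<-snoc (suc s) f ⟩
    Σ< (suc s) f + f (suc s)
      ≈⟨ +-congˡ (trans (*-congʳ (reflexive (cong (λ m → ιℤ (+ m)) (k>n⇒nCk≡0 (ℕ.n<1+n s))))) (zeroˡ _)) ⟩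
    Σ< (suc s) f + 0#
      ≈⟨ +-identityʳ _ ⟩
    Σ< (suc s) f
      ≈⟨ Σ<-cong (suc s) (λ i i<1+s → termwise i (ℕ.≤-pred i<1+s)) ⟩
    Σ< (suc s) (λ i → d k * d k * (ιℤ (+ (s C i)) * ((- 1#) ^ i * (ζ ^ k * d k ^ (2 ℕ.* s ∸ i)))))
      ≈⟨ *-Σ< (suc s) (d k * d k) (λ i → ιℤ (+ (s C i)) * ((- 1#) ^ i * (ζ ^ k * d k ^ (2 ℕ.* s ∸ i)))) ⟨
    d k * d k * Σ< (suc s) (λ i → ιℤ (+ (s C i)) * ((- 1#) ^ i * (ζ ^ k * d k ^ (2 ℕ.* s ∸ i))))
      ≈⟨ *-congˡ (expand-ζy^ k s) ⟩
    d k * d k * (ζ ^ k * y k ^ s)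
      ≈⟨ solve 3 (λ d z q → d :* d :* (z :* q) := z :* d :* d :* q) refl (d k) _ _ ⟩
    ζ ^ k * d k * d k * y k ^ s
      ≈⟨ *-congʳ (*-congʳ (ζd p∤k)) ⟩
    (d k - 1#) * d k * y k ^ s
      ≈⟨ *-congʳ (solve 1 (λ d → (d :- con (+ 1)) :* d := d :* d :- d) refl (d k)) ⟩
    y k ^ suc s ∎
    where
    f : ℕ → Carrier
    f i = ιℤ (+ (s C i)) * ((- 1#) ^ i * (ζ ^ k * d k ^ (2 ℕ.* suc s ∸ i)))
    exponent : ∀ i → i ≤ s → 2 ℕ.* suc s ∸ i ≡ 2 ℕ.+ (2 ℕ.* s ∸ i)
    exponent i i≤s = ≡.trans (cong (_∸ i) (cong suc (ℕ.+-suc s (s ℕ.+ 0))))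
      (ℕ.+-∸-assoc 2 (ℕ.≤-trans i≤s (ℕ.m≤m+n s (s ℕ.+ 0))))
    termwise : ∀ i → i ≤ s → f i ≈ d k * d k * (ιℤ (+ (s C i)) * ((- 1#) ^ i * (ζ ^ k * d k ^ (2 ℕ.* s ∸ i))))
    termwise i i≤s = trans
      (*-congˡ (*-congˡ (*-congˡ (reflexive (cong (d k ^_) (exponent i i≤s))))))
      (solve 5 (λ b m z d e → b :* (m :* (z :* (d :* (d :* e)))) := d :* d :* (b :* (m :* (z :* e)))) refl _ _ _ (d k) _)

  weight′ : ℕ → ℕ → Carrier
  weight′ t i = ιℤ (+ t) * ιℤ (+ ((t ∸ 1) C i)) + (ιℤ (+ t) - 1#) * ιℤ (+ (t C i))

  weightedSum : ∀ t → Σ< (suc t) (λ i → weight′ t i * ((- 1#) ^ i * bernoulli (2 ℕ.* t ∸ i))) ≈ closedForm t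
  weightedSum t = begin
    Σ< (suc t) (λ i → weight′ t i * ((- 1#) ^ i * bernoulli (2 ℕ.* t ∸ i)))
      ≈⟨ Σ<-cong (suc t) (λ i _ → distribute i) ⟩
    Σ< (suc t) (λ i → Σ≢0 (λ k → α * g k i + β * f k i))
      ≈⟨ Σ<-comm (suc t) r (λ i j → α * g (suc j) i + β * f (suc j) i) ⟩
    Σ≢0 (λ k → Σ< (suc t) (λ i → α * g k i + β * f k i))
      ≈⟨ Σ≢0-cong (λ k p∤k → column k p∤k) ⟩
    Σ≢0 (λ k → α * y k ^ t + β * (ζ ^ k * y k ^ t))
      ≈⟨ Σ<-+ r (λ i → α * y (suc i) ^ t) (λ i → β * (ζ ^ suc i * y (suc i) ^ t)) ⟩
    Σ≢0 (λ k → α * y k ^ t) + Σ≢0 (λ k → β * (ζ ^ k * y k ^ t))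
      ≈⟨ +-cong (*-Σ< r α (λ i → y (suc i) ^ t)) (*-Σ< r β (λ i → ζ ^ suc i * y (suc i) ^ t)) ⟨
    closedForm t ∎
    where
    α = ιℤ (+ t)
    β = ιℤ (+ t) - 1#
    f g : ℕ → ℕ → Carrier
    f k i = ιℤ (+ (t C i)) * ((- 1#) ^ i * (ζ ^ k * d k ^ (2 ℕ.* t ∸ i)))
    g k i = ιℤ (+ ((t ∸ 1) C i)) * ((- 1#) ^ i * (ζ ^ k * d k ^ (2 ℕ.* t ∸ i)))

    distribute : ∀ i → weight′ t i * ((- 1#) ^ i * bernoulli (2 ℕ.* t ∸ i)) ≈ Σ≢0 (λ k → α * g k i + β * f k i)
    distribute i = begin
      weight′ t i * ((- 1#) ^ i * bernoulli (2 ℕ.* t ∸ i))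
        ≈⟨ *-assoc _ _ _ ⟨
      weight′ t i * (- 1#) ^ i * bernoulli (2 ℕ.* t ∸ i)
        ≈⟨ *-Σ< r _ (λ j → ζ ^ suc j * d (suc j) ^ (2 ℕ.* t ∸ i)) ⟩
      Σ≢0 (λ k → weight′ t i * (- 1#) ^ i * (ζ ^ k * d k ^ (2 ℕ.* t ∸ i)))
        ≈⟨ Σ≢0-cong (λ k _ → solve 6 (λ a b c e s z → (a :* b :+ c :* e) :* s :* z := a :* (b :* (s :* z)) :+ c :* (e :* (s :* z)))
             refl α (ιℤ (+ ((t ∸ 1) C i))) β (ιℤ (+ (t C i))) ((- 1#) ^ i) (ζ ^ k * d k ^ (2 ℕ.* t ∸ i))) ⟩
      Σ≢0 (λ k → α * g k i + β * f k i) ∎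

    g-sum : ∀ t k → p ∤ k → ιℤ (+ t) * Σ< (suc t) (λ i → ιℤ (+ ((t ∸ 1) C i)) * ((- 1#) ^ i * (ζ ^ k * d k ^ (2 ℕ.* t ∸ i)))) ≈ ιℤ (+ t) * y k ^ t
    -- Here t - 1 is truncated to 0, and the factor t = 0 makes the value of that binomial
    -- irrelevant.
    g-sum zero    k p∤k = trans (zeroˡ _) (sym (zeroˡ _))
    g-sum (suc s) k p∤k = *-congˡ (expand-y^ k s p∤k)

    column : ∀ k → p ∤ k → Σ< (suc t) (λ i → α * g k i + β * f k i) ≈ α * y k ^ t + β * (ζ ^ k * y k ^ t)
    column k p∤k = begin
      Σ< (suc t) (λ i → α * g k i + β * f k i)
        ≈⟨ Σ<-+ (suc t) (λ i → α * g k i) (λ i → β * f k i) ⟩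
      Σ< (suc t) (λ i → α * g k i) + Σ< (suc t) (λ i → β * f k i)
        ≈⟨ +-cong (*-Σ< (suc t) α (g k)) (*-Σ< (suc t) β (f k)) ⟨
      α * Σ< (suc t) (g k) + β * Σ< (suc t) (f k)
        ≈⟨ +-cong (g-sum t k p∤k) (*-congˡ (expand-ζy^ k t)) ⟩
      α * y k ^ t + β * (ζ ^ k * y k ^ t) ∎

-- The numbers K_n

module Kernel (R : ℚ-Algebra) (r : ℕ) (ρ : RootOfUnity R r) (1<p : 1 < suc r) where
  open ℚ-Algebra R
  open RootOfUnity ρ
  open Solver using (solve; _:=_; _:+_; _:*_; _:-_; :-_; con)
  open RangeSum semiring
  open import Relation.Binary.Reasoning.Setoid setoid
  open Cotangent R r ρ
  open RootSums R r ρ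

  1^ : ∀ n → 1# ^ n ≈ 1#
  1^ zero    = refl
  1^ (suc n) = trans (*-identityˡ _) (1^ n)

  ^-swap : ∀ x m n → (x ^ m) ^ n ≈ (x ^ n) ^ m
  ^-swap x m n = trans (^-assocʳ x m n) (trans (reflexive (cong (x ^_) (ℕ.*-comm m n))) (sym (^-assocʳ x n m)))

  Σ1 : ∀ n → Σ< n (λ _ → 1#) ≈ ιℤ (+ n)
  Σ1 zero    = refl
  Σ1 (suc n) = trans (+-congˡ (Σ1 n)) (sym (ιℤ-+ (+ 1) (+ n)))

  orbit : ℕ → Carrier
  orbit m = Σ< p (λ k → (ζ ^ m) ^ k)

  orbit-∣ : ∀ {m} → p ∣ m → orbit m ≈ ιℤ (+ p)
  orbit-∣ p∣m = trans (Σ<-cong p (λ k _ → trans (^-congˡ k (ζ^≈1 p∣m)) (1^ k))) (Σ1 p)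

  module _ (z : Carrier) (b : ℕ → Carrier) (zb : ∀ k → p ∤ k → z * b k ≈ ζ ^ k * b k + (1# - ζ ^ k)) where

    -- With x = ζ^k, the relation `zb` says (z - x) b_k = 1 - x; multiplying by (z^n - x^n) / (z -
    -- x) = Σ z^i x^(n-1-i) gives the claim without any division.
    z^*b : ∀ {k} → p ∤ k → ∀ n →
      z ^ n * b k ≈ (ζ ^ k) ^ n * b k + (1# - ζ ^ k) * Σ< n (λ i → z ^ i * (ζ ^ k) ^ (n ∸ suc i))
    z^*b {k} p∤k zero    = solve 2 (λ b x → con (+ 1) :* b := con (+ 1) :* b :+ x :* con (+ 0)) refl (b k) _
    z^*b {k} p∤k (suc n) = begin
      z * z ^ n * b k
        ≈⟨ *-assoc _ _ _ ⟩
      z * (z ^ n * b k)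
        ≈⟨ *-congˡ (z^*b p∤k n) ⟩
      z * (x ^ n * b k + (1# - x) * s)
        ≈⟨ solve 5 (λ z q b x s → z :* (q :* b :+ (con (+ 1) :- x) :* s) := q :* (z :* b) :+ (con (+ 1) :- x) :* (z :* s)) refl z (x ^ n) (b k) x s ⟩
      x ^ n * (z * b k) + (1# - x) * (z * s)
        ≈⟨ +-cong (*-congˡ (zb k p∤k)) (*-congˡ (trans (*-Σ< n z (λ i → z ^ i * x ^ (n ∸ suc i)))
             (Σ<-cong n (λ i _ → sym (*-assoc z (z ^ i) (x ^ (n ∸ suc i))))))) ⟩
      x ^ n * (x * b k + (1# - x)) + (1# - x) * Σ< n (λ i → z ^ suc i * x ^ (n ∸ suc i))
        ≈⟨ solve 4 (λ q x b s → q :* (x :* b :+ (con (+ 1) :- x)) :+ (con (+ 1) :- x) :* s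
             := x :* q :* b :+ (con (+ 1) :- x) :* (con (+ 1) :* q :+ s)) refl (x ^ n) x (b k) _ ⟩
      x ^ suc n * b k + (1# - x) * Σ< (suc n) (λ i → z ^ i * x ^ (suc n ∸ suc i)) ∎
      where
      x = ζ ^ k
      s = Σ< n (λ i → z ^ i * x ^ (n ∸ suc i))

    -- For i < p this is z^i (x^(p-i) - x^(p-i+1)) with x = ζ^k. Writing the powers as (ζ^m)^k makes
    -- the sum over k, for fixed i, a difference of two geometric sums.
    kernelTerm : ℕ → ℕ → Carrier
    kernelTerm k i = z ^ i * ((ζ ^ suc (p ∸ suc i)) ^ k - (ζ ^ suc (suc (p ∸ suc i))) ^ k)

    [z^p-1]*ζb : ∀ k → p ∤ k → (z ^ p - 1#) * (ζ ^ k * b k) ≈ Σ< p (kernelTerm k)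
    [z^p-1]*ζb k p∤k = begin
      (z ^ p - 1#) * (x * b k)
        ≈⟨ solve 3 (λ q x b → (q :- con (+ 1)) :* (x :* b) := x :* (q :* b :- b)) refl (z ^ p) x (b k) ⟩
      x * (z ^ p * b k - b k)
        ≈⟨ *-congˡ (+-congʳ (z^*b p∤k p)) ⟩
      x * (x ^ p * b k + (1# - x) * s - b k)
        ≈⟨ *-congˡ (+-congʳ (+-congʳ (*-congʳ (trans (^-assocʳ ζ k p) (ζ^≈1 (divides k ≡.refl)))))) ⟩
      x * (1# * b k + (1# - x) * s - b k)
        ≈⟨ solve 3 (λ x b s → x :* (con (+ 1) :* b :+ (con (+ 1) :- x) :* s :- b) := x :* (con (+ 1) :- x) :* s) refl x (b k) s ⟩
      x * (1# - x) * s
        ≈⟨ *-Σ< p (x * (1# - x)) (λ i → z ^ i * x ^ (p ∸ suc i)) ⟩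
      Σ< p (λ i → x * (1# - x) * (z ^ i * x ^ (p ∸ suc i)))
        ≈⟨ Σ<-cong p (λ i _ → trans
             (solve 3 (λ x z q → x :* (con (+ 1) :- x) :* (z :* q) := z :* (x :* q :- x :* (x :* q))) refl x (z ^ i) (x ^ (p ∸ suc i)))
             (*-congˡ (+-cong (^-swap ζ k (suc (p ∸ suc i))) (-‿cong (^-swap ζ k (suc (suc (p ∸ suc i)))))))) ⟩
      Σ< p (kernelTerm k) ∎
      where
      x = ζ ^ k
      s = Σ< p (λ i → z ^ i * x ^ (p ∸ suc i))

    column : ℕ → Carrier
    column i = z ^ i * (orbit (suc (p ∸ suc i)) - orbit (suc (suc (p ∸ suc i))))

    Σ-kernelTerm : ∀ i → Σ< p (λ k → kernelTerm k i) ≈ column i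
    Σ-kernelTerm i = trans (sym (*-Σ< p (z ^ i) f)) (*-congˡ (trans (Σ<-+ p (λ k → (ζ ^ m) ^ k) (λ k → - (ζ ^ suc m) ^ k)) (+-congˡ neg)))
      where
      m = suc (p ∸ suc i)
      f : ℕ → Carrier
      f k = (ζ ^ m) ^ k - (ζ ^ suc m) ^ k
      neg : Σ< p (λ k → - (ζ ^ suc m) ^ k) ≈ - orbit (suc m)
      neg = begin
        Σ< p (λ k → - (ζ ^ suc m) ^ k)
          ≈⟨ Σ<-cong p (λ k _ → solve 1 (λ a → :- a := :- con (+ 1) :* a) refl ((ζ ^ suc m) ^ k)) ⟩
        Σ< p (λ k → - 1# * (ζ ^ suc m) ^ k)
          ≈⟨ *-Σ< p (- 1#) (λ k → (ζ ^ suc m) ^ k) ⟨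
        - 1# * orbit (suc m)
          ≈⟨ solve 1 (λ a → :- con (+ 1) :* a := :- a) refl (orbit (suc m)) ⟩
        - orbit (suc m) ∎

    -- A sum over k is p if the exponent is a multiple of p and 0 otherwise. Among the exponents p -
    -- i and p - i + 1 this happens at i = 0 for the first and at i = 1 for the second.
    Σ-column : Σ< p column ≈ ιℤ (+ p) - ιℤ (+ p) * z
    Σ-column = begin
      Σ< p column
        ≈⟨ Σ<-pair p 0 1 column (s≤s z≤n) 1<p (λ ()) vanish ⟩
      1# * (orbit p - orbit (suc p)) + z * 1# * (orbit (suc (r ∸ 1)) - orbit (suc (suc (r ∸ 1))))
        ≈⟨ +-cong (*-congˡ (+-cong (orbit-∣ ∣-refl) (-‿cong (Σζ^≈0 p∤1+p))))
             (*-congˡ (+-cong (trans (reflexive (cong orbit 1+[r∸1]≡r)) (Σζ^≈0 p∤r))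
               (-‿cong (trans (reflexive (cong (orbit ∘ suc) 1+[r∸1]≡r)) (orbit-∣ ∣-refl))))) ⟩
      1# * (ιℤ (+ p) - 0#) + z * 1# * (0# - ιℤ (+ p))
        ≈⟨ solve 2 (λ p z → con (+ 1) :* (p :- con (+ 0)) :+ z :* con (+ 1) :* (con (+ 0) :- p) := p :- p :* z) refl _ z ⟩
      ιℤ (+ p) - ιℤ (+ p) * z ∎
      where
      0<r : 0 < r
      0<r = ℕ.≤-pred 1<p
      instance
        r≢0 = ℕ.>-nonZero 0<r
      1+[r∸1]≡r : suc (r ∸ 1) ≡ r
      1+[r∸1]≡r = ℕ.suc-pred r
      p∤1+p : p ∤ suc p
      p∤1+p p∣1+p = >⇒∤ 1<p (∣m+n∣m⇒∣n (≡.subst (p ∣_) (ℕ.+-comm 1 p) p∣1+p) ∣-refl)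
      p∤r : p ∤ r
      p∤r = >⇒∤ (ℕ.n<1+n r)
      vanish : ∀ i → i < p → i ≢ 0 → i ≢ 1 → column i ≈ 0#
      vanish zero          i<p i≢0 i≢1 = ⊥-elim (i≢0 ≡.refl)
      vanish (suc zero)    i<p i≢0 i≢1 = ⊥-elim (i≢1 ≡.refl)
      vanish (suc (suc i)) (s≤s i<r) i≢0 i≢1 = trans (*-congˡ (+-cong (Σζ^≈0 (>⇒∤ (ℕ.<-trans (ℕ.n<1+n _) m+1<p))) (-‿cong (Σζ^≈0 (>⇒∤ m+1<p)))))
        (solve 1 (λ a → a :* (con (+ 0) :- con (+ 0)) := con (+ 0)) refl (z ^ suc (suc i)))
        where
        m+1<p : suc (suc (r ∸ suc (suc i))) < p
        m+1<p = s≤s (≡.subst (_< r) (ℕ.+-∸-assoc 1 i<r) (ℕ.∸-monoʳ-< {r} {suc i} {0} (s≤s z≤n) (ℕ.<⇒≤ i<r)))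

    -- Partial fractions of p (1 - z) / (z ^ p - 1), with b k = (1 - ζ ^ k) / (z - ζ ^ k).
    kernel-identity : (z ^ p - 1#) * Σ≢0 (λ k → ζ ^ k * b k) ≈ ιℤ (+ p) - ιℤ (+ p) * z
    kernel-identity = begin
      (z ^ p - 1#) * Σ≢0 (λ k → ζ ^ k * b k)
        ≈⟨ *-Σ< r (z ^ p - 1#) (λ i → ζ ^ suc i * b (suc i)) ⟩
      Σ≢0 (λ k → (z ^ p - 1#) * (ζ ^ k * b k))
        ≈⟨ Σ≢0-cong [z^p-1]*ζb ⟩
      Σ≢0 (λ k → Σ< p (kernelTerm k))
        ≈⟨ +-identityˡ _ ⟨
      0# + Σ≢0 (λ k → Σ< p (kernelTerm k))
        -- The term k = 0, zero because ζ^0 = 1, completes the sums to all residues.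
        ≈⟨ +-congʳ (Σ<-zero p (kernelTerm 0) (λ i _ → trans (*-congˡ (-‿inverseʳ 1#)) (zeroʳ _))) ⟨
      Σ< p (λ k → Σ< p (kernelTerm k))
        ≈⟨ Σ<-comm p p kernelTerm ⟩
      Σ< p (λ i → Σ< p (λ k → kernelTerm k i))
        ≈⟨ Σ<-cong p (λ i _ → Σ-kernelTerm i) ⟩
      Σ< p column
        ≈⟨ Σ-column ⟩
      ιℤ (+ p) - ιℤ (+ p) * z ∎

module KValues (R : ℚ-Algebra) (r : ℕ) (ρ : RootOfUnity R r) (1<p : 1 < suc r) where
  open ℚ-Algebra R
  open RootOfUnity ρ
  open Solver using (solve; _:=_; _:+_; _:*_; _:-_; :-_; con)
  open RangeSum semiring
  open import Relation.Binary.Reasoning.Setoid setoid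
  open Cotangent R r ρ
  open Bernoulli R r ρ 1<p
  open SeriesLift R r ρ

  1+w : Series
  1+w = constant 1# ⊕ w

  1+w⋆-suc : ∀ a n → (1+w ⋆ a) (suc n) ≈ a (suc n) + a n
  1+w⋆-suc a n = trans (⋆-distribʳ a (constant 1#) w (suc n)) (+-cong (Ser.*-identityˡ a (suc n)) (w⋆-suc a n))

  1+w⋆-zero : ∀ a → (1+w ⋆ a) 0 ≈ a 0
  1+w⋆-zero a = trans (*-congʳ (+-identityʳ 1#)) (*-identityˡ _)

  -- In z = 1 + w this is 1 / (1 + d_k w) = (1 - ζ^k) / (z - ζ^k), the partial fraction with pole
  -- ζ^k, normalised to 1 at z = 1.
  b : ℕ → Series
  b k = geometric (- d k)

  1+w⋆b : ∀ k → p ∤ k → 1+w ⋆ b k ≋ (constant ζ Ser.^ k ⋆ b k) ⊕ (constant 1# Ser.- constant ζ Ser.^ k)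
  1+w⋆b k p∤k n = trans (pointwise n) (sym (+-cong
    (trans (⋆-cong {b = b k} (constant-^ ζ k) (λ _ → refl) n) (constant-⋆ (ζ ^ k) (b k) n))
    (trans (+-congˡ (-‿cong (constant-^ ζ k n))) (1-constant (ζ ^ k) n))))
    where
    pointwise : ∀ n → (1+w ⋆ b k) n ≈ ζ ^ k * b k n + constant (1# - ζ ^ k) n
    pointwise zero    = trans (1+w⋆-zero (b k)) (solve 1 (λ x → con (+ 1) := x :* con (+ 1) :+ (con (+ 1) :- x)) refl _)
    pointwise (suc n) = begin
      (1+w ⋆ b k) (suc n)                ≈⟨ 1+w⋆-suc (b k) n ⟩
      - d k * b k n + b k n            ≈⟨ +-congˡ (trans (sym (*-identityˡ _)) (*-congʳ (sym (d-inverse p∤k)))) ⟩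
      - d k * b k n + (1# - ζ ^ k) * d k * b k n
        ≈⟨ solve 3 (λ d b x → :- d :* b :+ (con (+ 1) :- x) :* d :* b := x :* (:- d :* b) :+ con (+ 0)) refl (d k) (b k n) _ ⟩
      ζ ^ k * (- d k * b k n) + 0#     ∎

  open Kernel powerSeriesAlgebra r ρˢ 1<p using (kernel-identity)

  -- The expansion of p (z - 1) / (z^p - 1) about z = 1; the minus sign turns p - p z into p w.
  G : Series
  G = Ser.- Ser.Σ< r (λ i → constant ζ Ser.^ suc i ⋆ b (suc i))

  [1+w^p-1]⋆G : (1+w Ser.^ p Ser.- constant 1#) ⋆ G ≋ Ser.ιℤ (+ p) ⋆ w
  [1+w^p-1]⋆G = Ser.trans (Ser.sym (-‿distribʳ-* (1+w Ser.^ p Ser.- constant 1#) _)) (Ser.trans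
    (Ser.-‿cong (kernel-identity 1+w b 1+w⋆b))
    (Ser.Solver.solve 2 (λ p w → Ser.Solver.:- (p Ser.Solver.:- p Ser.Solver.:* (Ser.Solver.con (+ 1) Ser.Solver.:+ w)) Ser.Solver.:= p Ser.Solver.:* w)
       Ser.refl (Ser.ιℤ (+ p)) w))
    where open import Algebra.Properties.Ring Ser.ring using (-‿distribʳ-*)

  1+w^-0 : ∀ n → (1+w Ser.^ n) 0 ≈ 1#
  1+w^-0 zero    = refl
  1+w^-0 (suc n) = trans (1+w⋆-zero (1+w Ser.^ n)) (1+w^-0 n)

  1+w^-1 : ∀ n → (1+w Ser.^ n) 1 ≈ ιℤ (+ n)
  1+w^-1 zero    = refl
  1+w^-1 (suc n) = trans (1+w⋆-suc (1+w Ser.^ n) 0) (trans (+-cong (1+w^-1 n) (1+w^-0 n)) (trans (+-comm _ _) (sym (ιℤ-+ (+ 1) (+ n)))))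

  -- As a series in w, z^p - 1 has constant term 0 and linear coefficient p, so it can be cancelled.
  G-unique : ∀ g → (1+w Ser.^ p Ser.- constant 1#) ⋆ g ≋ Ser.ιℤ (+ p) ⋆ w → g ≋ G
  G-unique g eq n = begin
    g n                ≈⟨ solve 2 (λ a b → a := a :- b :+ b) refl (g n) (G n) ⟩
    g n - G n + G n    ≈⟨ +-congʳ (⋆-cancel (1+w Ser.^ p Ser.- constant 1#) (g Ser.- G) r
                            (trans (+-congʳ (1+w^-0 p)) (-‿inverseʳ 1#))
                            (trans (+-cong (1+w^-1 p) -0#≈0#) (+-identityʳ _)) vanish n) ⟩
    0# + G n           ≈⟨ +-identityˡ _ ⟩
    G n                ∎
    where
    open import Algebra.Properties.Ring ring using (-0#≈0#)
    vanish : (1+w Ser.^ p Ser.- constant 1#) ⋆ (g Ser.- G) ≋ λ _ → 0#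
    vanish = Ser.trans (Ser.Solver.solve 3 (λ a b c → a Ser.Solver.:* (b Ser.Solver.:- c) Ser.Solver.:= a Ser.Solver.:* b Ser.Solver.:- a Ser.Solver.:* c) Ser.refl (1+w Ser.^ p Ser.- constant 1#) g G)
      (Ser.trans (Ser.+-cong eq (Ser.-‿cong [1+w^p-1]⋆G)) (Ser.-‿inverseʳ _))

  geometric-neg : ∀ x n → (- x) ^ n ≈ (- 1#) ^ n * x ^ n
  geometric-neg x zero    = sym (*-identityˡ 1#)
  geometric-neg x (suc n) = trans (*-congˡ (geometric-neg x n))
    (solve 3 (λ x a b → :- x :* (a :* b) := :- con (+ 1) :* a :* (x :* b)) refl x _ _)

  G≈bernoulli : ∀ n → G n ≈ (- 1#) ^ suc n * bernoulli n
  G≈bernoulli n = begin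
    - Ser.Σ< r (λ i → constant ζ Ser.^ suc i ⋆ b (suc i)) n
      ≈⟨ -‿cong (Σˢ r (λ i → constant ζ Ser.^ suc i ⋆ b (suc i)) n) ⟩
    - Σ< r (λ i → (constant ζ Ser.^ suc i ⋆ b (suc i)) n)
      ≈⟨ -‿cong (Σ<-cong r (λ i _ → trans (⋆-cong {b = b (suc i)} (constant-^ ζ (suc i)) (λ _ → refl) n)
           (trans (constant-⋆ (ζ ^ suc i) (b (suc i)) n) (trans (*-congˡ (geometric-neg (d (suc i)) n))
             (solve 3 (λ x a b → x :* (a :* b) := a :* (x :* b)) refl (ζ ^ suc i) ((- 1#) ^ n) (d (suc i) ^ n)))))) ⟩
    - Σ< r (λ i → (- 1#) ^ n * (ζ ^ suc i * d (suc i) ^ n))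
      ≈⟨ -‿cong (*-Σ< r ((- 1#) ^ n) (λ i → ζ ^ suc i * d (suc i) ^ n)) ⟨
    - ((- 1#) ^ n * bernoulli n)
      ≈⟨ solve 2 (λ a b → :- (a :* b) := :- con (+ 1) :* a :* b) refl _ _ ⟩
    (- 1#) ^ suc n * bernoulli n ∎

-- The ring ℚ[q] and its quotient by [p]

ℚ-algebra : ℚ-Algebra
ℚ-algebra = record
  { commutativeRing = ℚ.+-*-commutativeRing
  ; ι = id
  ; ι-homo = record
    { isSemiringHomomorphism = record
      { isNearSemiringHomomorphism = record
        { +-isMonoidHomomorphism = record
          { isMagmaHomomorphism = record
            { isRelHomomorphism = record { cong = id }
            ; homo = λ x y → ≡.refl }
          ; ε-homo = ≡.refl }
        ; *-homo = λ x y → ≡.refl }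
      ; 1#-homo = ≡.refl }
    ; -‿homo = λ x → ≡.refl } }

module ℚ[[q]] = PowerSeries ℚ-algebra

module _ where
  open ℚ[q]
  open ℚ[[q]] using (_≋_; _⋆_; constant; ⋆-zeroˡ)

  coeff-⋆ : ∀ f g → coeff (f *ᴾ g) ≋ coeff f ⋆ coeff g
  coeff-⋆ []      g n       = ≡.sym (⋆-zeroˡ (coeff g) n)
  coeff-⋆ (a ∷ f) g zero    = ≡.trans (coeff-∷* a f g 0) (ℚ.+-identityʳ _)
  coeff-⋆ (a ∷ f) g (suc n) = ≡.trans (coeff-∷* a f g (suc n)) (cong (a ℚ.* coeff g (suc n) ℚ.+_) (coeff-⋆ f g n))

  coeff-neg : ∀ f n → coeff (List.map (ℚ.-_) f) n ≡ ℚ.- coeff f n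
  coeff-neg []      n       = ≡.refl
  coeff-neg (a ∷ f) zero    = ≡.refl
  coeff-neg (a ∷ f) (suc n) = coeff-neg f n

  coeff-const : ∀ c → coeff (c ∷ []) ≋ constant c
  coeff-const c zero    = ≡.refl
  coeff-const c (suc n) = ≡.refl

  -- Polynomial equality is equality of all coefficients, so the ring laws of ℚ[q] can be pulled
  -- back from power series.
  coeff-isRingMonomorphism : IsRingMonomorphism polyRawRing ℚ[[q]].rawRing-ˢ coeff
  coeff-isRingMonomorphism = record
    { isRingHomomorphism = record
      { isSemiringHomomorphism = record
        { isNearSemiringHomomorphism = record
          { +-isMonoidHomomorphism = record
            { isMagmaHomomorphism = record
              { isRelHomomorphism = record { cong = id }
              ; homo = coeff-+ }
            ; ε-homo = λ n → ≡.refl }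
          ; *-homo = coeff-⋆ }
        ; 1#-homo = coeff-const 1ℚ }
      ; -‿homo = coeff-neg }
    ; injective = id }

  ℚ[q]-algebra : ℚ-Algebra
  ℚ[q]-algebra = record
    { commutativeRing = record
      { isCommutativeRing = RingMonomorphism.isCommutativeRing coeff-isRingMonomorphism ℚ[[q]].isCommutativeRing-ˢ }
    ; ι = _∷ []
    ; ι-homo = record
      { isSemiringHomomorphism = record
        { isNearSemiringHomomorphism = record
          { +-isMonoidHomomorphism = record
            { isMagmaHomomorphism = record
              { isRelHomomorphism = record { cong = λ { ≡.refl n → ≡.refl } }
              ; homo = λ x y n → ≡.refl }
            ; ε-homo = λ { zero → ≡.refl ; (suc n) → ≡.refl } }
          ; *-homo = λ { x y zero → ≡.sym (ℚ.+-identityʳ _) ; x y (suc n) → ≡.refl } }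
        ; 1#-homo = λ n → ≡.refl }
      ; -‿homo = λ { x zero → ≡.refl ; x (suc n) → ≡.refl } } }

module QuotientAlgebra (R : ℚ-Algebra) (m : ℚ-Algebra.Carrier R) where
  open ℚ-Algebra R
  open Solver using (solve; _:=_; _:+_; _:*_; _:-_; :-_; con)
  open import Relation.Binary.Reasoning.Setoid setoid

  infix 4 _~_
  -- A residue class is represented by any of its elements; the cofactor `h` is kept as a witness,
  -- since it later yields the numerator of the congruence.
  _~_ : Carrier → Carrier → Set
  x ~ y = ∃[ h ] h * m ≈ x - y

  ≈⇒~ : ∀ {x y} → x ≈ y → x ~ y
  ≈⇒~ {x} {y} x≈y = 0# , trans (zeroˡ m) (trans (sym (-‿inverseʳ y)) (+-congʳ (sym x≈y)))

  private
    ~-sym : ∀ {x y} → x ~ y → y ~ x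
    ~-sym {x} {y} (h , e) = - h , (begin
      - h * m     ≈⟨ solve 2 (λ h m → :- h :* m := :- (h :* m)) refl h m ⟩
      - (h * m)   ≈⟨ -‿cong e ⟩
      - (x - y)   ≈⟨ solve 2 (λ x y → :- (x :- y) := y :- x) refl x y ⟩
      y - x       ∎)

    ~-trans : ∀ {x y z} → x ~ y → y ~ z → x ~ z
    ~-trans {x} {y} {z} (h , e) (k , f) = h + k , (begin
      (h + k) * m          ≈⟨ distribʳ m h k ⟩
      h * m + k * m        ≈⟨ +-cong e f ⟩
      x - y + (y - z)      ≈⟨ solve 3 (λ x y z → x :- y :+ (y :- z) := x :- z) refl x y z ⟩
      x - z                ∎)

    +-~ : ∀ {x y u v} → x ~ y → u ~ v → x + u ~ y + v
    +-~ {x} {y} {u} {v} (h , e) (k , f) = h + k , (begin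
      (h + k) * m          ≈⟨ distribʳ m h k ⟩
      h * m + k * m        ≈⟨ +-cong e f ⟩
      x - y + (u - v)      ≈⟨ solve 4 (λ x y u v → x :- y :+ (u :- v) := x :+ u :- (y :+ v)) refl x y u v ⟩
      x + u - (y + v)      ∎)

    *-~ : ∀ {x y u v} → x ~ y → u ~ v → x * u ~ y * v
    *-~ {x} {y} {u} {v} (h , e) (k , f) = h * u + y * k , (begin
      (h * u + y * k) * m          ≈⟨ solve 5 (λ h u y k m → (h :* u :+ y :* k) :* m := h :* m :* u :+ y :* (k :* m)) refl h u y k m ⟩
      h * m * u + y * (k * m)      ≈⟨ +-cong (*-congʳ e) (*-congˡ f) ⟩
      (x - y) * u + y * (u - v)    ≈⟨ solve 4 (λ x y u v → (x :- y) :* u :+ y :* (u :- v) := x :* u :- y :* v) refl x y u v ⟩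
      x * u - y * v                ∎)

    neg-~ : ∀ {x y} → x ~ y → - x ~ - y
    neg-~ {x} {y} (h , e) = - h , (begin
      - h * m     ≈⟨ solve 2 (λ h m → :- h :* m := :- (h :* m)) refl h m ⟩
      - (h * m)   ≈⟨ -‿cong e ⟩
      - (x - y)   ≈⟨ solve 2 (λ x y → :- (x :- y) := :- x :- :- y) refl x y ⟩
      - x - - y   ∎)

  isCommutativeRing-~ : IsCommutativeRing _~_ _+_ _*_ -_ 0# 1#
  isCommutativeRing-~ = record
    { isRing = record
      { +-isAbelianGroup = record
        { isGroup = record
          { isMonoid = record
            { isSemigroup = record
              { isMagma = record
                { isEquivalence = record { refl = ≈⇒~ refl ; sym = ~-sym ; trans = ~-trans }
                ; ∙-cong = +-~ }
              ; assoc = λ x y z → ≈⇒~ (+-assoc x y z) }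
            ; identity = (λ x → ≈⇒~ (+-identityˡ x)) , (λ x → ≈⇒~ (+-identityʳ x)) }
          ; inverse = (λ x → ≈⇒~ (-‿inverseˡ x)) , (λ x → ≈⇒~ (-‿inverseʳ x))
          ; ⁻¹-cong = neg-~ }
        ; comm = λ x y → ≈⇒~ (+-comm x y) }
      ; *-cong = *-~
      ; *-assoc = λ x y z → ≈⇒~ (*-assoc x y z)
      ; *-identity = (λ x → ≈⇒~ (*-identityˡ x)) , (λ x → ≈⇒~ (*-identityʳ x))
      ; distrib = (λ x y z → ≈⇒~ (distribˡ x y z)) , (λ x y z → ≈⇒~ (distribʳ x y z)) }
    ; *-comm = λ x y → ≈⇒~ (*-comm x y) }

  quotientAlgebra : ℚ-Algebra
  quotientAlgebra = record
    { commutativeRing = record { isCommutativeRing = isCommutativeRing-~ }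
    ; ι = ι
    ; ι-homo = record
      { isSemiringHomomorphism = record
        { isNearSemiringHomomorphism = record
          { +-isMonoidHomomorphism = record
            { isMagmaHomomorphism = record
              { isRelHomomorphism = record { cong = λ x≡y → ≈⇒~ (ι.⟦⟧-cong x≡y) }
              ; homo = λ x y → ≈⇒~ (ι.+-homo x y) }
            ; ε-homo = ≈⇒~ ι.0#-homo }
          ; *-homo = λ x y → ≈⇒~ (ι.*-homo x y) }
        ; 1#-homo = ≈⇒~ ι.1#-homo }
      ; -‿homo = λ x → ≈⇒~ (ι.-‿homo x) } }

  ~0⇒∣ : ∀ {x} → x ~ 0# → ∃[ h ] h * m ≈ x
  ~0⇒∣ {x} (h , e) = h , trans e (solve 1 (λ x → x :- con (+ 0) := x) refl x)

  m~0 : m ~ 0#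
  m~0 = 1# , solve 1 (λ m → con (+ 1) :* m := m :- con (+ 0)) refl m

-- q-integers and the residue ring modulo [p]

record QIntegers (A : ℚ-Algebra) : Set where
  open ℚ-Algebra A
  field
    q       : Carrier
    [_]     : ℕ → Carrier
    []-zero : [ 0 ] ≈ 0#
    []-suc  : ∀ n → [ suc n ] ≈ 1# + q * [ n ]

  open Solver using (solve; _:=_; _:+_; _:*_; _:-_; :-_; con)
  open import Relation.Binary.Reasoning.Setoid setoid

  [1-q]*[] : ∀ n → (1# - q) * [ n ] ≈ 1# - q ^ n
  [1-q]*[] zero    = trans (*-congˡ []-zero) (trans (zeroʳ (1# - q)) (sym (-‿inverseʳ 1#)))
  [1-q]*[] (suc n) = begin
    (1# - q) * [ suc n ]            ≈⟨ *-congˡ ([]-suc n) ⟩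
    (1# - q) * (1# + q * [ n ])     ≈⟨ solve 2 (λ q s → (con (+ 1) :- q) :* (con (+ 1) :+ q :* s) := con (+ 1) :- q :+ q :* ((con (+ 1) :- q) :* s)) refl q [ n ] ⟩
    1# - q + q * ((1# - q) * [ n ]) ≈⟨ +-congˡ  (*-congˡ  ([1-q]*[] n)) ⟩
    1# - q + q * (1# - q ^ n)       ≈⟨ solve 2 (λ q s → con (+ 1) :- q :+ q :* (con (+ 1) :- s) := con (+ 1) :- q :* s) refl q (q ^ n) ⟩
    1# - q ^ suc n                  ∎

  -- At q = 1 the q-integer becomes n. For n = p this shows that 1 - q divides the invertible number
  -- p modulo `[ p ]`.
  n-[n] : ∀ n → ∃[ e ] (1# - q) * e ≈ ιℤ (+ n) - [ n ]
  n-[n] zero    = 0# , trans (zeroʳ (1# - q)) (sym (trans (+-congˡ (-‿cong []-zero)) (-‿inverseʳ 0#)))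
  n-[n] (suc n) with n-[n] n
  ... | e , eq = e + [ n ] , (begin
    (1# - q) * (e + [ n ])                      ≈⟨ solve 3 (λ q e s → (con (+ 1) :- q) :* (e :+ s) := (con (+ 1) :- q) :* e :+ s :- q :* s) refl q e [ n ] ⟩
    (1# - q) * e + [ n ] - q * [ n ]            ≈⟨ +-congʳ (+-congʳ eq) ⟩
    ιℤ (+ n) - [ n ] + [ n ] - q * [ n ]        ≈⟨ solve 3 (λ n q s → n :- s :+ s :- q :* s := con (+ 1) :+ n :- (con (+ 1) :+ q :* s)) refl (ιℤ (+ n)) q [ n ] ⟩
    1# + ιℤ (+ n) - (1# + q * [ n ])            ≈⟨ +-cong (ιℤ-+ (+ 1) (+ n)) (-‿cong ([]-suc n)) ⟨
    ιℤ (+ suc n) - [ suc n ]                    ∎)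

module _ where
  open ℚ[q] using (q; [_])
  open ℚ-Algebra ℚ[q]-algebra using (_≈_; _+_; _*_; 1#)

  [1+n]≈1+q[n] : ∀ n → [ suc n ] ≈ 1# + q * [ n ]
  [1+n]≈1+q[n] n zero    = ≡.sym (≡.trans (coeff-+ 1# (q * [ n ]) 0) (≡.trans
    (cong (1ℚ ℚ.+_) (≡.trans (coeff-∷* 0ℚ (1ℚ ∷ []) [ n ] 0) (≡.trans (ℚ.+-identityʳ _) (ℚ.*-zeroˡ (ℚ[q].coeff [ n ] 0))))) (ℚ.+-identityʳ 1ℚ)))
  [1+n]≈1+q[n] n (suc m) = ≡.sym (≡.trans (coeff-+ 1# (q * [ n ]) (suc m)) (≡.trans (ℚ.+-identityˡ _)
    (≡.trans (coeff-⋆ q [ n ] (suc m)) (≡.trans (ℚ[[q]].⋆-cong {b = ℚ[q].coeff [ n ]} coeff-q (λ _ → ≡.refl) (suc m)) (ℚ[[q]].w⋆-suc (ℚ[q].coeff [ n ]) m)))))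
    where
    coeff-q : ∀ i → ℚ[q].coeff q i ≡ ℚ[[q]].w i
    coeff-q zero          = ≡.refl
    coeff-q (suc zero)    = ≡.refl
    coeff-q (suc (suc i)) = ≡.refl

  ℚ[q]-integers : QIntegers ℚ[q]-algebra
  ℚ[q]-integers = record { q = q ; [_] = [_] ; []-zero = λ n → ≡.refl ; []-suc = [1+n]≈1+q[n] }

module CyclotomicRing (A : ℚ-Algebra) (Q : QIntegers A) (r : ℕ) (p-prime : Prime (suc r)) where
  private module Base = ℚ-Algebra A
  open QIntegers Q
  p : ℕ
  p = suc r

  open QuotientAlgebra A [ p ] public using (_~_; ≈⇒~; ~0⇒∣; m~0)
  R : ℚ-Algebra
  R = QuotientAlgebra.quotientAlgebra A [ p ]

  open ℚ-Algebra R
  open Solver using (solve; _:=_; _:+_; _:*_; _:-_; :-_; con)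
  open import Relation.Binary.Reasoning.Setoid setoid

  ζ : Carrier
  ζ = q

  ^-base : ∀ x n → x ^ n ≡ x Base.^ n
  ^-base x zero    = ≡.refl
  ^-base x (suc n) = cong (x *_) (^-base x n)

  ιℤ-base : ∀ i → ιℤ i ≡ Base.ιℤ i
  ιℤ-base (+ 0)           = ≡.refl
  ιℤ-base (+ 1)           = ≡.refl
  ιℤ-base (+ suc (suc n)) = ≡.refl
  ιℤ-base ℤ.-[1+ n ]      = ≡.refl

  ζ^p~1 : ζ ^ p ~ 1#
  ζ^p~1 = begin
    ζ ^ p                             ≈⟨ solve 1 (λ x → x := con (+ 1) :- (con (+ 1) :- x)) refl (ζ ^ p) ⟩
    1# - (1# - ζ ^ p)                 ≈⟨ +-congˡ {1#} (-‿cong (trans (≈⇒~ ([1-q]*[] p)) (reflexive (cong (λ x → 1# - x) (≡.sym (^-base ζ p)))))) ⟨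
    1# - (1# - ζ) * [ p ]        ≈⟨ +-congˡ {1#} (-‿cong (*-congˡ {1# - ζ} m~0)) ⟩
    1# - (1# - ζ) * 0#                ≈⟨ solve 1 (λ x → con (+ 1) :- x :* con (+ 0) := con (+ 1)) refl (1# - ζ) ⟩
    1#                                ∎

  Unit : Carrier → Set
  Unit x = ∃[ u ] u * x ~ 1#

  unit-* : ∀ {x y} → Unit x → Unit y → Unit (x * y)
  unit-* {x} {y} (u , e) (v , f) = u * v , (begin
    u * v * (x * y)       ≈⟨ solve 4 (λ u v x y → u :* v :* (x :* y) := u :* x :* (v :* y)) refl u v x y ⟩
    u * x * (v * y)       ≈⟨ *-cong e f ⟩
    1# * 1#               ≈⟨ *-identityˡ 1# ⟩
    1#                    ∎)

  unit-∣ : ∀ {x} y z → x ~ y * z → Unit x → Unit z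
  unit-∣ {x} y z x~yz (u , e) = u * y , trans (*-assoc u y z) (trans (*-congˡ {u} (sym x~yz)) e)

  unit-1 : Unit 1#
  unit-1 = 1# , *-identityˡ 1#

  unit-^ : ∀ {x} n → Unit x → Unit (x ^ n)
  unit-^ zero    ux = unit-1
  unit-^ (suc n) ux = unit-* ux (unit-^ n ux)

  -- Used with x = 1 - ζ, n = p and s = `[ p ]`, where x e = p - `[ p ]` reduces to the invertible
  -- p.
  unit-difference : ∀ {a n s} e x → a * n ~ 1# → s ~ 0# → x * e ~ n - s → Unit x
  unit-difference {a} {n} {s} e x an~1 s~0 xe~n-s = a * e , (begin
    a * e * x      ≈⟨ solve 3 (λ a e x → a :* e :* x := a :* (x :* e)) refl a e x ⟩
    a * (x * e)    ≈⟨ *-congˡ {a} xe~n-s ⟩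
    a * (n - s)    ≈⟨ *-congˡ {a} (+-congˡ {n} (-‿cong s~0)) ⟩
    a * (n - 0#)   ≈⟨ solve 2 (λ a n → a :* (n :- con (+ 0)) := a :* n) refl a n ⟩
    a * n          ≈⟨ an~1 ⟩
    1#             ∎)

  unit-[1-ζ] : Unit (1# - ζ)
  unit-[1-ζ] = unit-difference {ι⁻¹ r} {ιℤ (+ p)} {[ p ]} (proj₁ (n-[n] p)) (1# - ζ) (ιℤ-inverse r) m~0
    (trans {j = Base.ιℤ (+ p) - [ p ]} (≈⇒~ (proj₂ (n-[n] p))) (reflexive (cong (λ x → x - [ p ]) (≡.sym (ιℤ-base (+ p))))))

  1-x^n : ∀ x n → ∃[ s ] 1# - x ^ n ~ s * (1# - x)
  1-x^n x zero    = 0# , trans (-‿inverseʳ 1#) (sym (zeroˡ (1# - x)))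
  1-x^n x (suc n) with 1-x^n x n
  ... | s , eq = 1# + x * s , (begin
    1# - x * x ^ n                       ≈⟨ solve 2 (λ x y → con (+ 1) :- x :* y := con (+ 1) :- x :+ x :* (con (+ 1) :- y)) refl x (x ^ n) ⟩
    1# - x + x * (1# - x ^ n)            ≈⟨ +-congˡ {1# - x} (*-congˡ {x} eq) ⟩
    1# - x + x * (s * (1# - x))          ≈⟨ solve 2 (λ x s → con (+ 1) :- x :+ x :* (s :* (con (+ 1) :- x)) := (con (+ 1) :+ x :* s) :* (con (+ 1) :- x)) refl x s ⟩
    (1# + x * s) * (1# - x)              ∎)

  ζ^[m*p] : ∀ m → ζ ^ (m ℕ.* p) ~ 1#
  ζ^[m*p] zero    = refl
  ζ^[m*p] (suc m) = trans (^-homo-* ζ p (m ℕ.* p)) (trans (*-cong ζ^p~1 (ζ^[m*p] m)) (*-identityˡ 1#))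

  -- A Bézout relation between k and the prime p writes ζ as a power of ζ^k or of its inverse, so 1
  -- - ζ^k divides the unit 1 - ζ.
  unit-[1-ζ^] : ∀ {k} → p ∤ k → Unit (1# - ζ ^ k)
  unit-[1-ζ^] {k} p∤k with coprime-Bézout coprime
    where
    coprime : Coprime k p
    coprime (i∣k , i∣p) with prime⇒irreducible p-prime i∣p
    ... | inj₁ i≡1    = i≡1
    ... | inj₂ ≡.refl = ⊥-elim (p∤k i∣k)
  ... | Bézout.+- x y eq with 1-x^n (ζ ^ k) x
  ... | s , e = unit-∣ s (1# - ζ ^ k) (begin
    1# - ζ                        ≈⟨ +-congˡ {1#} (-‿cong (trans (*-congˡ {ζ} (ζ^[m*p] y)) (*-identityʳ ζ))) ⟨
    1# - ζ ^ (1 ℕ.+ y ℕ.* p)      ≡⟨ cong (λ m → 1# - ζ ^ m) (≡.trans eq (ℕ.*-comm x k)) ⟩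
    1# - ζ ^ (k ℕ.* x)            ≈⟨ +-congˡ {1#} (-‿cong (^-assocʳ ζ k x)) ⟨
    1# - (ζ ^ k) ^ x              ≈⟨ e ⟩
    s * (1# - ζ ^ k)              ∎) unit-[1-ζ]
  unit-[1-ζ^] {k} p∤k | Bézout.-+ x y eq with 1-x^n (ζ ^ k) x
  -- With 1 + k x = y p one has ζ ζ^(k x) = 1, hence 1 - ζ = -ζ (1 - ζ^(k x)); this accounts for the
  -- cofactor -ζ s.
  ... | s , e = unit-∣ (- ζ * s) (1# - ζ ^ k) (begin
    1# - ζ                        ≈⟨ +-congʳ {x = - ζ} (ζ^[m*p] y) ⟨
    ζ ^ (y ℕ.* p) - ζ             ≡⟨ cong (λ m → ζ ^ m - ζ) (≡.sym (≡.trans (cong (1 ℕ.+_) (ℕ.*-comm k x)) eq)) ⟩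
    ζ * ζ ^ (k ℕ.* x) - ζ         ≈⟨ +-congʳ {x = - ζ} (*-congˡ {ζ} (^-assocʳ ζ k x)) ⟨
    ζ * (ζ ^ k) ^ x - ζ           ≈⟨ solve 2 (λ z y → z :* y :- z := :- z :* (con (+ 1) :- y)) refl ζ ((ζ ^ k) ^ x) ⟩
    - ζ * (1# - (ζ ^ k) ^ x)      ≈⟨ *-congˡ { - ζ} e ⟩
    - ζ * (s * (1# - ζ ^ k))      ≈⟨ *-assoc (- ζ) s (1# - ζ ^ k) ⟨
    - ζ * s * (1# - ζ ^ k)        ∎) unit-[1-ζ]

  -- `ι⁻¹ 1` is 1 / 2, the argument of `ι⁻¹` being one less than the denominator.
  d′ : ∀ {k} → Dec (p ∣ k) → Carrier
  d′ (yes _)   = ι⁻¹ 1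
  d′ (no p∤k)  = proj₁ (unit-[1-ζ^] p∤k)

  d : ℕ → Carrier
  d k = d′ (p ∣? k)

  2d~1 : ∀ {k} → p ∣ k → ιℤ (+ 2) * d k ~ 1#
  2d~1 {k} p∣k with p ∣? k
  ... | yes _   = trans (*-comm (ιℤ (+ 2)) (ι⁻¹ 1)) (ιℤ-inverse 1)
  ... | no  p∤k = ⊥-elim (p∤k p∣k)

  d-inverse : ∀ {k} → p ∤ k → (1# - ζ ^ k) * d k ~ 1#
  d-inverse {k} p∤k with p ∣? k
  ... | yes p∣k  = ⊥-elim (p∤k p∣k)
  ... | no  p∤k′ = trans (*-comm (1# - ζ ^ k) (proj₁ (unit-[1-ζ^] p∤k′))) (proj₂ (unit-[1-ζ^] p∤k′))

  ρ : RootOfUnity R r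
  ρ = record { ζ = ζ ; ζ^p≈1 = ζ^p~1 ; d = d ; 2d≈1 = 2d~1 ; d-inverse = λ {k} → d-inverse {k} }

-- Rational coefficients in a ℚ-algebra and the residue classes of K_n

⊛≡⋆ : ∀ a b n → (a ⊛ b) n ≡ ℚ[[q]]._⋆_ a b n
⊛≡⋆ a b zero    = ℚ.+-identityʳ _
⊛≡⋆ a b (suc n) = cong (a 0 ℚ.* b (suc n) ℚ.+_) (⊛≡⋆ (a ∘ suc) b n)

module Rational (R : ℚ-Algebra) where
  open ℚ-Algebra R
  open PowerSeries R
  open RangeSum semiring using (sum)

  ι-⋆ : ∀ a b n → ι (ℚ[[q]]._⋆_ a b n) ≈ ((ι ∘ a) ⋆ (ι ∘ b)) n
  ι-⋆ a b zero    = ι.*-homo _ _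
  ι-⋆ a b (suc n) = trans (ι.+-homo _ _) (+-cong (ι.*-homo _ _) (ι-⋆ (a ∘ suc) b n))

  ι-^ : ∀ x n → ι (x Q.^ n) ≈ ι x ^ n
  ι-^ x zero    = ι.1#-homo
  ι-^ x (suc n) = trans (ι.*-homo _ _) (*-congˡ (ι-^ x n))

  ι-sum : ∀ {n} (f : Fin n → ℚ) → ι (Q.sum f) ≈ sum (ι ∘ f)
  ι-sum {zero}  f = ι.0#-homo
  ι-sum {suc n} f = trans (ι.+-homo _ _) (+-congˡ (ι-sum (f ∘ Fin.suc)))

  ι[-1] : ι (ℚ.- 1ℚ) ≈ - 1#
  ι[-1] = trans (ι.-‿homo 1ℚ) (-‿cong ι.1#-homo)

  ι[-1]^ : ∀ n → ι ((ℚ.- 1ℚ) Q.^ n) ≈ (- 1#) ^ n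
  ι[-1]^ n = trans (ι-^ (ℚ.- 1ℚ) n) (^-congˡ n ι[-1])

module _ (R : ℚ-Algebra) (r : ℕ) (ρ : RootOfUnity R r)
  (1<p : 1 < suc r) (K : ℕ → ℚ) (isK : IsK (suc r) K)
  where
  open ℚ-Algebra R
  open RootOfUnity ρ
  open Solver using (solve; _:=_; _:*_; _:-_; :-_; con)
  open RangeSum semiring
  open import Relation.Binary.Reasoning.Setoid setoid
  open Rational R
  open Bernoulli R r ρ 1<p
  open KValues R r ρ 1<p
  open RootSums R r ρ using (closedForm)
  open SeriesLift R r ρ

  private
    p : ℕ
    p = suc r

  signedK : ℕ → ℚ
  signedK m = ((ℚ.- 1ℚ) Q.^ suc m) ℚ.* K m

  ι-coeff-z : ι ∘ ℚ[q].coeff z ≋ 1+w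
  ι-coeff-z zero          = trans ι.1#-homo (sym (+-identityʳ 1#))
  ι-coeff-z (suc zero)    = trans ι.1#-homo (sym (+-identityˡ 1#))
  ι-coeff-z (suc (suc n)) = trans ι.0#-homo (sym (+-identityˡ 0#))

  ι-coeff-z^ : ∀ n → ι ∘ ℚ[q].coeff (z ℚ[q].^ᴾ n) ≋ 1+w Ser.^ n
  ι-coeff-z^ zero    zero    = ι.1#-homo
  ι-coeff-z^ zero    (suc m) = ι.0#-homo
  ι-coeff-z^ (suc n) m       = trans (ι.⟦⟧-cong (coeff-⋆ z (z ℚ[q].^ᴾ n) m))
    (trans (ι-⋆ (ℚ[q].coeff z) (ℚ[q].coeff (z ℚ[q].^ᴾ n)) m) (⋆-cong ι-coeff-z (ι-coeff-z^ n) m))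

  ι-coeff-zᵖ-1 : ι ∘ ℚ[q].coeff (zᵖ-1 p) ≋ 1+w Ser.^ p Ser.- constant 1#
  ι-coeff-zᵖ-1 m = trans (ι.⟦⟧-cong (coeff-+ (z ℚ[q].^ᴾ p) ((ℚ.- 1ℚ) ∷ []) m))
    (trans (ι.+-homo _ _) (+-cong (ι-coeff-z^ p m) (ι-1 m)))
    where
    open import Algebra.Properties.Ring ring using (-0#≈0#)
    ι-1 : ∀ m → ι (ℚ[q].coeff ((ℚ.- 1ℚ) ∷ []) m) ≈ - constant 1# m
    ι-1 zero    = ι[-1]
    ι-1 (suc m) = trans ι.0#-homo (sym -0#≈0#)

  ι-coeff-p·x : ι ∘ ℚ[q].coeff (p·x p) ≋ Ser.ιℤ (+ p) ⋆ w
  ι-coeff-p·x n = trans (pointwise n) (sym (ιℤ-⋆ (+ p) w n))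
    where
    pointwise : ∀ n → ι (ℚ[q].coeff (p·x p) n) ≈ ιℤ (+ p) * w n
    pointwise zero          = trans ι.0#-homo (sym (zeroʳ _))
    pointwise (suc zero)    = trans (sym (ιℤ≈ (+ p))) (sym (*-identityʳ _))
    pointwise (suc (suc n)) = trans ι.0#-homo (sym (zeroʳ _))

  [-1]^-square : ∀ n → (- 1#) ^ n * (- 1#) ^ n ≈ 1#
  [-1]^-square zero    = *-identityˡ 1#
  [-1]^-square (suc n) = trans (solve 1 (λ x → :- con (+ 1) :* x :* (:- con (+ 1) :* x) := x :* x) refl ((- 1#) ^ n)) ([-1]^-square n)

  -- The signed K_n, mapped into the ring, solve the equation that determines G; the sign occurs on
  -- both sides and squares to 1.
  ιK≈bernoulli : ∀ n → ι (K n) ≈ bernoulli n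
  ιK≈bernoulli n = begin
    ι (K n)               ≈⟨ *-identityˡ _ ⟨
    1# * ι (K n)          ≈⟨ *-congʳ ([-1]^-square (suc n)) ⟨
    s * s * ι (K n)       ≈⟨ *-assoc _ _ _ ⟩
    s * (s * ι (K n))     ≈⟨ *-congˡ (*-congʳ (ι[-1]^ (suc n))) ⟨
    s * (ι ((ℚ.- 1ℚ) Q.^ suc n) * ι (K n))  ≈⟨ *-congˡ (ι.*-homo _ _) ⟨
    s * ι (signedK n)     ≈⟨ *-congˡ (G-unique (ι ∘ signedK) equation n) ⟩
    s * G n               ≈⟨ *-congˡ (G≈bernoulli n) ⟩
    s * (s * bernoulli n) ≈⟨ *-assoc _ _ _ ⟨
    s * s * bernoulli n   ≈⟨ *-congʳ ([-1]^-square (suc n)) ⟩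
    1# * bernoulli n      ≈⟨ *-identityˡ _ ⟩
    bernoulli n           ∎
    where
    s = (- 1#) ^ suc n
    equation : (1+w Ser.^ p Ser.- constant 1#) ⋆ (ι ∘ signedK) ≋ Ser.ιℤ (+ p) ⋆ w
    equation m = begin
      ((1+w Ser.^ p Ser.- constant 1#) ⋆ (ι ∘ signedK)) m     ≈⟨ ⋆-cong {b = ι ∘ signedK} ι-coeff-zᵖ-1 (λ _ → refl) m ⟨
      ((ι ∘ ℚ[q].coeff (zᵖ-1 p)) ⋆ (ι ∘ signedK)) m          ≈⟨ ι-⋆ (ℚ[q].coeff (zᵖ-1 p)) signedK m ⟨
      ι (ℚ[[q]]._⋆_ (ℚ[q].coeff (zᵖ-1 p)) signedK m)          ≈⟨ ι.⟦⟧-cong (≡.trans (≡.sym (⊛≡⋆ (ℚ[q].coeff (zᵖ-1 p)) signedK m)) (isK m)) ⟩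
      ι (ℚ[q].coeff (p·x p) m)                                ≈⟨ ι-coeff-p·x m ⟩
      (Ser.ιℤ (+ p) ⋆ w) m                                    ∎

  ι-weight : ∀ t i → ι (fromℤ (weight t i)) ≈ weight′ t i
  ι-weight t i = begin
    ι (fromℤ (weight t i))                          ≈⟨ ιℤ≈ (weight t i) ⟨
    ιℤ (weight t i)                                 ≈⟨ ιℤ-+ (+ (t ℕ.* a)) ((+ t ℤ.- ℤ.1ℤ) ℤ.* + a′) ⟩
    ιℤ (+ (t ℕ.* a)) + ιℤ ((+ t ℤ.- ℤ.1ℤ) ℤ.* + a′)
      ≈⟨ +-cong (trans (reflexive (cong ιℤ (ℤ.pos-* t a))) (ιℤ-* (+ t) (+ a))) (ιℤ-* (+ t ℤ.- ℤ.1ℤ) (+ a′)) ⟩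
    ιℤ (+ t) * ιℤ (+ a) + ιℤ (+ t ℤ.- ℤ.1ℤ) * ιℤ (+ a′)
      ≈⟨ +-congˡ (*-congʳ (trans (ιℤ-+ (+ t) (ℤ.- ℤ.1ℤ)) (+-congˡ (ιℤ-neg (+ 1))))) ⟩
    weight′ t i                                     ∎
    where
    import Data.Integer.Properties as ℤ
    a = (t ∸ 1) C i
    a′ = t C i

  ι-rhs : ∀ t → ι (Q.sum {suc t} λ i → (weight t (toℕ i) ℚ./ 1) ℚ.* ((ℚ.- 1ℚ) Q.^ toℕ i) ℚ.* K (2 ℕ.* t ∸ toℕ i)) ≈ closedForm t
  ι-rhs t = begin
    ι (Q.sum {suc t} (λ i → f (toℕ i)))
      ≈⟨ ι-sum {suc t} (λ i → f (toℕ i)) ⟩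
    Σ< (suc t) (λ i → ι (f i))
      ≈⟨ Σ<-cong (suc t) (λ i _ → termwise i) ⟩
    Σ< (suc t) (λ i → weight′ t i * ((- 1#) ^ i * bernoulli (2 ℕ.* t ∸ i)))
      ≈⟨ weightedSum t ⟩
    closedForm t ∎
    where
    f : ℕ → ℚ
    f i = (weight t i ℚ./ 1) ℚ.* ((ℚ.- 1ℚ) Q.^ i) ℚ.* K (2 ℕ.* t ∸ i)
    termwise : ∀ i → ι (f i) ≈ weight′ t i * ((- 1#) ^ i * bernoulli (2 ℕ.* t ∸ i))
    termwise i = begin
      ι (f i)
        ≈⟨ ι.*-homo (fromℤ (weight t i) ℚ.* ((ℚ.- 1ℚ) Q.^ i)) (K (2 ℕ.* t ∸ i)) ⟩
      ι (fromℤ (weight t i) ℚ.* ((ℚ.- 1ℚ) Q.^ i)) * ι (K (2 ℕ.* t ∸ i))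
        ≈⟨ *-cong (trans (ι.*-homo (fromℤ (weight t i)) ((ℚ.- 1ℚ) Q.^ i)) (*-cong (ι-weight t i) (ι[-1]^ i))) (ιK≈bernoulli (2 ℕ.* t ∸ i)) ⟩
      weight′ t i * (- 1#) ^ i * bernoulli (2 ℕ.* t ∸ i)
        ≈⟨ *-assoc _ _ _ ⟩
      weight′ t i * ((- 1#) ^ i * bernoulli (2 ℕ.* t ∸ i)) ∎

-- Sums over weakly increasing tuples

module TupleSum (R : ℚ-Algebra) (x : ℕ → ℚ-Algebra.Carrier R) where
  open ℚ-Algebra R
  open RangeSum semiring
  open Homogeneous R
  open import Relation.Binary.Reasoning.Setoid setoid

  listSum : ∀ {X : Set} → (X → Carrier) → List X → Carrier
  listSum g []       = 0#
  listSum g (v ∷ vs) = g v + listSum g vs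

  listSum-++ : ∀ {X : Set} (g : X → Carrier) us vs → listSum g (us ++ vs) ≈ listSum g us + listSum g vs
  listSum-++ g []       vs = sym (+-identityˡ _)
  listSum-++ g (u ∷ us) vs = trans (+-congˡ (listSum-++ g us vs)) (sym (+-assoc _ _ _))

  listSum-tabulate : ∀ {X : Set} {n} (g : X → Carrier) (f : Fin n → X) → listSum g (List.tabulate f) ≈ sum (g ∘ f)
  listSum-tabulate {n = zero}  g f = refl
  listSum-tabulate {n = suc n} g f = +-congˡ (listSum-tabulate g (f ∘ Fin.suc))

  listSum-cong : ∀ {X : Set} {f g : X → Carrier} → (∀ v → f v ≈ g v) → ∀ vs → listSum f vs ≈ listSum g vs
  listSum-cong f≈g []       = refl
  listSum-cong f≈g (v ∷ vs) = +-cong (f≈g v) (listSum-cong f≈g vs)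

  monomial : ∀ {n l} → Vec (Fin n) l → Carrier
  monomial []      = 1#
  monomial (k ∷ v) = x (toℕ k) * monomial v

  -- Linkedness of `j ∷ v` says that v is weakly increasing with all entries at least j, so
  -- prefixing j encodes the lower bound.
  from : ∀ n l → Fin n → List (Vec (Fin n) l)
  from n l j = List.filter (λ v → linked? Fin._≤?_ (j ∷ v)) (tuples n l)

  restrict : ℕ → (ℕ → Carrier) → ℕ → Carrier
  restrict j f i = if j ≤ᵇ i then f i else 0#

  Σ-restrict : ∀ n j f → j < n → Σ< n (restrict j f) ≈ f j + Σ< n (restrict (suc j) f)
  Σ-restrict (suc n) zero    f j<n = +-congˡ (sym (+-identityˡ _))
  Σ-restrict (suc n) (suc j) f (s≤s j<n) = begin
    0# + Σ< n (restrict (suc j) f ∘ suc)                ≈⟨ +-congˡ (Σ<-cong n (λ i _ → reflexive (shift j i))) ⟩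
    0# + Σ< n (restrict j (f ∘ suc))                    ≈⟨ +-identityˡ _ ⟩
    Σ< n (restrict j (f ∘ suc))                         ≈⟨ Σ-restrict n j (f ∘ suc) j<n ⟩
    f (suc j) + Σ< n (restrict (suc j) (f ∘ suc))       ≈⟨ +-congˡ (+-identityˡ _) ⟨
    f (suc j) + (0# + Σ< n (restrict (suc j) (f ∘ suc))) ∎
    where
    shift : ∀ j i → restrict (suc j) f (suc i) ≡ restrict j (f ∘ suc) i
    shift zero    i = ≡.refl
    shift (suc j) i = ≡.refl

  restrict-beyond : ∀ n f i → i < n → restrict n f i ≈ 0#
  restrict-beyond (suc n)       f zero    i<n       = refl
  restrict-beyond (suc (suc n)) f (suc i) (s≤s i<n) = restrict-beyond (suc n) (f ∘ suc) i i<n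
  restrict-beyond (suc zero)    f (suc i) (s≤s ())

  -- Tuples are peeled off from their smallest entry, whereas `h` adjoins its last variable. Listed
  -- from the top, the variables with index at least j are the first n - j ones.
  reversed : ℕ → ℕ → Carrier
  reversed n m = x (n ∸ suc m)

  -- The recursion of `h` in the number of variables, unrolled: each summand collects the monomials
  -- whose smallest index is i.
  Σ-restrict-h : ∀ n l m → m ≤ n → Σ< n (restrict (n ∸ m) (λ i → x i * h (reversed n) (n ∸ i) l)) ≈ h (reversed n) m (suc l)
  Σ-restrict-h n l zero    m≤n = Σ<-zero n _ (restrict-beyond n (λ i → x i * h (reversed n) (n ∸ i) l))
  Σ-restrict-h n l (suc m) m≤n = begin
    Σ< n (restrict (n ∸ suc m) f)
      ≈⟨ Σ-restrict n (n ∸ suc m) f (ℕ.∸-monoʳ-< {n} {suc m} {0} (s≤s z≤n) m≤n) ⟩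
    f (n ∸ suc m) + Σ< n (restrict (suc (n ∸ suc m)) f)
      ≈⟨ +-cong (*-congˡ (reflexive (cong (λ a → h (reversed n) a l) (ℕ.m∸[m∸n]≡n m≤n))))
           (trans (reflexive (cong (λ j → Σ< n (restrict j f)) (≡.sym (ℕ.+-∸-assoc 1 m≤n)))) (Σ-restrict-h n l m (ℕ.<⇒≤ m≤n))) ⟩
    reversed n m * h (reversed n) (suc m) l + h (reversed n) m (suc l)
      ≈⟨ +-comm _ _ ⟩
    h (reversed n) (suc m) (suc l) ∎
    where
    f : ℕ → Carrier
    f i = x i * h (reversed n) (n ∸ i) l

  listSum-filter-∷ : ∀ {n l} (j i : Fin n) (vs : List (Vec (Fin n) l)) →
    listSum monomial (List.filter (λ v → linked? Fin._≤?_ (j ∷ v)) (List.map (i ∷_) vs)) ≈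
    (if toℕ j ≤ᵇ toℕ i then x (toℕ i) * listSum monomial (List.filter (λ v → linked? Fin._≤?_ (i ∷ v)) vs) else 0#)
  listSum-filter-∷ j i [] with toℕ j ≤ᵇ toℕ i
  ... | true  = sym (zeroʳ _)
  ... | false = refl
  listSum-filter-∷ j i (v ∷ vs) with toℕ j ≤ᵇ toℕ i | does (linked? Fin._≤?_ (i ∷ v)) | listSum-filter-∷ j i vs
  ... | true  | true  | ih = trans (+-congˡ ih) (sym (distribˡ _ _ _))
  ... | true  | false | ih = ih
  ... | false | _     | ih = ih

  listSum-filter-product : ∀ {n l} (j : Fin n) (is : List (Fin n)) (vs : List (Vec (Fin n) l)) →
    listSum monomial (List.filter (λ v → linked? Fin._≤?_ (j ∷ v)) (List.cartesianProductWith _∷_ is vs)) ≈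
    listSum (λ i → if toℕ j ≤ᵇ toℕ i then x (toℕ i) * listSum monomial (List.filter (λ v → linked? Fin._≤?_ (i ∷ v)) vs) else 0#) is
  listSum-filter-product j []       vs = refl
  listSum-filter-product j (i ∷ is) vs = trans
    (reflexive (cong (listSum monomial) (filter-++ (λ v → linked? Fin._≤?_ (j ∷ v)) (List.map (i ∷_) vs) _)))
    (trans (listSum-++ monomial (List.filter (λ v → linked? Fin._≤?_ (j ∷ v)) (List.map (i ∷_) vs)) _)
      (+-cong (listSum-filter-∷ j i vs) (listSum-filter-product j is vs)))

  -- Induction on the length: the first entry i runs over i ≥ j, and the remaining entries form a
  -- tuple bounded below by i.
  listSum-from : ∀ n l j → listSum monomial (from n l j) ≈ h (reversed n) (n ∸ toℕ j) l
  listSum-from n zero    j = +-identityʳ 1#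
  listSum-from n (suc l) j = begin
    listSum monomial (from n (suc l) j)
      ≈⟨ listSum-filter-product j (List.allFin n) (tuples n l) ⟩
    listSum (λ i → if toℕ j ≤ᵇ toℕ i then x (toℕ i) * listSum monomial (from n l i) else 0#) (List.allFin n)
      ≈⟨ listSum-tabulate {n = n} (λ i → if toℕ j ≤ᵇ toℕ i then x (toℕ i) * listSum monomial (from n l i) else 0#) id ⟩
    sum {n} (λ i → if toℕ j ≤ᵇ toℕ i then x (toℕ i) * listSum monomial (from n l i) else 0#)
      ≈⟨ sum-cong-≋ {n} step ⟩
    Σ< n (restrict (toℕ j) f)
      ≈⟨ reflexive (cong (λ a → Σ< n (restrict a f)) (≡.sym (ℕ.m∸[m∸n]≡n j≤n))) ⟩
    Σ< n (restrict (n ∸ (n ∸ toℕ j)) f)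
      ≈⟨ Σ-restrict-h n l (n ∸ toℕ j) (ℕ.m∸n≤m n (toℕ j)) ⟩
    h (reversed n) (n ∸ toℕ j) (suc l) ∎
    where
    f : ℕ → Carrier
    f i = x i * h (reversed n) (n ∸ i) l
    j≤n : toℕ j ≤ n
    j≤n = ℕ.<⇒≤ (Fin.toℕ<n j)
    step : ∀ i → (if toℕ j ≤ᵇ toℕ i then x (toℕ i) * listSum monomial (from n l i) else 0#) ≈ restrict (toℕ j) f (toℕ i)
    step i with toℕ j ≤ᵇ toℕ i
    ... | true  = *-congˡ (listSum-from n l i)
    ... | false = refl

  -- A lower bound of zero is no restriction, so every increasing tuple occurs in `from` at zero.
  listSum-increasing : ∀ n l → listSum monomial (increasing (suc n) l) ≈ h (reversed (suc n)) (suc n) l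
  listSum-increasing n l = trans
    (reflexive (cong (listSum monomial) (filter-≐ (linked? Fin._≤?_) (λ v → linked? Fin._≤?_ (Fin.zero ∷ v)) (cons , Linked.tail) (tuples (suc n) l))))
    (listSum-from (suc n) l Fin.zero)
    where
    cons : ∀ {l} {v : Vec (Fin (suc n)) l} → Linked Fin._≤_ v → Linked Fin._≤_ (Fin.zero ∷ v)
    cons {v = []}    _ = [-]
    cons {v = _ ∷ _} l = z≤n ∷ l

-- Reduction of fractions modulo [p]

module Evaluation (A : ℚ-Algebra) (Q : QIntegers A) (r : ℕ) (p-prime : Prime (suc r)) where
  private module Base = ℚ-Algebra A
  open QIntegers Q
  open CyclotomicRing A Q r p-prime public
  open ℚ-Algebra R
  open Solver using (solve; _:=_; _:+_; _:*_; _:-_; :-_; con)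
  open import Relation.Binary.Reasoning.Setoid setoid

  1<p : 1 < p
  1<p = ℕ.nonTrivial⇒n>1 p ⦃ prime⇒nonTrivial p-prime ⦄

  -- The fraction n / m is defined modulo [ p ] and has residue class x.
  infix 4 _/_⇝_
  _/_⇝_ : Carrier → Carrier → Carrier → Set
  n / m ⇝ x = Unit m × (n ~ x * m)

  ⇝-resp : ∀ {n m x x′} → x ~ x′ → n / m ⇝ x → n / m ⇝ x′
  ⇝-resp {m = m} x~x′ (um , e) = um , trans e (*-congʳ {m} x~x′)

  ⇝-1 : ∀ n → n / 1# ⇝ n
  ⇝-1 n = unit-1 , sym (*-identityʳ n)

  ⇝-+ : ∀ {n m x n′ m′ x′} → n / m ⇝ x → n′ / m′ ⇝ x′ → n * m′ + n′ * m / m * m′ ⇝ x + x′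
  ⇝-+ {n} {m} {x} {n′} {m′} {x′} (um , e) (um′ , e′) = unit-* um um′ , (begin
    n * m′ + n′ * m                  ≈⟨ +-cong (*-congʳ {m′} e) (*-congʳ {m} e′) ⟩
    x * m * m′ + x′ * m′ * m         ≈⟨ solve 4 (λ x x′ m m′ → x :* m :* m′ :+ x′ :* m′ :* m := (x :+ x′) :* (m :* m′)) refl x x′ m m′ ⟩
    (x + x′) * (m * m′)              ∎)

  ⇝-* : ∀ {n m x n′ m′ x′} → n / m ⇝ x → n′ / m′ ⇝ x′ → n * n′ / m * m′ ⇝ x * x′
  ⇝-* {n} {m} {x} {n′} {m′} {x′} (um , e) (um′ , e′) = unit-* um um′ , (begin
    n * n′                           ≈⟨ *-cong e e′ ⟩
    x * m * (x′ * m′)                ≈⟨ solve 4 (λ x x′ m m′ → x :* m :* (x′ :* m′) := x :* x′ :* (m :* m′)) refl x x′ m m′ ⟩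
    x * x′ * (m * m′)                ∎)

  ⇝-neg : ∀ {n m x} → n / m ⇝ x → - n / m ⇝ - x
  ⇝-neg {n} {m} {x} (um , e) = um , trans (-‿cong e) (solve 2 (λ x m → :- (x :* m) := :- x :* m) refl x m)

  open Cotangent R r ρ using (y; y-even)
  open RootSums R r ρ using (closedForm; h≈closedForm-suc)
  open Bernoulli R r ρ 1<p using (closedForm-zero)

  x : ℕ → Carrier
  x j = (1# - ζ) * (1# - ζ) * y (suc j)

  [1-ζ]*[] : ∀ k → (1# - ζ) * [ k ] ~ 1# - ζ ^ k
  [1-ζ]*[] k = trans (≈⇒~ ([1-q]*[] k)) (reflexive (cong (λ x → 1# - x) (≡.sym (^-base ζ k))))

  -- Multiplying y_k = d_k^2 - d_k by (1 - ζ^k)^2 gives ζ^k, and 1 - ζ^k = (1 - ζ) `[ k ]`. The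
  -- latter also makes `[ k ]` a unit.
  term-⇝ : ∀ j → j < r → q Base.^ (1 ℕ.* suc j) / [ suc j ] Base.^ 2 ⇝ x j
  term-⇝ j j<r = ≡.subst Unit (^-base [ k ] 2) (unit-^ 2 unit-[k]) , (begin
    ζ Base.^ (1 ℕ.* k)      ≡⟨ ≡.trans (cong (ζ Base.^_) (ℕ.*-identityˡ k)) (≡.sym (^-base ζ k)) ⟩
    ζ ^ k                   ≈⟨ solve 2 (λ z e → z := con (+ 1) :* con (+ 1) :- con (+ 1) :* (con (+ 1) :- z)) refl (ζ ^ k) (d k) ⟩
    1# * 1# - 1# * (1# - ζ ^ k)
      ≈⟨ +-cong (*-cong u u) (-‿cong (*-congʳ {1# - ζ ^ k} u)) ⟨
    (1# - ζ ^ k) * d k * ((1# - ζ ^ k) * d k) - (1# - ζ ^ k) * d k * (1# - ζ ^ k)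
      ≈⟨ solve 2 (λ a d → a :* d :* (a :* d) :- a :* d :* a := a :* a :* (d :* d :- d)) refl (1# - ζ ^ k) (d k) ⟩
    (1# - ζ ^ k) * (1# - ζ ^ k) * y k
      ≈⟨ *-congʳ {y k} (*-cong ([1-ζ]*[] k) ([1-ζ]*[] k)) ⟨
    (1# - ζ) * [ k ] * ((1# - ζ) * [ k ]) * y k
      ≈⟨ solve 3 (λ a n y → a :* n :* (a :* n) :* y := a :* a :* y :* (n :* (n :* con (+ 1)))) refl (1# - ζ) [ k ] (y k) ⟩
    (1# - ζ) * (1# - ζ) * y k * [ k ] ^ 2
      ≡⟨ cong (x j *_) (^-base [ k ] 2) ⟩
    x j * [ k ] Base.^ 2    ∎)
    where
    k = suc j
    p∤k : p ∤ k
    p∤k = >⇒∤ (s≤s j<r)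
    u : (1# - ζ ^ k) * d k ~ 1#
    u = d-inverse {k} p∤k
    unit-[k] : Unit [ k ]
    unit-[k] = unit-∣ (1# - ζ) [ k ] (sym ([1-ζ]*[] k)) (d k , trans (*-comm (d k) (1# - ζ ^ k)) u)

  open Homogeneous R
  open TupleSum R x using (reversed)

  p-odd : 2 < p → ∀ {k} → p ∤ k → p ∤ k ℕ.+ k
  p-odd 2<p {k} p∤k p∣2k with euclidsLemma 2 k p-prime (≡.subst (p ∣_) (cong (k ℕ.+_) (≡.sym (ℕ.+-identityʳ k))) p∣2k)
  ... | inj₁ p∣2 = >⇒∤ 2<p p∣2
  ... | inj₂ p∣k = p∤k p∣k

  -- For t > 0 the bound gives p > 2, so that p divides 2k only if it divides k, as the Riccati
  -- argument requires. At t = 0 both sides are 1.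
  h≈closedForm : ∀ t → 2 ℕ.* t ℕ.+ 1 < p → h (y ∘ suc) r t ~ closedForm t
  h≈closedForm zero    _     = sym closedForm-zero
  h≈closedForm (suc s) 2t+1<p = h≈closedForm-suc (λ {k} → p-odd 2<p {k}) s
    where
    2<p : 2 < p
    2<p = ℕ.≤-<-trans (ℕ.≤-trans (ℕ.*-monoʳ-≤ 2 (s≤s (z≤n {s}))) (ℕ.m≤m+n (2 ℕ.* suc s) 1)) 2t+1<p

  -- Reversing the variables is the reflection k ↦ p - k, under which y is invariant; the factor (1
  -- - ζ)^2 of each variable then comes out by homogeneity.
  h-reversed : ∀ t → h (reversed r) r t ~ (1# - ζ) ^ (2 ℕ.* t) * h (y ∘ suc) r t
  h-reversed t = begin
    h (reversed r) r t
      ≈⟨ h-cong r (λ i i<r → *-congˡ {(1# - ζ) * (1# - ζ)} (reflect i i<r)) t ⟩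
    h (λ i → (1# - ζ) * (1# - ζ) * y (suc i)) r t
      ≈⟨ h-scale ((1# - ζ) * (1# - ζ)) (y ∘ suc) r t ⟩
    ((1# - ζ) * (1# - ζ)) ^ t * h (y ∘ suc) r t
      ≈⟨ *-congʳ {h (y ∘ suc) r t} (trans (^-congˡ t (*-congˡ {1# - ζ} (sym (*-identityʳ (1# - ζ))))) (^-assocʳ (1# - ζ) 2 t)) ⟩
    (1# - ζ) ^ (2 ℕ.* t) * h (y ∘ suc) r t ∎
    where
    reflect : ∀ i → i < r → y (suc (r ∸ suc i)) ~ y (suc i)
    reflect i i<r = y-even {suc i} (≡.subst (p ∣_) (≡.sym eq) ∣-refl)
      where
      eq : suc i ℕ.+ suc (r ∸ suc i) ≡ p
      eq = ≡.trans (ℕ.+-suc (suc i) (r ∸ suc i)) (cong suc (ℕ.m+[n∸m]≡n i<r))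

  evaluated : ∀ t → 2 ℕ.* t ℕ.+ 1 < p → ∀ K → IsK p K →
    h (reversed r) r t ~ (1# - ζ) ^ (2 ℕ.* t) *
      ι (Q.sum {suc t} λ i → (weight t (toℕ i) ℚ./ 1) ℚ.* ((ℚ.- 1ℚ) Q.^ toℕ i) ℚ.* K (2 ℕ.* t ∸ toℕ i))
  evaluated t 2t+1<p K isK = trans (h-reversed t) (*-congˡ {(1# - ζ) ^ (2 ℕ.* t)}
    (trans (h≈closedForm t 2t+1<p) (sym (ι-rhs R r ρ 1<p K isK t))))

  -- A unit g modulo `[ p ]` satisfies u g - v `[ p ]` = 1 in the base ring, and x divides the left
  -- side.
  ∣-unit : ∀ {g x a b} → Unit g → a * x Base.≈ g → b * x Base.≈ [ p ] → ∃[ c ] c * x Base.≈ 1#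
  ∣-unit {g} {x} {a} {b} (u , v , vp≈ug-1) ax≈g bx≈p = u * a - v * b , Base.trans
    (Solve.solve 5 (λ u a v b x → (u Solve.:* a Solve.:- v Solve.:* b) Solve.:* x Solve.:= u Solve.:* (a Solve.:* x) Solve.:- v Solve.:* (b Solve.:* x)) Base.refl u a v b x)
    (Base.trans (Base.+-cong (Base.*-congˡ ax≈g) (Base.-‿cong (Base.trans (Base.*-congˡ bx≈p) vp≈ug-1)))
      (Solve.solve 1 (λ s → s Solve.:- (s Solve.:- Solve.con (+ 1)) Solve.:= Solve.con (+ 1)) Base.refl (u * g)))
    where module Solve = Base.Solver

  unit-ι : ∀ n → Unit (ι (fromℤ (+ suc n)))
  unit-ι n = ι⁻¹ n , trans (*-congˡ {ι⁻¹ n} (sym (ιℤ≈ (+ suc n)))) (ιℤ-inverse n)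

  unit-resp : ∀ {x y} → x Base.≈ y → Unit x → Unit y
  unit-resp {x} {y} x≈y (u , e) = u , trans (*-congˡ {u} (sym (≈⇒~ x≈y))) e

  num-∣ : ∀ n m → n / m ⇝ 0# → ∃[ k ] k * [ p ] Base.≈ n
  num-∣ n m (_ , e) = ~0⇒∣ (trans e (zeroˡ m))

  unit-scaled : ∀ g m a b → g Base.≈ ι (fromℤ (+ suc a)) * (ι (fromℤ (+ suc b)) * m) → Unit m → Unit g
  unit-scaled g m a b g≈ um = unit-resp (Base.sym g≈) (unit-* (unit-ι a) (unit-* (unit-ι b) um))

  ⇝-subtract : ∀ n m n′ m′ x → n / m ⇝ x → n′ / m′ ⇝ x → n * m′ + (- n′) * m / m * m′ ⇝ 0#
  ⇝-subtract n m n′ m′ x e e′ = ⇝-resp (-‿inverseʳ x) (⇝-+ e (⇝-neg e′))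

module CrossMultiply (A : ℚ-Algebra) where
  open ℚ-Algebra A
  open Solver using (solve; _:=_; _:*_)
  open import Relation.Binary.Reasoning.Setoid setoid

  cross-multiply : ∀ {num den tf tg h π n m} →
    h * π ≈ num → tf ≈ m * (n * h) * π → tg ≈ n * (m * den) → num * tg ≈ tf * den
  cross-multiply {num} {den} {tf} {tg} {h} {π} {n} {m} hπ tf≈ tg≈ = begin
    num * tg                       ≈⟨ *-cong (sym hπ) tg≈ ⟩
    h * π * (n * (m * den))        ≈⟨ solve 5 (λ h π n m e → h :* π :* (n :* (m :* e)) := m :* (n :* h) :* π :* e) refl h π n m den ⟩
    m * (n * h) * π * den          ≈⟨ *-congʳ tf≈ ⟨
    tf * den                       ∎

-- Clearing denominators

module _ where
  open ℚ[q] using (coeff)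

  fromℤ-↥ : ∀ a → fromℤ (ℚ.↥ a) ≡ fromℤ (ℚ.↧ a) ℚ.* a
  fromℤ-↥ a@(ℚ.mkℚ n m _) = ℚ.toℚᵘ-injective (ℚᵘ.≃-trans (toℚᵘ-fromℤ n) (ℚᵘ.≃-sym
    (ℚᵘ.≃-trans (ℚ.toℚᵘ-homo-* (fromℤ (+ suc m)) a) (ℚᵘ.≃-trans (ℚᵘ.*-cong (toℚᵘ-fromℤ (+ suc m)) ℚᵘ.≃-refl)
      (ℚᵘ.*≡* (≡.trans (ℤ.*-identityʳ (+ suc m ℤ.* n)) (≡.trans (ℤ.*-comm (+ suc m) n) (cong (n ℤ.*_) (cong +_ (≡.sym (ℕ.*-identityˡ (suc m))))))))))))

  coeff-toℚ-scale : ∀ c f n → coeff (toℚ[q] (List.map (c ℤ.*_) f)) n ≡ fromℤ c ℚ.* coeff (toℚ[q] f) n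
  coeff-toℚ-scale c []      n       = ≡.sym (ℚ.*-zeroʳ (fromℤ c))
  coeff-toℚ-scale c (a ∷ f) zero    = fromℤ-* c a
  coeff-toℚ-scale c (a ∷ f) (suc n) = coeff-toℚ-scale c f n

  clear : ∀ f → ∃[ N ] ∃[ f′ ] (∀ n → coeff (toℚ[q] f′) n ≡ fromℤ (+ suc N) ℚ.* coeff f n)
  clear []      = 0 , [] , λ n → ≡.sym (ℚ.*-zeroʳ (fromℤ (+ 1)))
  clear (a ∷ f) with clear f
  -- The common denominator is the product (m + 1)(N + 1) of that of a and that of the tail; its
  -- predecessor N + m (N + 1) is stored, so positivity is built in.
  ... | N , f′ , e = N ℕ.+ m ℕ.* suc N , (ℚ.↥ a ℤ.* + suc N) ∷ List.map (+ suc m ℤ.*_) f′ , coefficients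
    where
    open ≡.≡-Reasoning
    m = ℚ.denominator-1 a
    M = fromℤ (+ suc m)
    collect : ∀ b → M ℚ.* (fromℤ (+ suc N) ℚ.* b) ≡ fromℤ (+ (suc m ℕ.* suc N)) ℚ.* b
    collect b = ≡.trans (≡.sym (ℚ.*-assoc M (fromℤ (+ suc N)) b))
      (cong (ℚ._* b) (≡.trans (≡.sym (fromℤ-* (+ suc m) (+ suc N))) (cong fromℤ (≡.sym (ℤ.pos-* (suc m) (suc N))))))
    coefficients : ∀ n → coeff (toℚ[q] ((ℚ.↥ a ℤ.* + suc N) ∷ List.map (+ suc m ℤ.*_) f′)) n ≡ fromℤ (+ (suc m ℕ.* suc N)) ℚ.* coeff (a ∷ f) n
    coefficients zero    = begin
      fromℤ (ℚ.↥ a ℤ.* + suc N)             ≡⟨ fromℤ-* (ℚ.↥ a) (+ suc N) ⟩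
      fromℤ (ℚ.↥ a) ℚ.* fromℤ (+ suc N)     ≡⟨ cong (ℚ._* fromℤ (+ suc N)) (fromℤ-↥ a) ⟩
      M ℚ.* a ℚ.* fromℤ (+ suc N)           ≡⟨ ℚ.*-assoc M a (fromℤ (+ suc N)) ⟩
      M ℚ.* (a ℚ.* fromℤ (+ suc N))         ≡⟨ cong (M ℚ.*_) (ℚ.*-comm a (fromℤ (+ suc N))) ⟩
      M ℚ.* (fromℤ (+ suc N) ℚ.* a)         ≡⟨ collect a ⟩
      fromℤ (+ (suc m ℕ.* suc N)) ℚ.* a     ∎
    coefficients (suc n) = begin
      coeff (toℚ[q] (List.map (+ suc m ℤ.*_) f′)) n   ≡⟨ coeff-toℚ-scale (+ suc m) f′ n ⟩
      M ℚ.* coeff (toℚ[q] f′) n                       ≡⟨ cong (M ℚ.*_) (e n) ⟩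
      M ℚ.* (fromℤ (+ suc N) ℚ.* coeff f n)           ≡⟨ collect (coeff f n) ⟩
      fromℤ (+ (suc m ℕ.* suc N)) ℚ.* coeff f n       ∎

  toℚ-+ : ∀ f g → toℚ[q] (f ℤ[q].+ᴾ g) ≡ toℚ[q] f ℚ[q].+ᴾ toℚ[q] g
  toℚ-+ []      g       = ≡.refl
  toℚ-+ (a ∷ f) []      = ≡.refl
  toℚ-+ (a ∷ f) (b ∷ g) = cong₂ _∷_ (fromℤ-+ a b) (toℚ-+ f g)

  toℚ-scale : ∀ c f → toℚ[q] (List.map (c ℤ.*_) f) ≡ List.map (fromℤ c ℚ.*_) (toℚ[q] f)
  toℚ-scale c []      = ≡.refl
  toℚ-scale c (a ∷ f) = cong₂ _∷_ (fromℤ-* c a) (toℚ-scale c f)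

  toℚ-* : ∀ f g → toℚ[q] (f ℤ[q].*ᴾ g) ≡ toℚ[q] f ℚ[q].*ᴾ toℚ[q] g
  toℚ-* []      g = ≡.refl
  toℚ-* (a ∷ f) g = ≡.trans (toℚ-+ (List.map (a ℤ.*_) g) _)
    (cong₂ ℚ[q]._+ᴾ_ (toℚ-scale a g) (cong (0ℚ ∷_) (toℚ-* f g)))

  toℚ-[] : ∀ n → toℚ[q] ℤ[q].[ n ] ≡ ℚ[q].[ n ]
  toℚ-[] zero    = ≡.refl
  toℚ-[] (suc n) = cong (1ℚ ∷_) (toℚ-[] n)

  coeff-const* : ∀ c f n → coeff ((c ∷ []) ℚ[q].*ᴾ f) n ≡ c ℚ.* coeff f n
  coeff-const* c f n = ≡.trans (coeff-⋆ (c ∷ []) f n) (≡.trans (ℚ[[q]].⋆-cong {b = coeff f} (coeff-const c) (λ _ → ≡.refl) n) (ℚ[[q]].constant-⋆ c (coeff f) n))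

  toℚ-scaled : ∀ c f′ N f → (∀ n → coeff (toℚ[q] f′) n ≡ fromℤ N ℚ.* coeff f n) →
    toℚ[q] (List.map (c ℤ.*_) f′) ℚ[q].≈ᴾ (fromℤ c ∷ []) ℚ[q].*ᴾ ((fromℤ N ∷ []) ℚ[q].*ᴾ f)
  toℚ-scaled c f′ N f e n = ≡.trans (coeff-toℚ-scale c f′ n) (≡.sym (≡.trans (coeff-const* (fromℤ c) ((fromℤ N ∷ []) ℚ[q].*ᴾ f) n)
    (cong (fromℤ c ℚ.*_) (≡.trans (coeff-const* (fromℤ N) f n) (≡.sym (e n))))))

-- From residue classes to the congruence of rational functions

module _ (r : ℕ) (p-prime : Prime (suc r)) where
  open Evaluation ℚ[q]-algebra ℚ[q]-integers r p-prime
  private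
    module P = ℚ-Algebra ℚ[q]-algebra
    module R = ℚ-Algebra R

  infix 4 _⇝_
  _⇝_ : ℚ⟨q⟩ → ℚ[q].Poly → Set
  A ⇝ x = num A / den A ⇝ x

  -- The numerator is k times `[ p ]`. Denominators are cleared in the cofactor k, by N, and in the
  -- denominator of the fraction, by M; then f = M N k `[ p ]` keeps `[ p ]` as a visible integer
  -- factor, and g is the denominator scaled by M N. Coprimality holds because g is a unit modulo
  -- `[ p ]`.
  vanish⇒≡mod : ∀ A B → (A F.- B) ⇝ P.0# → A ≡ B mod[ p ]
  vanish⇒≡mod A B C⇝0 =
    f , g , g≉0 , cross , coprime , (f₀ , λ n → ≡.refl)
    where
    C = A F.- B
    divisible : ∃[ k ] k P.* ℚ[q].[ p ] P.≈ num C
    divisible = num-∣ (num C) (den C) C⇝0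
    k : ℚ[q].Poly
    k = proj₁ divisible
    clear-k = clear k
    clear-den = clear (den C)
    N M : ℤ
    N = + suc (proj₁ clear-k)
    M = + suc (proj₁ clear-den)
    f₀ f g : ℤ[q].Poly
    f₀ = List.map (M ℤ.*_) (proj₁ (proj₂ clear-k))
    f  = f₀ ℤ[q].*ᴾ ℤ[q].[ p ]
    g  = List.map (N ℤ.*_) (proj₁ (proj₂ clear-den))
    toℚ-f₀ : toℚ[q] f₀ P.≈ P.ι (fromℤ M) P.* (P.ι (fromℤ N) P.* k)
    toℚ-f₀ = toℚ-scaled M (proj₁ (proj₂ clear-k)) N k (proj₂ (proj₂ clear-k))
    toℚ-f : toℚ[q] f P.≈ P.ι (fromℤ M) P.* (P.ι (fromℤ N) P.* k) P.* ℚ[q].[ p ]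
    toℚ-f n = ≡.trans
      (cong (λ h → ℚ[q].coeff h n) (≡.trans (toℚ-* f₀ ℤ[q].[ p ]) (cong (toℚ[q] f₀ ℚ[q].*ᴾ_) (toℚ-[] p))))
      (P.*-congʳ {ℚ[q].[ p ]} {toℚ[q] f₀} {P.ι (fromℤ M) P.* (P.ι (fromℤ N) P.* k)} toℚ-f₀ n)
    toℚ-g : toℚ[q] g P.≈ P.ι (fromℤ N) P.* (P.ι (fromℤ M) P.* den C)
    toℚ-g = toℚ-scaled N (proj₁ (proj₂ clear-den)) M (den C) (proj₂ (proj₂ clear-den))
    unit-g : Unit (toℚ[q] g)
    unit-g = unit-scaled (toℚ[q] g) (den C) (proj₁ clear-k) (proj₁ clear-den) toℚ-g (proj₁ C⇝0)
    cross : num C P.* toℚ[q] g P.≈ toℚ[q] f P.* den C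
    cross = CrossMultiply.cross-multiply ℚ[q]-algebra {num C} {den C} {toℚ[q] f} {toℚ[q] g} {k} {ℚ[q].[ p ]} {P.ι (fromℤ N)} {P.ι (fromℤ M)}
      (proj₂ divisible) toℚ-f toℚ-g
    const≉0 : ∀ n → ¬ (fromℤ (+ suc n) ∷ []) ℚ[q].≈ᴾ []
    const≉0 n e with fromℤ-injective {+ suc n} {+ 0} (e 0)
    ... | ()
    g≉0 : ¬ toℚ[q] g ℚ[q].≈ᴾ []
    g≉0 g≈0 = *-≉0 {fromℤ N ∷ []} {(fromℤ M ∷ []) ℚ[q].*ᴾ den C} (const≉0 (proj₁ clear-k))
      (*-≉0 {fromℤ M ∷ []} {den C} (const≉0 (proj₁ clear-den)) (den≉0 C))
      (λ n → ≡.trans (≡.sym (toℚ-g n)) (g≈0 n))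
    coprime : ℚ[q].Coprimeᴾ (toℚ[q] g) ℚ[q].[ p ]
    coprime {x} (a , ax≈g) (b , bx≈p) = proj₁ c , proj₂ c
      where c = ∣-unit {toℚ[q] g} {x} {a} {b} unit-g ax≈g bx≈p

  ⇝-≡mod : ∀ A B x → A ⇝ x → B ⇝ x → A ≡ B mod[ p ]
  ⇝-≡mod A B x A⇝x B⇝x = vanish⇒≡mod A B (⇝-subtract (num A) (den A) (num B) (den B) x A⇝x B⇝x)

  ⇝-^ : ∀ A x → A ⇝ x → ∀ n → (A F.^ n) ⇝ (x R.^ n)
  ⇝-^ A x A⇝x zero    = ⇝-1 P.1#
  ⇝-^ A x A⇝x (suc n) = ⇝-* {num A} {den A} {x} {num (A F.^ n)} {den (A F.^ n)} {x R.^ n} A⇝x (⇝-^ A x A⇝x n)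

  1-q⇝ : 1-q ⇝ (P.1# R.- ζ)
  1-q⇝ = ⇝-+ {P.1#} {P.1#} {P.1#} {P.- ζ} {P.1#} {P.- ζ} (⇝-1 P.1#) (⇝-neg {ζ} {P.1#} {ζ} (⇝-1 ζ))

  open TupleSum R x using (monomial; listSum; listSum-increasing)

  summand-⇝ : ∀ {l} (v : Vec (Fin r) l) → summand (replicate l 2) v ⇝ monomial v
  summand-⇝ []      = ⇝-1 P.1#
  summand-⇝ {suc l} (k ∷ v) = ⇝-* {num (term 2 (toℕ k))} {den (term 2 (toℕ k))} {x (toℕ k)}
    {num (summand (replicate l 2) v)} {den (summand (replicate l 2) v)} {monomial v}
    (term-⇝ (toℕ k) (Fin.toℕ<n k)) (summand-⇝ v)

  sum-⇝ : ∀ {l} (vs : List (Vec (Fin r) l)) → List.foldr F._+_ F.0# (List.map (summand (replicate l 2)) vs) ⇝ listSum monomial vs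
  sum-⇝ []       = ⇝-1 P.0#
  sum-⇝ {l} (v ∷ vs) = ⇝-+ {num A} {den A} {monomial v} {num B} {den B} {listSum monomial vs} (summand-⇝ v) (sum-⇝ vs)
    where
    A = summand (replicate l 2) v
    B = List.foldr F._+_ F.0# (List.map (summand (replicate l 2)) vs)

  congruence : ∀ t → p > 2 ℕ.* t ℕ.+ 1 → ∀ (K : ℕ → ℚ) → IsK p K →
    S r (replicate t 2) ≡ (1-q F.^ (2 ℕ.* t)) F.* const (Q.sum {suc t} λ i →
      (weight t (toℕ i) ℚ./ 1) ℚ.* ((ℚ.- 1ℚ) Q.^ toℕ i) ℚ.* K (2 ℕ.* t ∸ toℕ i)) mod[ p ]
  congruence t 2t+1<p K isK = ⇝-≡mod A B rhs
    (⇝-resp {num A} {den A} {listSum monomial (increasing r t)} {rhs}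
      (R.trans {listSum monomial (increasing r t)} (listSum-h r (ℕ.≤-pred 1<p)) (evaluated t 2t+1<p K isK))
      (sum-⇝ (increasing r t)))
    (⇝-* {num (1-q F.^ (2 ℕ.* t))} {den (1-q F.^ (2 ℕ.* t))} {(P.1# R.- ζ) R.^ (2 ℕ.* t)} {c ∷ []} {P.1#} {c ∷ []}
      (⇝-^ 1-q (P.1# R.- ζ) 1-q⇝ (2 ℕ.* t)) (⇝-1 (c ∷ [])))
    where
    c : ℚ
    c = Q.sum {suc t} λ i → (weight t (toℕ i) ℚ./ 1) ℚ.* ((ℚ.- 1ℚ) Q.^ toℕ i) ℚ.* K (2 ℕ.* t ∸ toℕ i)
    A = S r (replicate t 2)
    B = (1-q F.^ (2 ℕ.* t)) F.* const c
    rhs = (P.1# R.- ζ) R.^ (2 ℕ.* t) R.* R.ι c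
    open Homogeneous R using (h)
    listSum-h : ∀ n → 0 < n → listSum monomial (increasing n t) R.≈ h (TupleSum.reversed R x n) n t
    -- The range 1, ..., p - 1 is nonempty as p > 1, and so has the least index that serves as lower
    -- bound.
    listSum-h (suc n) _ = listSum-increasing n t

open import Data.Nat.Base using (_+_; _*_)

theorem4p3 : ∀ (t p : ℕ) → Prime p → p > 2 * t + 1 →
    ∀ (K : ℕ → ℚ) → IsK p K →
    S (p ∸ 1) (replicate t 2)
    ≡ (1-q F.^ (2 * t)) F.* const (Q.sum {suc t} λ i →
    (weight t (toℕ i) ℚ./ 1) ℚ.* ((ℚ.- 1ℚ) Q.^ toℕ i) ℚ.* K (2 * t ∸ toℕ i))
    mod[ p ]
theorem4p3 t zero    p-prime () K isK
theorem4p3 t (suc r) p-prime 2t+1<p K isK = congruence r p-prime t 2t+1<p K isK
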